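{- Let $\lambda$ be an uncountable cardinal and let $\theta=\mathrm{cf}(\theta)\le\lambda$ be a regular cardinal. Let $$\Theta_\lambda=\Theta_{\lambda,\theta}=\{\mathrm{cf}(\lambda),\theta\},$$ except when $\lambda=\mu^+$ with $\mu>\mathrm{cf}(\mu)$, in which case $\Theta_\lambda=\{\mathrm{cf}(\lambda),\mathrm{cf}(\mu),\theta\}$. Let $$\Theta'_\lambda=\{\sigma<\lambda:\sigma=\mathrm{cf}(\sigma)\text{ and }\lambda^{\langle\lambda;\sigma\rangle}=\lambda\}.$$ If $G$ is a locally finite group of cardinality $\lambda$, then there is a locally finite group $H$ of cardinality $\lambda$ extending $G$ which is $(\Theta'_\lambda\setminus\Theta_\lambda)$-indecomposable.
   Context: A group is locally finite if each finitely generated subgroup is finite. For a regular (infinite) cardinal $\sigma$, a group $M$ is $\sigma$-indecomposable if for every $\subseteq$-increasing sequence $\langle M_i:i<\sigma\rangle$ of subgroups with union $M$ we have $M=M_i$ for some $i<\sigma$. For a set $\Theta$ of regular cardinals, $M$ is $\Theta$-indecomposable if it is $\sigma$-indecomposable for every $\sigma\in\Theta$. For cardinals $\lambda\ge\theta\ge\sigma$, $\lambda^{\langle\theta;\sigma\rangle}$ is the minimal cardinality $|\mathcal{P}|$ of a family $\mathcal{P}\subseteq[\lambda]^\sigma$ such that for every $u\in[\lambda]^\theta$ there is $v\in[u]^\sigma$ which belongs to $\mathcal{P}$. Here $[A]^\sigma$ is the set of subsets of $A$ of cardinality $\sigma$. -}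

module Defs where

open import Algebra.Bundles using (Group)
open import Algebra.Morphism.Structures using (IsGroupMonomorphism)
open import Data.Fin.Base using (Fin)
open import Data.List.Base using (List)
open import Data.List.Relation.Unary.All using (All)
open import Data.Nat.Base using (ℕ)
open import Data.Product using (Σ; Σ-syntax; ∃; ∃-syntax; _×_; _,_; proj₁; proj₂)
open import Data.Sum.Base using (_⊎_)
open import Function.Bundles using (Func; Injection; Bijection)
open import Induction.WellFounded using (WellFounded)
open import Level using (Level; Setω; suc; _⊔_)
open import Relation.Binary.Bundles using (Setoid; StrictTotalOrder)
open import Relation.Binary.Core using (REL)
open import Relation.Binary.Definitions using (_Respects_; _Respectsˡ_; _Respectsʳ_)
import Relation.Binary.Construct.On as On
import Relation.Binary.Construct.StrictToNonStrict as NonStrict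
open import Relation.Binary.PropositionalEquality.Properties using (setoid)
open import Relation.Nullary.Negation.Core using (¬_)
open import Relation.Unary using (Pred; _⊆_; _≐_)
open import Relation.Unary.Properties using (≐-refl; ≐-sym; ≐-trans)

private
  variable
    a b c d ℓ p : Level

-- Extensional choice: since the chosen function must respect the setoid
-- equality, this is not derivable by projecting out of Σ.  It is used, together
-- with excluded middle, as a hypothesis making the ambient theory classical.
AxiomOfChoice : Setω
AxiomOfChoice =
  ∀ {i i′ x x′ r} (I : Setoid i i′) (X : Setoid x x′)
  (R : REL (Setoid.Carrier I) (Setoid.Carrier X) r) →
  R Respectsˡ Setoid._≈_ I → R Respectsʳ Setoid._≈_ X →
  (∀ j → ∃ (R j)) →
  Σ[ f ∈ Func I X ] (∀ j → R j (Func.to f j))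

record Subset (S : Setoid a b) (ℓ : Level) : Set (a ⊔ b ⊔ suc ℓ) where
  open Setoid S using (Carrier; _≈_)
  field
    member  : Pred Carrier ℓ
    respect : member Respects _≈_

open Subset public using (member; respect)

⟦_⟧ : {S : Setoid a b} → Subset S ℓ → Setoid (a ⊔ ℓ) b
⟦_⟧ {S = S} U = On.setoid {B = ∃ (member U)} S proj₁

Powerset : Setoid a b → (ℓ : Level) → Setoid (a ⊔ b ⊔ suc ℓ) (a ⊔ ℓ)
Powerset S ℓ = record
  { Carrier       = Subset S ℓ
  ; _≈_           = λ U V → member U ≐ member V
  ; isEquivalence = record
    { refl  = ≐-refl
    ; sym   = ≐-sym
    ; trans = ≐-trans
    }
  }

infix 4 _≃_ _≲_ _≺_

_≃_ : Setoid a b → Setoid c d → Set (a ⊔ b ⊔ c ⊔ d)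
S ≃ T = Bijection S T

_≲_ : Setoid a b → Setoid c d → Set (a ⊔ b ⊔ c ⊔ d)
S ≲ T = Injection S T

_≺_ : Setoid a b → Setoid c d → Set (a ⊔ b ⊔ c ⊔ d)
S ≺ T = S ≲ T × ¬ (S ≃ T)

Finite : Setoid a b → Set (a ⊔ b)
Finite S = ∃[ n ] (S ≃ setoid (Fin n))

Uncountable : Setoid a b → Set (a ⊔ b)
Uncountable S = ¬ (S ≲ setoid ℕ)

initialSegment : (A : StrictTotalOrder ℓ ℓ ℓ) → StrictTotalOrder.Carrier A →
                 Subset (StrictTotalOrder.Eq.setoid A) ℓ
initialSegment A x = record
  { member  = λ y → y < x
  ; respect = <-respˡ-≈
  }
  where open StrictTotalOrder A

-- A cardinal is an initial ordinal: a well-order (standing for the ordinal of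
-- its order type) not equinumerous to any of its proper initial segments.
-- Equality of cardinals is ≃ on the underlying setoids.
record Cardinal (ℓ : Level) : Set (suc ℓ) where
  field
    order : StrictTotalOrder ℓ ℓ ℓ

  open StrictTotalOrder order public using (Carrier; _≈_; _<_)

  ∣_∣ : Setoid ℓ ℓ
  ∣_∣ = StrictTotalOrder.Eq.setoid order

  field
    wellFounded : WellFounded _<_
    initial     : ∀ x → ¬ (⟦ initialSegment order x ⟧ ≃ ∣_∣)

  infix 4 _≤_
  _≤_ : Carrier → Carrier → Set ℓ
  _≤_ = NonStrict._≤_ _≈_ _<_

open Cardinal public using (∣_∣)

-- "κ is the least cardinality of a subset of S satisfying P"
IsLeastSize : (S : Setoid a b) → Pred (Subset S ℓ) p → Cardinal ℓ →
              Set (a ⊔ b ⊔ suc ℓ ⊔ p)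
IsLeastSize {ℓ = ℓ} S P κ =
  (Σ[ U ∈ Subset S ℓ ] (P U × ⟦ U ⟧ ≃ ∣ κ ∣)) ×
  (∀ (U : Subset S ℓ) → P U → ∣ κ ∣ ≲ ⟦ U ⟧)

Cofinal : (κ : Cardinal ℓ) → Subset ∣ κ ∣ ℓ → Set ℓ
Cofinal κ U = ∀ x → ∃[ y ] (member U y × x ≤ y)
  where open Cardinal κ using (_≤_)

-- cf(κ) = χ
Cf : Cardinal ℓ → Cardinal ℓ → Set (suc ℓ)
Cf κ χ = IsLeastSize ∣ κ ∣ (Cofinal κ) χ

Regular : Cardinal ℓ → Set (suc ℓ)
Regular κ = ¬ Finite ∣ κ ∣ × Cf κ κ

-- λ = μ⁺
IsSuccessor : Cardinal ℓ → Cardinal ℓ → Set (suc ℓ)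
IsSuccessor {ℓ} lam μ =
  ∣ μ ∣ ≺ ∣ lam ∣ × (∀ (κ : Cardinal ℓ) → ∣ μ ∣ ≺ ∣ κ ∣ → ∣ lam ∣ ≲ ∣ κ ∣)

-- The families 𝒫 ⊆ [λ]^σ such that every u ∈ [λ]^θ includes some v ∈ [u]^σ
-- belonging to 𝒫.
Dense : (lam θ σ : Cardinal ℓ) → Subset (Powerset ∣ lam ∣ ℓ) ℓ → Set (suc ℓ)
Dense {ℓ} lam θ σ 𝒫 =
  (∀ (v : Subset ∣ lam ∣ ℓ) → member 𝒫 v → ⟦ v ⟧ ≃ ∣ σ ∣) ×
  (∀ (u : Subset ∣ lam ∣ ℓ) → ⟦ u ⟧ ≃ ∣ θ ∣ →
     Σ[ v ∈ Subset ∣ lam ∣ ℓ ] (member v ⊆ member u × ⟦ v ⟧ ≃ ∣ σ ∣ × member 𝒫 v))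

-- λ^⟨θ;σ⟩ = κ
_^⟨_⨾_⟩≡_ : (lam θ σ κ : Cardinal ℓ) → Set (suc ℓ)
_^⟨_⨾_⟩≡_ {ℓ} lam θ σ κ = IsLeastSize (Powerset ∣ lam ∣ ℓ) (Dense lam θ σ) κ

-- Θ_{λ,θ}
Θ : (lam θ : Cardinal ℓ) → Pred (Cardinal ℓ) (suc ℓ)
Θ lam θ σ =
  Cf lam σ ⊎
  ∣ σ ∣ ≃ ∣ θ ∣ ⊎
  (∃[ μ ] (IsSuccessor lam μ × ∃[ χ ] (Cf μ χ × ∣ χ ∣ ≺ ∣ μ ∣ × ∣ σ ∣ ≃ ∣ χ ∣)))

Θ′ : (lam : Cardinal ℓ) → Pred (Cardinal ℓ) (suc ℓ)
Θ′ lam σ = ∣ σ ∣ ≺ ∣ lam ∣ × Regular σ × lam ^⟨ lam ⨾ σ ⟩≡ lam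

module _ (G : Group ℓ ℓ) where
  open Group G using (Carrier; _∙_; ε; _⁻¹) renaming (setoid to ∣G∣)

  record IsSubgroup (U : Subset ∣G∣ ℓ) : Set ℓ where
    field
      ε-closed  : member U ε
      ∙-closed  : ∀ {x y} → member U x → member U y → member U (x ∙ y)
      ⁻¹-closed : ∀ {x} → member U x → member U (x ⁻¹)

  -- U is the least subgroup containing the entries of xs.
  IsGeneratedBy : Subset ∣G∣ ℓ → List Carrier → Set (suc ℓ)
  IsGeneratedBy U xs =
    IsSubgroup U × All (member U) xs ×
    (∀ (V : Subset ∣G∣ ℓ) → IsSubgroup V → All (member V) xs → member U ⊆ member V)

  LocallyFinite : Set (suc ℓ)
  LocallyFinite = ∀ (U : Subset ∣G∣ ℓ) → (∃[ xs ] IsGeneratedBy U xs) → Finite ⟦ U ⟧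

  -- Monotonicity is required for the non-strict order of σ, so it also makes
  -- the sequence respect the setoid equality of the index set.
  Indecomposable : Cardinal ℓ → Set (suc ℓ)
  Indecomposable σ =
    ∀ (M : Cardinal.Carrier σ → Subset ∣G∣ ℓ) →
    (∀ i → IsSubgroup (M i)) →
    (∀ {i j} → i ≤ j → member (M i) ⊆ member (M j)) →
    (∀ x → ∃[ i ] member (M i) x) →
    ∃[ i ] (∀ x → member (M i) x)
    where open Cardinal σ using (_≤_)

  IndecomposableFor : Pred (Cardinal ℓ) p → Set (suc ℓ ⊔ p)
  IndecomposableFor Ξ = ∀ σ → Ξ σ → Indecomposable σ

-- H extends G, up to replacing G by its image under an embedding.
_Extends_ : Group ℓ ℓ → Group ℓ ℓ → Set ℓ
H Extends G = ∃ (IsGroupMonomorphism (Group.rawGroup G) (Group.rawGroup H))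

{-# OPTIONS --safe #-}
-- Let σ < λ be regular with σ ∉ Θ.
--
-- Combinatorics.  On λ there are finitely many finitary operations for which λ is not the union of an
-- increasing σ-chain of proper closed subsets.  On a successor τ⁺ of a regular cardinal this holds
-- because every closed unbounded set contains all its limit points of cofinality τ, hence meets every
-- set of a Ulam partition of {δ < τ⁺ : cf δ = τ} into stationary sets, from which every ordinal below
-- τ⁺ is decoded.  A limit cardinal is exhausted by such successors unless its cofinality is σ, and the
-- successor of a singular μ is reached from μ; this is where cf λ and cf μ are excluded.
--
-- Group theory.  A member of the chain would be closed under the operations if the group composed
-- them, but composites of finitely many operations are infinitely many in general.
-- Index generators T(m; q, q) by rows q < θ, with
-- [T(m₁; q₁, r₁), T(m₂; q₂, r₂)] = T(m₂ ∘ m₁; q₂, r₁) for r₂ < q₁: strictly descending rows keep the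
-- group locally finite, while, as cf θ ≠ σ, a single member of a σ-chain contains cofinally many of the
-- elements T(1; q, q), so that what it contains in every such row is closed under composition.  Thus
-- some member contains T(x; -∞, +∞) for every x < λ.  These elements move a base point to λ many
-- distinct places; an involution acting at the x-th place as the x-th generator of a given group then
-- gives all generators of that group.  H is a tower of length θ of such extensions of G, and the
-- argument at each level puts all lower levels in one member of the chain; as cf θ ≠ σ, this suffices.
-- Everything acts by involutions, and local finiteness is the uniform boundedness of the orbits of
-- finitely many generators.
module Submission where

-- The involution that imitates every lower generator at that generator's own place is what lets one
-- level control all levels below it, and it is also the threat to local finiteness: an orbit
-- meeting many places would mix many generators, with no bound in terms of the given finite list.
-- The places are therefore chosen as the base point plus a correction in a single topmost row,
-- which no toggle copies elsewhere. A word in toggles then moves all places by the same amount, and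
-- this amount determines the only pair of distinct places that it can carry one to the other. Apart
-- from finitely many exceptional generators, an orbit of coordinates meets at most one place, and
-- the one involution imitated there merely doubles the lower part. Lower generators are blocked
-- wherever a higher coordinate is not neutral. So at a place only the imitated involution moves the
-- lower coordinates, and nothing else can combine with it. The bounds must be uniform over all
-- points: finite orbits alone would leave infinitely many possible action tables, and a word would
-- not be determined by finitely many data.

-- Classical well-orders: minimisation and transfinite recursion.

module WellOrders where

  open import Axiom.ExcludedMiddle using (ExcludedMiddle)
  open import Data.Empty using (⊥-elim)
  open import Data.Product using (Σ-syntax; ∃; ∃-syntax; _×_; _,_; proj₁; proj₂)
  open import Data.Sum.Base using (_⊎_; inj₁; inj₂)
  open import Induction.WellFounded using (WellFounded; module All; module FixPoint)
  open import Level using (Level) renaming (suc to lsuc)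
  open import Relation.Binary.Core using (Rel)
  open import Relation.Binary.Definitions using (Trichotomous; tri<; tri≈; tri>)
  open import Relation.Binary.PropositionalEquality using (_≡_; refl; trans)
  open import Relation.Nullary using (¬_; Dec; yes; no)

  module LEM (em : ∀ {a} → ExcludedMiddle a) where

    byContra : ∀ {a} {P : Set a} → ¬ ¬ P → P
    byContra {P = P} nn with em {P = P}
    ... | yes p = p
    ... | no np = ⊥-elim (nn np)

    ¬∀⇒∃¬ : ∀ {a p} {A : Set a} {P : A → Set p} → ¬ (∀ x → P x) → ∃[ x ] ¬ P x
    ¬∀⇒∃¬ h = byContra λ k → h λ x → byContra λ np → k (x , np)

    ¬∀⇒∃¬′ : ∀ {a p q} {A : Set a} {P : A → Set p} {Q : A → Set q} →
              ¬ (∀ x → P x → Q x) → ∃[ x ] (P x × ¬ Q x)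
    ¬∀⇒∃¬′ h = byContra λ k → h λ x px → byContra λ nq → k (x , px , nq)

    if-dec : ∀ {a p} {A : Set a} {P : Set p} → Dec P → A → A → A
    if-dec (yes _) x y = x
    if-dec (no _)  x y = y

  record WellOrder (a : Level) : Set (lsuc a) where
    infix 4 _<_ _≤_
    field
      Carrier : Set a
      _<_     : Rel Carrier a
      <-trans : ∀ {x y z} → x < y → y < z → x < z
      cmp     : Trichotomous _≡_ _<_
      wf      : WellFounded _<_

    <-irrefl : ∀ {x} → ¬ (x < x)
    <-irrefl {x} p with cmp x x
    ... | tri< _ x≢x _ = x≢x refl
    ... | tri≈ ¬p _ _  = ¬p p
    ... | tri> ¬p _ _  = ¬p p

    _≤_ : Rel Carrier a
    x ≤ y = ¬ (y < x)

    ≤-refl : ∀ {x} → x ≤ x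
    ≤-refl = <-irrefl

    <⇒≤ : ∀ {x y} → x < y → x ≤ y
    <⇒≤ x<y y<x = <-irrefl (<-trans x<y y<x)

    ≰⇒> : ∀ {x y} → ¬ (x ≤ y) → y < x
    ≰⇒> {x} {y} h with cmp x y
    ... | tri< _ _ ¬p = ⊥-elim (h ¬p)
    ... | tri≈ _ _ ¬p = ⊥-elim (h ¬p)
    ... | tri> _ _ p  = p

    ≤⇒<⊎≡ : ∀ {x y} → x ≤ y → (x < y) ⊎ (x ≡ y)
    ≤⇒<⊎≡ {x} {y} h with cmp x y
    ... | tri< p _ _ = inj₁ p
    ... | tri≈ _ p _ = inj₂ p
    ... | tri> _ _ p = ⊥-elim (h p)

    ≤-<-trans : ∀ {x y z} → x ≤ y → y < z → x < z
    ≤-<-trans h p with ≤⇒<⊎≡ h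
    ... | inj₁ q    = <-trans q p
    ... | inj₂ refl = p

    <-≤-trans : ∀ {x y z} → x < y → y ≤ z → x < z
    <-≤-trans p h with ≤⇒<⊎≡ h
    ... | inj₁ q    = <-trans p q
    ... | inj₂ refl = p

    ≤-trans : ∀ {x y z} → x ≤ y → y ≤ z → x ≤ z
    ≤-trans h k p = h (≤-<-trans k p)

    ≤-antisym : ∀ {x y} → x ≤ y → y ≤ x → x ≡ y
    ≤-antisym h k with ≤⇒<⊎≡ h
    ... | inj₁ p = ⊥-elim (k p)
    ... | inj₂ p = p

    <-or-≥ : ∀ x y → (x < y) ⊎ (y ≤ x)
    <-or-≥ x y with cmp x y
    ... | tri< p _ _ = inj₁ p
    ... | tri≈ ¬p _ _ = inj₂ ¬p
    ... | tri> ¬p _ _ = inj₂ ¬p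

    max : Carrier → Carrier → Carrier
    max x y with <-or-≥ x y
    ... | inj₁ _ = y
    ... | inj₂ _ = x

    ≤-maxˡ : ∀ x y → x ≤ max x y
    ≤-maxˡ x y with <-or-≥ x y
    ... | inj₁ p = <⇒≤ p
    ... | inj₂ _ = ≤-refl

    ≤-maxʳ : ∀ x y → y ≤ max x y
    ≤-maxʳ x y with <-or-≥ x y
    ... | inj₁ _ = ≤-refl
    ... | inj₂ p = p

    max-elim : ∀ {p} (P : Carrier → Set p) {x y} → P x → P y → P (max x y)
    max-elim P {x} {y} px py with <-or-≥ x y
    ... | inj₁ _ = py
    ... | inj₂ _ = px

    module _ (em : ∀ {a} → ExcludedMiddle a) where
      open LEM em

      least : ∀ {p} (P : Carrier → Set p) → ∃ P → Σ[ x ∈ Carrier ] (P x × (∀ y → P y → x ≤ y))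
      least {p} P (x , px) = All.wfRec wf _ (λ x → P x → Least) step x px
        where
        Least = Σ[ x ∈ Carrier ] (P x × (∀ y → P y → x ≤ y))
        step : ∀ x → (∀ {y} → y < x → P y → Least) → P x → Least
        step x ih px with em {P = ∃[ y ] (P y × y < x)}
        ... | yes (y , py , y<x) = ih y<x py
        ... | no none            = x , px , λ y py y<x → none (y , py , y<x)

      module Minimum (default : Carrier) where

        opaque
          -- Total by means of `default`, so that definitions by minimisation need no existence
          -- proof and can be compared through `μ-cong`.
          μ : ∀ {p} (P : Carrier → Set p) → Carrier
          μ P with em {P = ∃ P}
          ... | yes e = proj₁ (least P e)
          ... | no _  = default

          μ-sat : ∀ {p} (P : Carrier → Set p) → ∃ P → P (μ P)
          μ-sat P e with em {P = ∃ P}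
          ... | yes e′ = proj₁ (proj₂ (least P e′))
          ... | no ¬e  = ⊥-elim (¬e e)

          μ-min : ∀ {p} (P : Carrier → Set p) {y} → P y → μ P ≤ y
          μ-min P {y} py with em {P = ∃ P}
          ... | yes e′ = proj₂ (proj₂ (least P e′)) y py
          ... | no ¬e  = ⊥-elim (¬e (y , py))

          μ-cong : ∀ {p} {P Q : Carrier → Set p} →
                   (∀ x → P x → Q x) → (∀ x → Q x → P x) → μ P ≡ μ Q
          μ-cong {P = P} {Q} P⊆Q Q⊆P with em {P = ∃ P} | em {P = ∃ Q}
          ... | yes e | yes e′ = ≤-antisym
                  (proj₂ (proj₂ (least P e)) _ (Q⊆P _ (proj₁ (proj₂ (least Q e′)))))
                  (proj₂ (proj₂ (least Q e′)) _ (P⊆Q _ (proj₁ (proj₂ (least P e)))))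
          ... | yes (x , px) | no ¬e  = ⊥-elim (¬e (x , P⊆Q x px))
          ... | no ¬e | yes (x , qx)  = ⊥-elim (¬e (x , Q⊆P x qx))
          ... | no _ | no _    = refl

      module Recursion {b} {B : Set b} (default : B) (step : Carrier → (Carrier → B) → B)
                       (ext : ∀ x f g → (∀ y → y < x → f y ≡ g y) → step x f ≡ step x g) where
        extend : ∀ x → (∀ {y} → y < x → B) → Carrier → B
        extend x f y with em {P = y < x}
        ... | yes p = f p
        ... | no _  = default
        body : ∀ x → (∀ {y} → y < x → B) → B
        body x f = step x (extend x f)
        extend-≡ : ∀ x (f g : ∀ {y} → y < x → B) → (∀ {y} y<x → f {y} y<x ≡ g y<x) →
                   ∀ y → y < x → extend x f y ≡ extend x g y
        extend-≡ x f g h y y<x with em {P = y < x}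
        ... | yes p = h p
        ... | no _  = refl
        private module Fix = FixPoint wf (λ _ → B) body
                       (λ x {f} {g} h → ext x (extend x f) (extend x g) (extend-≡ x f g h))
        F : Carrier → B
        F = All.wfRec wf b (λ _ → B) body
        extend-F : ∀ x y → y < x → extend x (λ {y} _ → F y) y ≡ F y
        extend-F x y y<x with em {P = y < x}
        ... | yes _ = refl
        ... | no ¬p = ⊥-elim (¬p y<x)
        F-step : ∀ x → F x ≡ step x F
        F-step x = trans Fix.unfold-wfRec (ext x _ _ (extend-F x))

      opaque
        -- `step` is handed a total function; by the hypothesis it reads only values below its
        -- argument, so the arbitrary extension by `default` has no influence.
        recursion : ∀ {b} {B : Set b} (default : B) (step : Carrier → (Carrier → B) → B) →
                    (∀ x f g → (∀ y → y < x → f y ≡ g y) → step x f ≡ step x g) →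
                    Σ[ F ∈ (Carrier → B) ] (∀ x → F x ≡ step x F)
        recursion default step ext = Recursion.F default step ext , Recursion.F-step default step ext

-- Comparison of cardinalities, and the square of an infinite cardinal.

module Sizes where

  open import Axiom.ExcludedMiddle using (ExcludedMiddle)
  open import Data.Empty using (⊥; ⊥-elim)
  open import Data.Fin.Base using (Fin; toℕ; fromℕ<; combine)
  open import Data.Fin.Properties using (pigeonhole; combine-injective; fromℕ<-injective)
  open import Data.Nat.Base as ℕ using (ℕ; suc)
  import Data.Nat.Properties as ℕₚ
  open import Data.Nat.Induction using (<-wellFounded)
  open import Data.Product using (Σ-syntax; ∃; ∃-syntax; _×_; _,_; proj₁; proj₂)
  open import Data.Sum.Base using (_⊎_; inj₁; inj₂)
  open import Data.Unit.Base using (⊤; tt)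
  open import Function.Base using (_∘_; id)
  open import Induction.WellFounded using (Acc; acc; module All)
  open import Level using (Level; _⊔_; 0ℓ)
  open import Relation.Binary.Definitions using (Tri; tri<; tri≈; tri>)
  open import Relation.Binary.PropositionalEquality using (_≡_; _≢_; refl; sym; trans; cong; cong₂; subst)
  open import Relation.Nullary using (¬_; Dec; yes; no)
  open WellOrders

  infix 4 _≼_

  -- The map is total, but its values and its injectivity count only on `P`: sizes are compared
  -- between predicates, mostly initial segments, without subset types.
  record _≼_ {a b p q} {A : Set a} {B : Set b} (P : A → Set p) (Q : B → Set q) :
             Set (a ⊔ b ⊔ p ⊔ q) where
    constructor inj
    field
      to     : A → B
      to-in  : ∀ {x} → P x → Q (to x)
      to-inj : ∀ {x y} → P x → P y → to x ≡ to y → x ≡ y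

  Full : ∀ {a} {A : Set a} → A → Set
  Full _ = ⊤

  _⊠_ : ∀ {a b p q} {A : Set a} {B : Set b} → (A → Set p) → (B → Set q) → A × B → Set (p ⊔ q)
  (P ⊠ Q) (x , y) = P x × Q y

  ≼-trans : ∀ {a b c p q r} {A : Set a} {B : Set b} {C : Set c}
            {P : A → Set p} {Q : B → Set q} {R : C → Set r} → P ≼ Q → Q ≼ R → P ≼ R
  ≼-trans (inj f f-in f-inj) (inj g g-in g-inj) =
    inj (g ∘ f) (g-in ∘ f-in) λ px py e → f-inj px py (g-inj (f-in px) (f-in py) e)

  ⊆⇒≼ : ∀ {a p q} {A : Set a} {P : A → Set p} {Q : A → Set q} → (∀ {x} → P x → Q x) → P ≼ Q
  ⊆⇒≼ P⊆Q = inj id P⊆Q λ _ _ e → e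

  ⊠-mono : ∀ {a b c d p q r s} {A : Set a} {B : Set b} {C : Set c} {D : Set d}
           {P : A → Set p} {Q : B → Set q} {R : C → Set r} {S : D → Set s} →
           P ≼ R → Q ≼ S → P ⊠ Q ≼ R ⊠ S
  ⊠-mono (inj f f-in f-inj) (inj g g-in g-inj) =
    inj (λ (x , y) → f x , g y) (λ (p , q) → f-in p , g-in q)
    λ (p , q) (p′ , q′) e → cong₂ _,_ (f-inj p p′ (cong proj₁ e)) (g-inj q q′ (cong proj₂ e))

  Infinite : ∀ {a p} {A : Set a} → (A → Set p) → Set (a ⊔ p)
  Infinite P = Full {A = ℕ} ≼ P

  ℕ-order : WellOrder 0ℓ
  ℕ-order = record
    { Carrier = ℕ
    ; _<_     = ℕ._<_
    ; <-trans = ℕₚ.<-trans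
    ; cmp     = ℕₚ.<-cmp
    ; wf      = <-wellFounded
    }

  module _ {a : Level} (X : WellOrder a) where
    open WellOrder X

    private
      height : Carrier × Carrier → Carrier
      height (x , y) = max x y

    -- Gödel's ordering of pairs. Its proper initial segments lie in squares of closed segments,
    -- which is what bounds the square of a cardinal.
    data _◁_ (p q : Carrier × Carrier) : Set a where
      by-max : height p < height q → p ◁ q
      by-fst : height p ≡ height q → proj₁ p < proj₁ q → p ◁ q
      by-snd : height p ≡ height q → proj₁ p ≡ proj₁ q → proj₂ p < proj₂ q → p ◁ q

    private
      ◁-trans : ∀ {p q r} → p ◁ q → q ◁ r → p ◁ r
      ◁-trans (by-max l) (by-max l′)        = by-max (<-trans l l′)
      ◁-trans (by-max l) (by-fst e _)       = by-max (subst (_ <_) e l)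
      ◁-trans (by-max l) (by-snd e _ _)     = by-max (subst (_ <_) e l)
      ◁-trans (by-fst e _) (by-max l)       = by-max (subst (_< _) (sym e) l)
      ◁-trans (by-fst e l) (by-fst e′ l′)   = by-fst (trans e e′) (<-trans l l′)
      ◁-trans (by-fst e l) (by-snd e′ f _)  = by-fst (trans e e′) (subst (_ <_) f l)
      ◁-trans (by-snd e _ _) (by-max l)     = by-max (subst (_< _) (sym e) l)
      ◁-trans (by-snd e f _) (by-fst e′ l)  = by-fst (trans e e′) (subst (_< _) (sym f) l)
      ◁-trans (by-snd e f l) (by-snd e′ f′ l′) = by-snd (trans e e′) (trans f f′) (<-trans l l′)

      ◁-irrefl : ∀ {p} → ¬ (p ◁ p)
      ◁-irrefl (by-max l)     = <-irrefl l
      ◁-irrefl (by-fst _ l)   = <-irrefl l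
      ◁-irrefl (by-snd _ _ l) = <-irrefl l

      from-< : ∀ {p q} → p ◁ q → Tri (p ◁ q) (p ≡ q) (q ◁ p)
      from-< l = tri< l (λ { refl → ◁-irrefl l }) (λ g → ◁-irrefl (◁-trans l g))

      from-> : ∀ {p q} → q ◁ p → Tri (p ◁ q) (p ≡ q) (q ◁ p)
      from-> l = tri> (λ g → ◁-irrefl (◁-trans l g)) (λ { refl → ◁-irrefl l }) l

      ◁-cmp : ∀ p q → Tri (p ◁ q) (p ≡ q) (q ◁ p)
      ◁-cmp p@(x , y) q@(x′ , y′) with cmp (max x y) (max x′ y′)
      ... | tri< l _ _ = from-< (by-max l)
      ... | tri> _ _ l = from-> (by-max l)
      ... | tri≈ _ e _ with cmp x x′
      ...   | tri< l _ _ = from-< (by-fst e l)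
      ...   | tri> _ _ l = from-> (by-fst (sym e) l)
      ...   | tri≈ _ refl _ with cmp y y′
      ...     | tri< l _ _ = from-< (by-snd e refl l)
      ...     | tri> _ _ l = from-> (by-snd (sym e) refl l)
      ...     | tri≈ _ refl _ = tri≈ ◁-irrefl refl ◁-irrefl

      -- Nested induction on the maximum, the first and the second coordinate; a drop in one of them
      -- lets the later ones restart from `wf`.
      ◁-acc : ∀ {m} → Acc _<_ m → ∀ {x} → Acc _<_ x → ∀ {y} → Acc _<_ y →
              max x y ≡ m → ∀ {q} → q ◁ (x , y) → Acc _◁_ q
      ◁-acc (acc rm) ax ay refl (by-max l)        = acc (◁-acc (rm l) (wf _) (wf _) refl)
      ◁-acc am (acc rx) ay e (by-fst f l)         = acc (◁-acc am (rx l) (wf _) (trans f e))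
      ◁-acc am ax (acc ry) e (by-snd f refl l)    = acc (◁-acc am ax (ry l) (trans f e))

    gödel : WellOrder a
    gödel = record
      { Carrier = Carrier × Carrier
      ; _<_     = _◁_
      ; <-trans = ◁-trans
      ; cmp     = ◁-cmp
      ; wf      = λ (x , y) → acc (◁-acc (wf _) (wf _) (wf _) refl)
      }

    ◁⇒≤ : ∀ {p q} → p ◁ q → (proj₁ p ≤ height q) × (proj₂ p ≤ height q)
    ◁⇒≤ {p} {q} l = ≤-trans (≤-maxˡ _ _) (h l) , ≤-trans (≤-maxʳ (proj₁ p) _) (h l)
      where
      h : p ◁ q → height p ≤ height q
      h (by-max l)     = <⇒≤ l
      h (by-fst e _) r   = <-irrefl (subst (_ <_) e r)
      h (by-snd e _ _) r = <-irrefl (subst (_ <_) e r)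

  below : ∀ {a} (X : WellOrder a) → WellOrder.Carrier X → WellOrder.Carrier X → Set a
  below X x y = WellOrder._<_ X y x

  module Cardinality (em : ∀ {a} → ExcludedMiddle a) where
    open LEM em

    retract : ∀ {a b p q} {A : Set a} {B : Set b} {P : A → Set p} {Q : B → Set q} →
              ∃ P → (i : P ≼ Q) →
              Σ[ s ∈ (B → A) ] ((∀ y → P (s y)) × (∀ {x} → P x → s (_≼_.to i x) ≡ x))
    retract {A = A} {B} {P} (x₀ , px₀) (inj f _ f-inj) = s , s-in , s-f
      where
      Pre : B → Set _
      Pre y = ∃[ x ] (P x × f x ≡ y)
      s : B → A
      s y with em {P = Pre y}
      ... | yes (x , _) = x
      ... | no _        = x₀
      s-in : ∀ y → P (s y)
      s-in y with em {P = Pre y}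
      ... | yes (_ , px , _) = px
      ... | no _             = px₀
      s-f : ∀ {x} → P x → s (f x) ≡ x
      s-f {x} px with em {P = Pre (f x)}
      ... | yes (_ , px′ , e) = f-inj px′ px e
      ... | no ¬pre           = ⊥-elim (¬pre (x , px , refl))

    onto⇒≽ : ∀ {a b p q} {A : Set a} {B : Set b} {P : A → Set p} {Q : B → Set q} →
             A → (s : A → B) → (∀ y → Q y → ∃[ x ] (P x × s x ≡ y)) → Q ≼ P
    onto⇒≽ {A = A} {B} {P} {Q} x₀ s onto = inj f f-in f-inj
      where
      f : B → A
      f y with em {P = Q y}
      ... | yes q = proj₁ (onto y q)
      ... | no _  = x₀
      f-in : ∀ {y} → Q y → P (f y)
      f-in {y} q with em {P = Q y}
      ... | yes q = proj₁ (proj₂ (onto y q))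
      ... | no ¬q = ⊥-elim (¬q q)
      s-f : ∀ {y} → Q y → s (f y) ≡ y
      s-f {y} q with em {P = Q y}
      ... | yes q = proj₂ (proj₂ (onto y q))
      ... | no ¬q = ⊥-elim (¬q q)
      f-inj : ∀ {x y} → Q x → Q y → f x ≡ f y → x ≡ y
      f-inj qx qy e = trans (sym (s-f qx)) (trans (cong s e) (s-f qy))

    -- Send each x to the least element of `Q` not yet used. If nothing is left at some x, the
    -- values below x already cover `Q`.
    compare : ∀ {a b p q} (X : WellOrder a) (Y : WellOrder b) → WellOrder.Carrier Y →
              (P : WellOrder.Carrier X → Set p) (Q : WellOrder.Carrier Y → Set q) →
              (P ≼ Q) ⊎ (∃[ x ] (P x × (Q ≼ λ x′ → P x′ × WellOrder._<_ X x′ x)))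
    compare X Y y₀ P Q = decide (em {P = ∀ x → P x → ∃ (Fresh F x)})
      where
      module X = WellOrder X
      module Y = WellOrder Y
      open Y.Minimum em y₀
      Fresh : (X.Carrier → Y.Carrier) → X.Carrier → Y.Carrier → Set _
      Fresh f x y = Q y × (∀ x′ → P x′ → x′ X.< x → f x′ ≢ y)
      fresh-cong : ∀ x f g → (∀ y → y X.< x → f y ≡ g y) → ∀ y → Fresh f x y → Fresh g x y
      fresh-cong x f g h y (q , new) = q , λ x′ p l e → new x′ p l (trans (h x′ l) e)
      defn = X.recursion em y₀ (λ x f → μ (Fresh f x))
               (λ x f g h → μ-cong (fresh-cong x f g h) (fresh-cong x g f λ y l → sym (h y l)))
      F : X.Carrier → Y.Carrier
      F = proj₁ defn
      decide : Dec (∀ x → P x → ∃ (Fresh F x)) →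
               (P ≼ Q) ⊎ (∃[ x ] (P x × (Q ≼ λ x′ → P x′ × x′ X.< x)))
      decide (yes all) = inj₁ (inj F (λ {x} px → proj₁ (fresh px)) F-inj)
        where
        fresh : ∀ {x} → P x → Fresh F x (F x)
        fresh {x} px = subst (Fresh F x) (sym (proj₂ defn x)) (μ-sat (Fresh F x) (all x px))
        F-inj : ∀ {x x′} → P x → P x′ → F x ≡ F x′ → x ≡ x′
        F-inj {x} {x′} px px′ e with X.cmp x x′
        ... | tri< l _ _ = ⊥-elim (proj₂ (fresh px′) x px l e)
        ... | tri≈ _ e _ = e
        ... | tri> _ _ l = ⊥-elim (proj₂ (fresh px) x′ px′ l (sym e))
      decide (no ¬all) with ¬∀⇒∃¬′ ¬all
      ... | x , px , none = inj₂ (x , px , onto⇒≽ x F covered)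
        where
        covered : ∀ y → Q y → ∃[ x′ ] ((P x′ × x′ X.< x) × F x′ ≡ y)
        covered y qy = byContra λ k → none (y , qy , λ x′ p l e → k (x′ , (p , l) , e))

    ¬infinite⇒bounded : ∀ {a p} (X : WellOrder a) → WellOrder.Carrier X →
                        {P : WellOrder.Carrier X → Set p} → ¬ Infinite P →
                        ∃[ n ] (P ≼ (λ m → m ℕ.< n))
    ¬infinite⇒bounded X x₀ {P} ¬inf with compare ℕ-order X x₀ Full P
    ... | inj₁ inf         = ⊥-elim (¬inf inf)
    ... | inj₂ (n , _ , i) = n , ≼-trans i (⊆⇒≼ proj₂)

    ¬infinite-square : ∀ {a p} {A : Set a} {P : A → Set p} {n} →
                       P ≼ (λ m → m ℕ.< n) → ¬ Infinite (P ⊠ P)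
    ¬infinite-square {P = P} {n} (inj f f-in f-inj) (inj g g-in g-inj)
      with pigeonhole (ℕₚ.n<1+n (n ℕ.* n)) code
      where
      code : Fin (suc (n ℕ.* n)) → Fin (n ℕ.* n)
      code i = combine (fromℕ< (f-in (proj₁ (g-in {toℕ i} tt)))) (fromℕ< (f-in (proj₂ (g-in {toℕ i} tt))))
    ... | i , j , i<j , e with combine-injective {n} {n} _ _ _ _ e
    ...   | e₁ , e₂ = ℕₚ.<⇒≢ i<j (g-inj tt tt (cong₂ _,_
              (f-inj (proj₁ (g-in tt)) (proj₁ (g-in tt)) (fromℕ<-injective _ _ _ _ e₁))
              (f-inj (proj₂ (g-in tt)) (proj₂ (g-in tt)) (fromℕ<-injective _ _ _ _ e₂))))

    -- Hilbert's hotel: if `m` is new it takes the place of `ι 0`, every `ι n` moves to `ι (suc n)`,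
    -- and all else stays.
    hotel : ∀ {a p} {A : Set a} {P : A → Set p} (m : A) → Infinite P → (λ x → P x ⊎ x ≡ m) ≼ P
    hotel {a} {A = A} {P} m (inj ι ι-in ι-inj) with em {P = P m}
    ... | yes pm = ⊆⇒≼ λ { (inj₁ p) → p ; (inj₂ refl) → pm }
    ... | no ¬pm = inj f f-in f-inj
      where
      data View (x : A) : A → Set a where
        new   : x ≡ m → View x (ι 0)
        shift : ∀ n → x ≡ ι n → View x (ι (suc n))
        keep  : x ≢ m → (∀ n → x ≢ ι n) → View x x
      view : ∀ x → ∃ (View x)
      view x with em {P = x ≡ m} | em {P = ∃[ n ] (x ≡ ι n)}
      ... | yes e | _           = _ , new e
      ... | no _  | yes (n , e) = _ , shift n e
      ... | no ¬e | no ¬i       = _ , keep ¬e (λ n e → ¬i (n , e))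
      f : A → A
      f x = proj₁ (view x)
      f-in : ∀ {x} → P x ⊎ x ≡ m → P (f x)
      f-in {x} h with view x | h
      ... | _ , new _    | _        = ι-in tt
      ... | _ , shift _ _ | _       = ι-in tt
      ... | _ , keep _ _ | inj₁ p   = p
      ... | _ , keep ¬e _ | inj₂ e  = ⊥-elim (¬e e)
      views-inj : ∀ {x y z} → View x z → View y z → x ≡ y
      views-inj u v = go u v refl
        where
        ιs : ∀ {i j} → ι i ≡ ι j → i ≡ j
        ιs = ι-inj tt tt
        go : ∀ {x y z z′} → View x z → View y z′ → z ≡ z′ → x ≡ y
        go (new refl) (new refl) _ = refl
        go (new _) (shift n _) e with () ← ιs e
        go (new _) (keep _ ¬ι) e = ⊥-elim (¬ι 0 (sym e))
        go (shift n _) (new _) e with () ← ιs e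
        go (shift n refl) (shift k refl) e with refl ← ιs e = refl
        go (shift n _) (keep _ ¬ι) e = ⊥-elim (¬ι (suc n) (sym e))
        go (keep _ ¬ι) (new _) e = ⊥-elim (¬ι 0 e)
        go (keep _ ¬ι) (shift n _) e = ⊥-elim (¬ι (suc n) e)
        go (keep _ _) (keep _ _) e = e
      f-inj : ∀ {x y} → P x ⊎ x ≡ m → P y ⊎ y ≡ m → f x ≡ f y → x ≡ y
      f-inj {x} {y} _ _ e = views-inj (proj₂ (view x)) (subst (View y) (sym e) (proj₂ (view y)))

    module _ {a : Level} (X : WellOrder a) where
      open WellOrder X

      closed≼below : ∀ {x} → Infinite (below X x) → (_≤ x) ≼ below X x
      closed≼below inf = ≼-trans (⊆⇒≼ ≤⇒<⊎≡) (hotel _ inf)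

      -- For an initial segment `P`, this says that its order type is a cardinal.
      Initial : ∀ {p} → (Carrier → Set p) → Set (a ⊔ p)
      Initial P = ∀ x → P x → ¬ (P ≼ below X x)

      drop-top : ∀ {m} → Infinite (_≤ m) → Infinite (below X m)
      drop-top {m} (inj ι ι-in ι-inj) with em {P = ∃[ n ] (ι n ≡ m)}
      ... | no ¬m = inj ι (λ {n} _ → strict n) ι-inj
        where
        strict : ∀ n → ι n < m
        strict n with ≤⇒<⊎≡ (ι-in {n} tt)
        ... | inj₁ l = l
        ... | inj₂ e = ⊥-elim (¬m (n , e))
      -- By injectivity the sequence avoids `m` from index `suc k` on.
      ... | yes (k , ιk) = inj (λ n → ι (suc k ℕ.+ n)) (λ {n} _ → strict n)
                               λ _ _ e → ℕₚ.+-cancelˡ-≡ (suc k) _ _ (ι-inj tt tt e)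
        where
        strict : ∀ n → ι (suc k ℕ.+ n) < m
        strict n with ≤⇒<⊎≡ (ι-in {suc k ℕ.+ n} tt)
        ... | inj₁ l = l
        ... | inj₂ e = ⊥-elim (ℕₚ.m≢1+m+n k (ι-inj tt tt (trans ιk (sym e))))

      -- Otherwise `P` injects into a proper segment of Gödel's ordering, hence into the square of
      -- `_≤ m` for some m in `P`. If m is infinite, the induction hypothesis squeezes `P` below m,
      -- against initiality; if m is finite, so is that square.
      square-step : ∀ {p} {P : Carrier → Set p} → Infinite P → Initial P →
                    (∀ x → P x → Infinite (below X x) → below X x ⊠ below X x ≼ below X x) →
                    P ⊠ P ≼ P
      square-step {P = P} inf init ih with compare (gödel X) X (_≼_.to inf 0) (P ⊠ P) P
      ... | inj₁ i = i
      ... | inj₂ ((x , y) , (px , py) , i) = ⊥-elim (absurd (em {P = Infinite (below X m)}))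
        where
        m  = max x y
        pm = max-elim P px py
        into-square : P ≼ (_≤ m) ⊠ (_≤ m)
        into-square = ≼-trans i (⊆⇒≼ λ (_ , l) → ◁⇒≤ X l)
        absurd : Dec (Infinite (below X m)) → ⊥
        absurd (yes inf-m) = init m pm (≼-trans into-square
          (≼-trans (⊠-mono (closed≼below inf-m) (closed≼below inf-m)) (ih m pm inf-m)))
        absurd (no fin-m) with em {P = Infinite (_≤ m)}
        ... | no fin = ¬infinite-square (proj₂ (¬infinite⇒bounded X x fin)) (≼-trans inf into-square)
        ... | yes inf′ = fin-m (drop-top inf′)

      square : ∀ x → Infinite (below X x) → below X x ⊠ below X x ≼ below X x
      square = All.wfRec wf _ (λ x → Infinite (below X x) → below X x ⊠ below X x ≼ below X x) step
        where
        step : ∀ x → (∀ {y} → y < x → Infinite (below X y) → below X y ⊠ below X y ≼ below X y) →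
               Infinite (below X x) → below X x ⊠ below X x ≼ below X x
        -- Either x has the size of a smaller ordinal, whose square is known, or x is a cardinal.
        step x ih inf with em {P = ∃[ y ] (y < x × below X x ≼ below X y)}
        ... | yes (y , y<x , i) = ≼-trans (⊠-mono i i)
                (≼-trans (ih y<x (≼-trans inf i)) (⊆⇒≼ λ l → <-trans l y<x))
        ... | no init = square-step inf (λ y l i → init (y , l , i)) (λ y l → ih l)

      square-full : Infinite {A = Carrier} Full → Initial {p = 0ℓ} Full → Full {A = Carrier × Carrier} ≼ Full {A = Carrier}
      square-full inf init = ≼-trans (⊆⇒≼ {Q = Full ⊠ Full} (λ _ → tt , tt))
                                     (square-step inf init (λ x _ → square x))

-- Ulam's partition and the algebra on the successor of a regular cardinal.

module Blocks where

  open import Axiom.ExcludedMiddle using (ExcludedMiddle)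
  open import Data.Empty using (⊥-elim)
  open import Data.Nat.Base as ℕ using (ℕ)
  open import Data.Product using (Σ-syntax; ∃; ∃-syntax; _×_; _,_; proj₁; proj₂)
  open import Data.Sum.Base using (_⊎_; inj₁; inj₂)
  open import Data.Unit.Base using (tt)
  open import Data.Unit.Polymorphic.Base using () renaming (⊤ to ⊤ₚ)
  open import Function.Base using (id)
  open import Induction.WellFounded using (module All)
  open import Level using (Level; _⊔_)
  open import Relation.Binary.Definitions using (tri<; tri≈; tri>)
  open import Relation.Binary.PropositionalEquality using (_≡_; refl; sym; trans; cong; subst)
  open import Relation.Nullary using (¬_; Dec; yes; no)
  open WellOrders
  open Sizes

  module Bounding (em : ∀ {a} → ExcludedMiddle a) where
    open LEM em
    open Cardinality em

    record Absorbing {a p : Level} {A : Set a} (κ : A → Set p) : Set (a ⊔ p) where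
      field
        infinite : Infinite κ
        squared  : κ ⊠ κ ≼ κ

      pair : A → A → A
      pair x y = _≼_.to squared (x , y)

      pair-in : ∀ {x y} → κ x → κ y → κ (pair x y)
      pair-in p q = _≼_.to-in squared (p , q)

      pair-inj : ∀ {x y x′ y′} → κ x → κ y → κ x′ → κ y′ →
                 pair x y ≡ pair x′ y′ → x ≡ x′ × y ≡ y′
      pair-inj p q p′ q′ e with _≼_.to-inj squared (p , q) (p′ , q′) e
      ... | refl = refl , refl

      point : ℕ → A
      point = _≼_.to infinite

      point-in : ∀ n → κ (point n)
      point-in n = _≼_.to-in infinite tt

      point-inj : ∀ {m n} → point m ≡ point n → m ≡ n
      point-inj = _≼_.to-inj infinite tt tt

    -- Tagging with two distinct points of κ makes room for one more element.
    add-point : ∀ {a b p q} {A : Set a} {B : Set b} {P : A → Set p} {κ : B → Set q} (x : A) →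
                Absorbing κ → P ≼ κ → (λ y → P y ⊎ y ≡ x) ≼ κ
    add-point {A = A} {B} {P} {κ} x abs (inj f f-in f-inj) = inj g g-in g-inj
      where
      open Absorbing abs
      g : A → B
      g y with em {P = P y}
      ... | yes _ = pair (point 0) (f y)
      ... | no _  = pair (point 1) (point 0)
      g-in : ∀ {y} → P y ⊎ y ≡ x → κ (g y)
      g-in {y} _ with em {P = P y}
      ... | yes p = pair-in (point-in 0) (f-in p)
      ... | no _  = pair-in (point-in 1) (point-in 0)
      g-inj : ∀ {y z} → P y ⊎ y ≡ x → P z ⊎ z ≡ x → g y ≡ g z → y ≡ z
      g-inj {y} {z} h k e with em {P = P y} | em {P = P z}
      ... | yes p | yes q = f-inj p q
            (proj₂ (pair-inj (point-in 0) (f-in p) (point-in 0) (f-in q) e))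
      ... | yes p | no _ with () ← point-inj
            (proj₁ (pair-inj (point-in 0) (f-in p) (point-in 1) (point-in 0) e))
      g-inj h k e | no _ | yes q with () ← point-inj
            (proj₁ (pair-inj (point-in 1) (point-in 0) (point-in 0) (f-in q) e))
      g-inj (inj₁ p) _ _ | no ¬p | no _ = ⊥-elim (¬p p)
      g-inj (inj₂ _) (inj₁ q) _ | no _ | no ¬q = ⊥-elim (¬q q)
      g-inj (inj₂ refl) (inj₂ refl) _ | no _ | no _ = refl

    module _ {a : Level} (X : WellOrder a) where
      open WellOrder X

      -- In ordinal terms: the cofinality of `A` exceeds the size of `κ`.
      Bounds : ∀ {k p q} {K : Set k} → (K → Set q) → (Carrier → Set p) → Set (a ⊔ k ⊔ p ⊔ q)
      Bounds {K = K} κ A = ∀ (b : K → Carrier) → (∀ {x} → κ x → A (b x)) →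
                   ∃[ a ] (A a × (∀ {x} → κ x → b x < a))

      opaque
        -- Gathers one chosen witness for each element of `κ` under a common bound; `d` fills in the
        -- values outside `κ`.
        choose-below : ∀ {k p q r} {K : Set k} {κ : K → Set q} {A : Carrier → Set p}
                       {R : K → Carrier → Set r} → Bounds κ A → Carrier →
                       (∀ {x} → κ x → ∃[ y ] (A y × R x y)) →
                       ∃[ a ] (A a × (∀ {x} → κ x → ∃[ y ] (R x y × y < a)))
        choose-below {K = K} {κ = κ} {A = A} {R = R} bnd d h = proj₁ found , proj₁ (proj₂ found) ,
                             λ {x} κx → b x , R-b κx , proj₂ (proj₂ found) κx
          where
          b : K → Carrier
          b x with em {P = κ x}
          ... | yes κx = proj₁ (h κx)
          ... | no _   = d
          A-b : ∀ {x} → κ x → A (b x)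
          A-b {x} κx with em {P = κ x}
          ... | yes κx = proj₁ (proj₂ (h κx))
          ... | no ¬κx = ⊥-elim (¬κx κx)
          R-b : ∀ {x} → κ x → R x (b x)
          R-b {x} κx with em {P = κ x}
          ... | yes κx = proj₂ (proj₂ (h κx))
          ... | no ¬κx = ⊥-elim (¬κx κx)
          found : ∃[ a ] (A a × (∀ {x} → κ x → b x < a))
          found = bnd b A-b

      -- Otherwise A would be a union of κ many sets of size at most κ.
      opaque
        covered⇒bounds : ∀ {k p q} {K : Set k} {κ : K → Set q} {A : Carrier → Set p} →
                         Absorbing κ → (∀ x → A x → below X x ≼ κ) → ¬ (A ≼ κ) → Bounds κ A
        covered⇒bounds {K = K} {κ} {A} abs cover big b b-in = byContra λ none → big (small none)
          where
          open Absorbing abs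
          small : ¬ (∃[ a ] (A a × (∀ {x} → κ x → b x < a))) → A ≼ κ
          small none = inj F (λ Ax → F-in Ax) F-inj
            where
            above : ∀ {x} → A x → ∃[ k ] (κ k × x ≤ b k)
            above {x} Ax with ¬∀⇒∃¬′ {P = κ} {Q = λ k → b k < x} (λ h → none (x , Ax , λ {k} → h k))
            ... | k , κk , ¬l = k , κk , ¬l
            code : ∀ {k} → κ k → (_≤ b k) ≼ κ
            code {k} κk = ≼-trans (⊆⇒≼ ≤⇒<⊎≡) (add-point (b k) abs (cover (b k) (b-in κk)))
            enc : K → Carrier → K
            enc k x with em {P = κ k}
            ... | yes κk = _≼_.to (code κk) x
            ... | no _   = k
            enc-in : ∀ {k x} → κ k → x ≤ b k → κ (enc k x)
            enc-in {k} κk l with em {P = κ k}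
            ... | yes κk = _≼_.to-in (code κk) l
            ... | no ¬κk = ⊥-elim (¬κk κk)
            enc-inj : ∀ {k x y} → κ k → x ≤ b k → y ≤ b k → enc k x ≡ enc k y → x ≡ y
            enc-inj {k} κk l l′ with em {P = κ k}
            ... | yes κk = _≼_.to-inj (code κk) l l′
            ... | no ¬κk = ⊥-elim (¬κk κk)
            idx : Carrier → K
            idx x with em {P = A x}
            ... | yes Ax = proj₁ (above Ax)
            ... | no _   = point 0
            idx-in : ∀ {x} → A x → κ (idx x) × x ≤ b (idx x)
            idx-in {x} Ax with em {P = A x}
            ... | yes Ax = proj₂ (above Ax)
            ... | no ¬Ax = ⊥-elim (¬Ax Ax)
            F : Carrier → K
            F x = pair (idx x) (enc (idx x) x)
            F-in : ∀ {x} → A x → κ (F x)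
            F-in Ax = pair-in (proj₁ (idx-in Ax)) (enc-in (proj₁ (idx-in Ax)) (proj₂ (idx-in Ax)))
            F-inj : ∀ {x y} → A x → A y → F x ≡ F y → x ≡ y
            F-inj {x} {y} Ax Ay e with idx-in Ax | idx-in Ay
            ... | κx , lx | κy , ly with pair-inj κx (enc-in κx lx) κy (enc-in κy ly) e
            ...   | i≡ , e≡ = enc-inj κy (subst (λ k → x ≤ b k) i≡ lx) ly
                                (trans (cong (λ k → enc k x) (sym i≡)) e≡)

      -- A stands for an ordinal τ⁺ with τ = below t regular.
      record SuccessorBlock {p : Level} (A : Carrier → Set p) (t : Carrier) : Set (a ⊔ p) where
        field
          absorbing : Absorbing (below X t)
          regular   : ∀ {e} → e < t → Bounds (below X e) (below X t)
          cover     : ∀ x → A x → below X x ≼ below X t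
          big       : ¬ (A ≼ below X t)

      module Block {p : Level} (u : Level) {A : Carrier → Set p} {t : Carrier}
                   (down : ∀ {x y} → A x → y < x → A y) (blk : SuccessorBlock A t) where
        open SuccessorBlock blk
        open Absorbing absorbing
        open Minimum em (point 0)

        opaque
          bounds : Bounds (below X t) A
          bounds = covered⇒bounds absorbing cover big

        private
          0<t : point 0 < t
          0<t = point-in 0

        opaque
          A₀ : ∃ A
          A₀ = byContra λ none → big (inj id (λ Ax → ⊥-elim (none (_ , Ax))) λ _ _ e → e)

        opaque
          -- Enumerations by `t` of all ordinals of the block, from which the Ulam matrix is read
          -- off. Where there is nothing to enumerate, the identity is a dummy.
          surjection : ∀ β → Σ[ s ∈ (Carrier → Carrier) ]
                       ((A β → ∃ (below X β) → ∀ η → s η < β) ×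
                        (A β → ∀ {x} → x < β → ∃[ η ] (η < t × s η ≡ x)))
          surjection β with em {P = A β} | em {P = ∃ (below X β)}
          ... | yes Aβ | yes ne with retract ne (cover β Aβ)
          ...   | s , s-in , s-to = s , (λ _ _ → s-in) ,
                  λ _ l → _ , _≼_.to-in (cover β Aβ) l , s-to l
          surjection β | yes Aβ | no ¬ne = id , (λ _ ne → ⊥-elim (¬ne ne)) , λ _ l → ⊥-elim (¬ne (_ , l))
          surjection β | no ¬Aβ | _ = id , (λ Aβ → ⊥-elim (¬Aβ Aβ)) , λ Aβ → ⊥-elim (¬Aβ Aβ)

        g : Carrier → Carrier → Carrier
        g β = proj₁ (surjection β)

        g-below : ∀ {β x} → A β → x < β → ∀ η → g β η < β
        g-below {β} Aβ l = proj₁ (proj₂ (surjection β)) Aβ (_ , l)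

        g-onto : ∀ {β x} → A β → x < β → ∃[ η ] (η < t × g β η ≡ x)
        g-onto {β} Aβ = proj₂ (proj₂ (surjection β)) Aβ

        Reaches : Carrier → Carrier → Carrier → Set a
        Reaches β ζ η = η < t × ζ ≤ g β η

        hit : Carrier → Carrier → Carrier
        hit β ζ = μ (Reaches β ζ)

        -- The first value in the enumeration of β that is at least ζ. Closure under this binary
        -- operation stands in for topological closure at limits of cofinality τ.
        m : Carrier → Carrier → Carrier
        m β ζ = g β (hit β ζ)

        Unbounded : ∀ {v} → (Carrier → Set v) → Set (a ⊔ p ⊔ v)
        Unbounded U = ∀ {x} → A x → ∃[ w ] (A w × U w × x < w)

        LimitOf : ∀ {v} → (Carrier → Set v) → Carrier → Set (a ⊔ v)
        LimitOf U δ = ∀ {ζ} → ζ < δ → ∃[ w ] (U w × ζ < w × w < δ)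

        Cofinality-t : Carrier → Set a
        Cofinality-t δ = ∀ {e} → e < t → Bounds (below X e) (below X δ)

        -- For the least β ∈ U above δ ∉ U, the values m β ζ with ζ ∈ U ∩ δ large
        -- would lie in U between δ and β.
        limits-belong : ∀ {v} (U : Carrier → Set v) → (∀ {β ζ} → U β → U ζ → U (m β ζ)) →
                        Unbounded U → ∀ {δ} → A δ → Cofinality-t δ → LimitOf U δ → U δ
        limits-belong U closed unb {δ} Aδ cof lim
          with least em (λ β → A β × U β × δ ≤ β)
                 (let w , Aw , Uw , l = unb Aδ in w , Aw , Uw , <⇒≤ l)
        ... | β , (Aβ , Uβ , δ≤β) , β-least with ≤⇒<⊎≡ δ≤β
        ...   | inj₂ refl = Uβ
        ...   | inj₁ δ<β = ⊥-elim (β-least (m β ζ)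
                  (down Aβ m<β , closed Uβ Uζ , subst (λ k → δ ≤ g β k) (sym hit-ζ) δ≤h) m<β)
          where
          δ-hit : ∃ (Reaches β δ)
          δ-hit with g-onto Aβ δ<β
          ... | η , η<t , refl = η , η<t , ≤-refl
          h = hit β δ
          h<t = proj₁ (μ-sat (Reaches β δ) δ-hit)
          δ≤h = proj₂ (μ-sat (Reaches β δ) δ-hit)
          early : ∀ {k} → k < h → g β k < δ
          early {k} k<h = ≰⇒> λ δ≤ → μ-min (Reaches β δ) (<-trans k<h h<t , δ≤) k<h
          -- Fewer than `t` values precede the first one that reaches δ, and all lie below δ, so one
          -- ordinal below δ bounds them. For a point ζ of `U` beyond it the first hit is again `h`.
          bound = cof h<t (g β) early
          above = lim (proj₁ (proj₂ bound))
          ζ = proj₁ above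
          Uζ = proj₁ (proj₂ above)
          ζ<δ = proj₂ (proj₂ (proj₂ above))
          h-reaches : Reaches β ζ h
          h-reaches = h<t , ≤-trans (<⇒≤ ζ<δ) δ≤h
          hit-ζ : hit β ζ ≡ h
          hit-ζ = ≤-antisym (μ-min (Reaches β ζ) h-reaches) λ k<h →
            proj₂ (μ-sat (Reaches β ζ) (h , h-reaches))
              (<-trans (proj₂ (proj₂ bound) k<h) (proj₁ (proj₂ (proj₂ above))))
          m<β : m β ζ < β
          m<β = g-below Aβ δ<β _

        opaque
          -- Regularity for a constant family yields a point above ε; the two points of `t` only
          -- provide a nonempty index segment.
          t-limit : ∀ {ε} → ε < t → ∃[ ε′ ] (ε < ε′ × ε′ < t)
          t-limit {ε} ε<t with cmp (point 0) (point 1)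
          ... | tri≈ _ e _ with () ← point-inj e
          t-limit {ε} ε<t | tri< l _ _ with regular (point-in 1) (λ _ → ε) (λ _ → ε<t)
          ... | a , a<t , ε<a = a , ε<a l , a<t
          t-limit {ε} ε<t | tri> _ _ l with regular (point-in 0) (λ _ → ε) (λ _ → ε<t)
          ... | a , a<t , ε<a = a , ε<a l , a<t

        module CommonLimit {v} (U : Carrier → Carrier → Set v)
                           (unb : ∀ {η} → η < t → Unbounded (U η)) {ξ : Carrier} (Aξ : A ξ) where

          Next : Carrier → Carrier → Set (a ⊔ p ⊔ v)
          Next ζ x = A x × (∀ {η} → η < t → ∃[ w ] ((U η w × ζ < w) × w < x))

          N : Carrier → Carrier
          N ζ = μ (Next ζ)

          opaque
            N-sat : ∀ {ζ} → A ζ → Next ζ (N ζ)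
            N-sat {ζ} Aζ = μ-sat (Next ζ) (choose-below bounds ζ λ η<t →
              let w , Aw , Uw , l = unb η<t Aζ in w , Aw , Uw , l)

          N-above : ∀ {ζ} → A ζ → ζ < N ζ
          N-above Aζ with proj₂ (N-sat Aζ) 0<t
          ... | w , (_ , l) , l′ = <-trans l l′

          Later : (Carrier → Carrier) → Carrier → Carrier → Set (a ⊔ p)
          Later f ε x = A x × ξ < x × (∀ ε′ → ε′ < ε → N (f ε′) < x)

          later-cong : ∀ ε f f′ → (∀ y → y < ε → f y ≡ f′ y) → ∀ x → Later f ε x → Later f′ ε x
          later-cong ε f f′ h x (Ax , l , k) =
            Ax , l , λ ε′ ε′<ε → subst (λ z → N z < x) (h ε′ ε′<ε) (k ε′ ε′<ε)

          opaque
            ladder : Σ[ d ∈ (Carrier → Carrier) ] (∀ ε → d ε ≡ μ (Later d ε))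
            ladder = recursion em (point 0) (λ ε f → μ (Later f ε)) λ ε f f′ h →
              μ-cong (later-cong ε f f′ h) (later-cong ε f′ f λ y l → sym (h y l))

          d : Carrier → Carrier
          d = proj₁ ladder

          later-exists : ∀ ε → (∀ {ε′} → ε′ < ε → ε′ < t → Later d ε′ (d ε′)) → ε < t → ∃ (Later d ε)
          later-exists ε ih ε<t = x , proj₁ (proj₂ found) , ξ<x , Nd<x
            where
            -- Indices from ε on impose nothing; ξ is a harmless value there and lets the whole of
            -- `t` index the bound.
            pick : ∀ ε′ → ε′ < t → Dec (ε′ < ε) →
                   ∃[ y ] (A y × ξ ≤ y × (ε′ < ε → N (d ε′) ≤ y))
            pick ε′ ε′<t (no ¬l)  = ξ , Aξ , ≤-refl , λ l → ⊥-elim (¬l l)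
            pick ε′ ε′<t (yes l) with ih l ε′<t
            ... | Ad , ξ<d , _ = N (d ε′) , proj₁ (N-sat Ad) ,
                                 <⇒≤ (<-trans ξ<d (N-above Ad)) , λ _ → ≤-refl
            found = choose-below {R = λ ε′ y → ξ ≤ y × (ε′ < ε → N (d ε′) ≤ y)} bounds ξ
                      (λ {ε′} ε′<t → pick ε′ ε′<t em)
            x = proj₁ found
            ξ<x : ξ < x
            ξ<x with proj₂ (proj₂ found) ε<t
            ... | y , (ξ≤y , _) , y<x = ≤-<-trans ξ≤y y<x
            Nd<x : ∀ ε′ → ε′ < ε → N (d ε′) < x
            Nd<x ε′ l with proj₂ (proj₂ found) (<-trans l ε<t)
            ... | y , (_ , k) , y<x = ≤-<-trans (k l) y<x

          opaque
            d-sat : ∀ ε → ε < t → Later d ε (d ε)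
            d-sat = All.wfRec wf _ (λ ε → ε < t → Later d ε (d ε)) λ ε ih ε<t →
              subst (Later d ε) (sym (proj₂ ladder ε)) (μ-sat (Later d ε) (later-exists ε ih ε<t))

          Ad : ∀ {ε} → ε < t → A (d ε)
          Ad ε<t = proj₁ (d-sat _ ε<t)

          Nd<d : ∀ {ε′ ε} → ε′ < ε → ε < t → N (d ε′) < d ε
          Nd<d l ε<t = proj₂ (proj₂ (d-sat _ ε<t)) _ l

          Sup : Carrier → Set (a ⊔ p)
          Sup x = A x × (∀ {ε} → ε < t → d ε < x)

          δ : Carrier
          δ = μ Sup

          opaque
            δ-sup : Sup δ
            δ-sup = μ-sat Sup (bounds d Ad)

          Aδ : A δ
          Aδ = proj₁ δ-sup

          d<δ : ∀ {ε} → ε < t → d ε < δ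
          d<δ = proj₂ δ-sup

          ξ<δ : ξ < δ
          ξ<δ = <-trans (proj₁ (proj₂ (d-sat _ 0<t))) (d<δ 0<t)

          opaque
            approach : ∀ {x} → x < δ → ∃[ ε ] (ε < t × x ≤ d ε)
            approach {x} x<δ = byContra λ none → μ-min Sup
              (down Aδ x<δ , λ {ε} ε<t → ≰⇒> λ x≤d → none (ε , ε<t , x≤d)) x<δ

          limit : ∀ {η} → η < t → LimitOf (U η) δ
          limit η<t ζ<δ with approach ζ<δ
          ... | ε , ε<t , ζ≤d with t-limit ε<t
          ...   | ε′ , ε<ε′ , ε′<t with proj₂ (N-sat (Ad ε<t)) η<t
          ...     | w , (Uw , l) , l′ = w , Uw , ≤-<-trans ζ≤d l ,
                    <-trans l′ (<-trans (Nd<d ε<ε′ ε′<t) (d<δ ε′<t))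

          -- Each value is overtaken by some rung of the ladder, and regularity of `t` puts fewer
          -- than `t` rungs under a single one.
          cofinality : Cofinality-t δ
          cofinality {e} e<t b b-in = d ε , d<δ ε<t , below-dε
            where
            found = choose-below {R = λ k ε → b k ≤ d ε} (regular e<t) δ (λ k<e → approach (b-in k<e))
            ε = proj₁ found
            ε<t = proj₁ (proj₂ found)
            below-dε : ∀ {k} → k < e → b k < d ε
            below-dε k<e with proj₂ (proj₂ found) k<e
            ... | ε′ , b≤d , l = ≤-<-trans b≤d (<-trans (N-above (Ad (<-trans l ε<t))) (Nd<d l ε<t))

        opaque
          -- The analogue of intersecting τ many clubs: climb a ladder of `t` rungs, leaving between
          -- consecutive rungs a point of every `U η`. The supremum is a limit of all these sets and
          -- has the cofinality of the ladder.
          common-limit : ∀ {v} (U : Carrier → Carrier → Set v) → (∀ {η} → η < t → Unbounded (U η)) →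
                         ∀ {ξ} → A ξ → ∃[ δ ] (A δ × ξ < δ × Cofinality-t δ ×
                           (∀ {η} → η < t → LimitOf (U η) δ))
          common-limit U unb Aξ = δ , Aδ , ξ<δ , (λ {e} → cofinality {e}) , limit
            where open CommonLimit U unb Aξ

        -- The δ of cofinality `t` with `g δ η ≡ ξ` form a stationary set; limit points of unbounded
        -- sets play the part of clubs.
        Stationary : Carrier → Carrier → Set _
        Stationary ξ η = ∀ (U : Carrier → Set u) → Unbounded U →
          ∃[ δ ] (A δ × Cofinality-t δ × LimitOf U δ × g δ η ≡ ξ)

        -- Ulam's argument. If every η failed, the `t` many unbounded sets witnessing it would have
        -- a common limit δ above ξ; but the enumeration of δ takes the value ξ at some η.
        stationary : ∀ {ξ} → A ξ → ∃[ η ] (η < t × Stationary ξ η)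
        stationary {ξ} Aξ = byContra λ none →
          let bad : ∀ {η} → η < t → Σ[ U ∈ (Carrier → Set u) ] (Unbounded U × ¬ _)
              bad {η} η<t = ¬∀⇒∃¬′ λ st → none (η , η<t , st)
              U : Carrier → Carrier → Set u
              U η = case-U η bad
              δ , Aδ , ξ<δ , cof , lim = common-limit U (λ {η} → U-unb bad {η}) Aξ
              η , η<t , e = g-onto Aδ ξ<δ
          in U-bad bad η<t (δ , Aδ , cof , lim η<t , e)
          where
          Bad : Carrier → Set _
          Bad η = η < t → Σ[ U ∈ (Carrier → Set u) ] (Unbounded U ×
                    ¬ (∃[ δ ] (A δ × Cofinality-t δ × LimitOf U δ × g δ η ≡ ξ)))
          case-U : ∀ η → (∀ {η} → Bad η) → Carrier → Set u
          case-U η bad with em {P = η < t}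
          ... | yes l = proj₁ (bad l)
          ... | no _  = λ _ → ⊤ₚ
          U-unb : (bad : ∀ {η} → Bad η) → ∀ {η} → η < t → Unbounded (case-U η bad)
          U-unb bad {η} η<t with em {P = η < t}
          ... | yes l = proj₁ (proj₂ (bad l))
          ... | no ¬l = ⊥-elim (¬l η<t)
          U-bad : (bad : ∀ {η} → Bad η) → ∀ {η} → η < t →
                  ¬ (∃[ δ ] (A δ × Cofinality-t δ × LimitOf (case-U η bad) δ × g δ η ≡ ξ))
          U-bad bad {η} η<t with em {P = η < t}
          ... | yes l = proj₂ (proj₂ (bad l))
          ... | no ¬l = ⊥-elim (¬l η<t)

        Colour : Carrier → Carrier → Set _
        Colour η ξ = A ξ × Stationary ξ η

        opaque
          -- Pigeonhole: if each of the `t` colours were bounded, some x in `A` would exceed all the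
          -- bounds, yet x has a colour too.
          frequent-colour : ∃[ η ] (η < t × Unbounded (Colour η))
          frequent-colour = byContra λ none →
            let bounded : ∀ {η} → η < t → ∃[ x ] (A x × (∀ {w} → A w → Stationary w η → w ≤ x))
                bounded {η} η<t = byContra λ nb → none (η , η<t , λ {x} Ax →
                  byContra λ nw → nb (x , Ax , λ {w} Aw st x<w → nw (w , Aw , (Aw , st) , x<w)))
                x , Ax , h = choose-below bounds (point 0) bounded
                η , η<t , st = stationary Ax
                y , k , y<x = h η<t
            in k Ax st y<x

        η* : Carrier
        η* = proj₁ frequent-colour

        colour-unbounded : Unbounded (Colour η*)
        colour-unbounded = proj₂ (proj₂ frequent-colour)

        -- A set of size at most `t` is bounded in `A`, and this one is not.
        colour-big : ∀ {x} → A x → ¬ (Colour η* ≼ below X x)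
        colour-big {x} Ax i = <-irrefl (<-trans w<y y<w)
          where
          e : Colour η* ≼ below X t
          e = ≼-trans i (cover x Ax)
          some : ∃ (Colour η*)
          some = let w , _ , Cw , _ = colour-unbounded (proj₂ A₀) in w , Cw
          s = retract some e
          bound = bounds (proj₁ s) (λ _ → proj₁ (proj₁ (proj₂ s) _))
          y = proj₁ bound
          next = colour-unbounded (proj₁ (proj₂ bound))
          w = proj₁ next
          Cw : Colour η* w
          Cw = proj₁ (proj₂ (proj₂ next))
          y<w : y < w
          y<w = proj₂ (proj₂ (proj₂ next))
          w<y : w < y
          w<y = subst (_< y) (proj₂ (proj₂ s) Cw) (proj₂ (proj₂ bound) (_≼_.to-in e Cw))

        opaque
          colour-onto : A ≼ Colour η*
          colour-onto with compare X X (point 0) A (Colour η*)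
          ... | inj₁ i = i
          ... | inj₂ (x , Ax , i) = ⊥-elim (colour-big Ax (≼-trans i (⊆⇒≼ proj₂)))

        private
          opaque
            r-retract : Σ[ s ∈ (Carrier → Carrier) ]
                        ((∀ y → A (s y)) × (∀ {x} → A x → s (_≼_.to colour-onto x) ≡ x))
            r-retract = retract A₀ colour-onto

        r : Carrier → Carrier
        r = proj₁ r-retract

        -- For every ξ of colour `η*`, stationarity provides a limit δ of `U` with `g δ η* ≡ ξ`; δ
        -- lies in `U` by `limits-belong`, hence so does ξ. There are as many such ξ as elements of
        -- `A`, and `r` maps them onto `A`.
        closed⇒all : ∀ (U : Carrier → Set u) → (∀ {β η} → U β → U η → U (g β η)) →
                     (∀ {β ζ} → U β → U ζ → U (m β ζ)) → (∀ {ξ} → U ξ → U (r ξ)) →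
                     U η* → Unbounded U → ∀ {x} → A x → U x
        closed⇒all U g-cl m-cl r-cl Uη* unb {x} Ax =
          subst U (proj₂ (proj₂ r-retract) Ax) (r-cl (colour⊆U (_≼_.to-in colour-onto Ax)))
          where
          colour⊆U : ∀ {ξ} → Colour η* ξ → U ξ
          colour⊆U (_ , st) with st U unb
          ... | δ , Aδ , cof , lim , refl = g-cl (limits-belong U m-cl unb Aδ cof lim) Uη*

-- Exhausting a well-order along a σ-chain, and regularity of initial ordinals.

module Stages where

  open import Axiom.ExcludedMiddle using (ExcludedMiddle)
  open import Data.Empty using (⊥-elim)
  open import Data.Product using (∃; ∃-syntax; _×_; _,_; proj₁; proj₂)
  open import Data.Unit.Base using (tt)
  open import Function.Base using (_∘_; id)
  open import Level using (Level; _⊔_) renaming (suc to lsuc)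
  open import Relation.Binary.PropositionalEquality using (_≡_; refl; subst)
  open import Relation.Nullary using (¬_; yes; no)
  open WellOrders
  open Sizes
  open Blocks

  RegularOrder : ∀ {ℓ} → WellOrder ℓ → Set (lsuc ℓ)
  RegularOrder {ℓ} σ = ∀ (V : Carrier → Set ℓ) → (∀ p → ∃[ y ] (V y × p ≤ y)) → Full {A = Carrier} ≼ V
    where open WellOrder σ

  record CofinalMap {s a p} (σ : WellOrder s) (X : WellOrder a) (P : WellOrder.Carrier X → Set p) :
                    Set (s ⊔ a ⊔ p) where
    private
      module σ = WellOrder σ
      module X = WellOrder X
    field
      map      : σ.Carrier → X.Carrier
      map-in   : ∀ i → P (map i)
      monotone : ∀ {i j} → i σ.≤ j → map i X.≤ map j
      cofinal  : ∀ {x} → P x → ∃[ i ] (x X.< map i)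

  module Exhaustion (em : ∀ {a} → ExcludedMiddle a) where
    open LEM em
    open Cardinality em
    open Bounding em

    module _ {s a p : Level} (σ : WellOrder s) (X : WellOrder a) where
      private
        module σ = WellOrder σ
        module X = WellOrder X

      -- The least element missed at stage i depends monotonically on i.
      opaque
        exhaust : ∀ {u} {P : X.Carrier → Set p} (U : σ.Carrier → X.Carrier → Set u) → X.Carrier →
                  (∀ {i j} → i σ.≤ j → ∀ {x} → U i x → U j x) →
                  (∀ {x} → P x → ∃[ i ] (∀ {y} → y X.≤ x → P y → U i y)) →
                  ¬ CofinalMap σ X P → ∃[ i ] (∀ {x} → P x → U i x)
        exhaust {u} {P} U d mono stage no-map = byContra λ none → no-map record
          { map      = λ i → μ (Missing i)
          ; map-in   = λ i → proj₁ (sat none i)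
          ; monotone = λ i≤j → μ-min (Missing _) (proj₁ (sat none _) ,
                         λ Ui → proj₂ (sat none _) (mono i≤j Ui))
          ; cofinal  = λ {x} Px → let i , h = stage Px in
                         i , X.≰⇒> λ l → proj₂ (sat none i) (h l (proj₁ (sat none i)))
          }
          where
          open X.Minimum em d
          Missing : σ.Carrier → X.Carrier → Set (p ⊔ u)
          Missing i x = P x × ¬ U i x
          sat : ¬ (∃[ i ] (∀ {x} → P x → U i x)) → ∀ i → Missing i (μ (Missing i))
          sat none i = μ-sat (Missing i) (¬∀⇒∃¬′ λ h → none (i , λ {x} → h x))

    module _ {ℓ : Level} (Λ : WellOrder ℓ) where
      open WellOrder Λ

      private
        ⟦_⟧< : Carrier → Carrier → Set ℓ
        ⟦_⟧< = below Λ

      opaque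
        bounds-mono : ∀ {k l p q r} {K : Set k} {L : Set l} {P : K → Set p} {κ : L → Set q}
                      {A : Carrier → Set r} → ∃ A → P ≼ κ → Bounds Λ κ A → Bounds Λ P A
        bounds-mono {P = P} {A = A} (a₀ , Aa₀) i bnd b b-in with em {P = ∃ P}
        ... | no ¬P = a₀ , Aa₀ , λ {x} Px → ⊥-elim (¬P (x , Px))
        ... | yes nonempty with retract nonempty i
        ...   | s , s-in , s-to with bnd (b ∘ s) (λ _ → b-in (s-in _))
        ...     | a , Aa , h = a , Aa , λ {x} Px → subst (λ y → b y < a) (s-to Px) (h (_≼_.to-in i Px))

      ≼-below⇒≤ : ∀ {x y} → ¬ (⟦ x ⟧< ≼ ⟦ y ⟧<) → y < x
      ≼-below⇒≤ h = ≰⇒> λ x≤y → h (⊆⇒≼ λ l → <-≤-trans l x≤y)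

      absorbing-below : ∀ {x} → Infinite ⟦ x ⟧< → Absorbing ⟦ x ⟧<
      absorbing-below inf = record { infinite = inf ; squared = square Λ _ inf }

      RegularPoint : Carrier → Set ℓ
      RegularPoint t = ∀ {e} → e < t → Bounds Λ ⟦ e ⟧< ⟦ t ⟧<

      opaque
        -- The hypotheses make `t` the successor cardinal of β, and successor cardinals are regular.
        small-covers⇒regular : ∀ {β t} → Infinite ⟦ β ⟧< → β < t → (∀ {x} → x < t → ⟦ x ⟧< ≼ ⟦ β ⟧<) →
                               ¬ (⟦ t ⟧< ≼ ⟦ β ⟧<) → RegularPoint t
        small-covers⇒regular inf β<t cov big e<t =
          bounds-mono (_ , β<t) (cov e<t) (covered⇒bounds Λ (absorbing-below inf) (λ x → cov {x}) big)

      opaque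
        -- Regularity must pass from the order of σ to another order of the same size. A family `b`
        -- on e < t without bound would cover σ by the sets of y with `i y ≤ b x`. None of these is
        -- cofinal, since `t` would then have the size of a smaller segment; and their bounds `u x`
        -- would form a cofinal subset of σ of size at most e.
        regular-transfer : (σ : WellOrder ℓ) → RegularOrder σ → ∀ {t} → Infinite ⟦ t ⟧< → Initial Λ ⟦ t ⟧< →
                           ⟦ t ⟧< ≼ Full {A = WellOrder.Carrier σ} → Full {A = WellOrder.Carrier σ} ≼ ⟦ t ⟧< →
                           RegularPoint t
        regular-transfer σ reg {t} inf init t≼σ (inj i i-in i-inj) {e} e<t b b-in = byContra λ none →
          init e e<t (≼-trans t≼σ (≼-trans (reg V (V-cofinal none)) (onto⇒≽ e u λ y (x , l , q) → x , l , q)))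
          where
          module σ = WellOrder σ
          Unbounded-fibre : Carrier → Set ℓ
          Unbounded-fibre x = ∀ p → ∃[ y ] (i y ≤ b x × p σ.≤ y)
          bounded-fibre : ∀ {x} → x < e → ¬ Unbounded-fibre x
          bounded-fibre {x} x<e cof =
            init (b x) (b-in x<e) (≼-trans t≼ (closed≼below Λ (drop-top Λ (≼-trans inf t≼))))
            where
            t≼ : ⟦ t ⟧< ≼ (_≤ b x)
            t≼ = ≼-trans t≼σ (≼-trans (reg (λ y → i y ≤ b x) cof) (inj i id λ _ _ → i-inj tt tt))
          bounded : ∀ {x} → x < e → ∃[ p ] (∀ {y} → i y ≤ b x → y σ.< p)
          bounded x<e = byContra λ nb → bounded-fibre x<e λ p → byContra λ none →
            nb (p , λ {y} l → σ.≰⇒> λ p≤y → none (y , l , p≤y))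
          u : Carrier → σ.Carrier
          u x with em {P = x < e}
          ... | yes l = proj₁ (bounded l)
          ... | no _  = _≼_.to t≼σ x
          u-bound : ∀ {x} → x < e → ∀ {y} → i y ≤ b x → y σ.< u x
          u-bound {x} l with em {P = x < e}
          ... | yes l = proj₂ (bounded l)
          ... | no ¬l = ⊥-elim (¬l l)
          V : σ.Carrier → Set ℓ
          V y = ∃[ x ] (x < e × u x ≡ y)
          V-cofinal : ¬ (∃[ a ] (a < t × (∀ {x} → x < e → b x < a))) → ∀ p → ∃[ y ] (V y × p σ.≤ y)
          V-cofinal none p = byContra λ nc → none (i p , i-in tt , λ {x} x<e → ≰⇒> λ l →
            nc (u x , (x , x<e , refl) , σ.<⇒≤ (u-bound x<e l)))

-- Finitely many operations on λ that no σ-chain of proper closed subsets exhausts.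

module JonssonAlgebras where

  open import Axiom.ExcludedMiddle using (ExcludedMiddle)
  open import Data.Empty using (⊥-elim)
  open import Data.Fin.Base using (Fin)
  open import Data.Fin.Patterns using (0F; 1F; 2F; 3F; 4F)
  open import Data.Product using (Σ-syntax; ∃; ∃-syntax; _×_; _,_; proj₁; proj₂)
  open import Data.Sum.Base using (_⊎_; inj₁; inj₂)
  open import Data.Unit.Base using (⊤; tt)
  open import Data.Unit.Polymorphic.Base using () renaming (⊤ to ⊤ₚ; tt to ttₚ)
  open import Function.Base using (id)
  open import Level using (Level) renaming (suc to lsuc)
  open import Relation.Binary.PropositionalEquality using (_≡_; refl; sym; trans; cong; subst)
  open import Relation.Nullary using (¬_; Dec; yes; no)
  open WellOrders
  open Sizes
  open Blocks
  open Stages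

  module Algebra (em : ∀ {a} → ExcludedMiddle a) {ℓ : Level} (Λ : WellOrder ℓ)
                 (Λ-infinite : Infinite {A = WellOrder.Carrier Λ} Full)
                 (Λ-initial : ∀ x → ¬ (Full {A = WellOrder.Carrier Λ} ≼ below Λ x)) where
    open LEM em
    open Cardinality em
    open Bounding em
    open Exhaustion em
    open WellOrder Λ

    ⟦_⟧< : Carrier → Carrier → Set ℓ
    ⟦_⟧< = below Λ

    record BlockOps : Set ℓ where
      field
        g m : Carrier → Carrier → Carrier
        r   : Carrier → Carrier
        c   : Carrier

    record ClosedUnder (ops : BlockOps) (U : Carrier → Set ℓ) : Set ℓ where
      open BlockOps ops
      field
        g-closed : ∀ {x y} → U x → U y → U (g x y)
        m-closed : ∀ {x y} → U x → U y → U (m x y)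
        r-closed : ∀ {x} → U x → U (r x)
        c-closed : U c

    UnboundedIn : (Carrier → Set ℓ) → (Carrier → Set ℓ) → Set ℓ
    UnboundedIn A U = ∀ {x} → A x → ∃[ w ] (A w × U w × x < w)

    -- The bottom element stands for the whole of Λ, every other γ for its initial segment.
    Segment : Carrier → Carrier → Set ℓ
    Segment γ x = x < γ ⊎ (∀ y → γ ≤ y)

    segment-down : ∀ {γ x y} → Segment γ x → y < x → Segment γ y
    segment-down (inj₁ x<γ) y<x = inj₁ (<-trans y<x x<γ)
    segment-down (inj₂ bot) _   = inj₂ bot

    Generates : BlockOps → Carrier → Set (lsuc ℓ)
    Generates ops γ = ∀ (U : Carrier → Set ℓ) → ClosedUnder ops U → UnboundedIn (Segment γ) U →
                      ∀ {x} → Segment γ x → U x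

    opaque
      -- A block is chosen once for each γ, so that finitely many operations taking γ as an argument
      -- serve all blocks.
      block-ops : ∀ γ → Σ[ ops ∈ BlockOps ] (∃ (SuccessorBlock Λ (Segment γ)) → Generates ops γ)
      block-ops γ with em {P = ∃ (SuccessorBlock Λ (Segment γ))}
      ... | yes (t , blk) = record { g = B.g ; m = B.m ; r = B.r ; c = B.η* } ,
              λ _ U cl → B.closed⇒all U (g-closed cl) (m-closed cl) (r-closed cl) (c-closed cl)
        where
        module B = Block Λ ℓ {A = Segment γ} segment-down blk
        open ClosedUnder
      ... | no none = record { g = λ x _ → x ; m = λ x _ → x ; r = id ; c = γ } , λ e → ⊥-elim (none e)

    Dominates : Carrier → Set ℓ
    Dominates μ = ∀ x → ⟦ x ⟧< ≼ ⟦ μ ⟧<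

    -- The cardinal μ with λ = μ⁺, if λ is a successor.
    LeastDominating : Carrier → Set ℓ
    LeastDominating μ = Dominates μ × (∀ y → Dominates y → μ ≤ y)

    predecessor? : Dec (∃ LeastDominating)
    predecessor? with em {P = ∃ Dominates}
    ... | yes e = yes (least em Dominates e)
    ... | no ¬e = no λ (μ , d , _) → ¬e (μ , d)

    covering : Dec (∃ LeastDominating) → Carrier → Carrier → Carrier
    covering (no _) β = id
    covering (yes (μ , dom , _)) β with em {P = ∃ ⟦ β ⟧<}
    ... | yes nonempty = proj₁ (retract nonempty (dom β))
    ... | no _         = id

    covering-onto : ∀ {μ} (h : LeastDominating μ) {β x} → x < β →
                    ∃[ η ] (η < μ × covering (yes (μ , h)) β η ≡ x)
    covering-onto {μ} (dom , _) {β} {x} x<β with em {P = ∃ ⟦ β ⟧<}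
    ... | yes nonempty = _≼_.to (dom β) x , _≼_.to-in (dom β) x<β , proj₂ (proj₂ (retract nonempty (dom β))) x<β
    ... | no empty     = ⊥-elim (empty (x , x<β))

    -- Everything is padded to arity three. The first argument of the first four operations names
    -- the block; the last operation enumerates β by the predecessor cardinal of λ.
    op : Fin 5 → Carrier → Carrier → Carrier → Carrier
    op 0F γ = BlockOps.g (proj₁ (block-ops γ))
    op 1F γ = BlockOps.m (proj₁ (block-ops γ))
    op 2F γ x _ = BlockOps.r (proj₁ (block-ops γ)) x
    op 3F γ _ _ = BlockOps.c (proj₁ (block-ops γ))
    op 4F β η _ = covering predecessor? β η

    Closed : (Carrier → Set ℓ) → Set ℓ
    Closed U = ∀ k {x y z} → U x → U y → U z → U (op k x y z)

    record Admissible (σ : WellOrder ℓ) : Set (lsuc ℓ) where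
      field
        regular  : RegularOrder σ
        infinite : Infinite {A = WellOrder.Carrier σ} Full
        small    : ∃[ x ] (Full {A = WellOrder.Carrier σ} ≼ ⟦ x ⟧<)
        no-map   : ¬ CofinalMap σ Λ (Full {A = Carrier})
        no-map-below : ∀ {μ} → LeastDominating μ → Initial Λ ⟦ μ ⟧< →
                       ¬ (⟦ μ ⟧< ≼ Full {A = WellOrder.Carrier σ}) → ¬ CofinalMap σ Λ ⟦ μ ⟧<

    module Chain (σ : WellOrder ℓ) (adm : Admissible σ)
                 (U : WellOrder.Carrier σ → Carrier → Set ℓ)
                 (mono : ∀ {i j} → WellOrder._≤_ σ i j → ∀ {x} → U i x → U j x)
                 (cover : ∀ x → ∃[ i ] U i x)
                 (i₀ : WellOrder.Carrier σ)
                 (closed : ∀ i → WellOrder._≤_ σ i₀ i → Closed (U i)) where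
      open Admissible adm
      private
        module σ = WellOrder σ
        I = σ.Carrier

      later : ∀ i j → ∃[ k ] (i σ.≤ k × j σ.≤ k)
      later i j = σ.max i j , σ.≤-maxˡ i j , σ.≤-maxʳ i j

      opaque
        -- If all late stages were bounded in `A`, their at most `κ` many bounds would lie below one
        -- element of `A`, and this element belongs to some late stage.
        unbounded-stage : ∀ {k q} {K : Set k} {κ : K → Set q} {A : Carrier → Set ℓ} →
                          Full {A = I} ≼ κ → Bounds Λ κ A →
                          ∃[ i ] (i₀ σ.≤ i × UnboundedIn A (U i))
        unbounded-stage {κ = κ} {A = A} σ≼κ bnd = byContra λ none →
          let s , _ , s-to = retract (i₀ , tt) σ≼κ
              bounded : ∀ {k} → κ k → ∃[ y ] (A y × (i₀ σ.≤ s k → ∀ {w} → A w → U (s k) w → w ≤ y))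
              bounded {k} _ = byContra λ nb → none (s k , byContra (λ ¬l → nb (_ , proj₁ (proj₂ (bnd (λ _ → a₀ none) λ _ → a₀-in none)) , λ l → ⊥-elim (¬l l))) ,
                λ {x} Ax → byContra λ nw → nb (x , Ax , λ _ {w} Aw Uw x<w → nw (w , Aw , Uw , x<w)))
              a , Aa , h = choose-below Λ bnd (a₀ none) bounded
              i , Ui = cover a
              k , i≤k , i₀≤k = later i i₀
              y , hy , y<a = h (_≼_.to-in σ≼κ {k} tt)
          in hy (subst (i₀ σ.≤_) (sym (s-to tt)) i₀≤k) Aa (subst (λ j → U j a) (sym (s-to tt)) (mono i≤k Ui)) y<a
          where
          a₀ : ¬ (∃[ i ] (i₀ σ.≤ i × UnboundedIn A (U i))) → Carrier
          a₀ none = proj₁ (¬∀⇒∃¬′ {P = A} (λ h → none (i₀ , σ.≤-refl , λ {x} Ax → h x Ax)))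
          a₀-in : (none : ¬ (∃[ i ] (i₀ σ.≤ i × UnboundedIn A (U i)))) → A (a₀ none)
          a₀-in none = proj₁ (proj₂ (¬∀⇒∃¬′ {P = A} (λ h → none (i₀ , σ.≤-refl , λ {x} Ax → h x Ax))))

      closed-under : ∀ {i γ} → i₀ σ.≤ i → U i γ → ClosedUnder (proj₁ (block-ops γ)) (U i)
      closed-under l Uγ = record
        { g-closed = closed _ l 0F Uγ
        ; m-closed = closed _ l 1F Uγ
        ; r-closed = λ Ux → closed _ l 2F Uγ Ux Uγ
        ; c-closed = closed _ l 3F Uγ Uγ Uγ
        }

      opaque
        block-stage : ∀ {γ t} → SuccessorBlock Λ (Segment γ) t → Full {A = I} ≼ ⟦ t ⟧< →
                      ∃[ i ] (∀ {x} → Segment γ x → U i x)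
        block-stage {γ} blk σ≼t =
          let open SuccessorBlock blk using (absorbing; big) renaming (cover to t-covers)
              i , i₀≤i , unb = unbounded-stage σ≼t (covered⇒bounds Λ absorbing t-covers big)
              j , Uγ = cover γ
              k , i≤k , j≤k = later i j
          in k , proj₂ (block-ops γ) (_ , blk) (U k) (closed-under (σ.≤-trans i₀≤i i≤k) (mono j≤k Uγ))
                   λ Ax → let w , Aw , Uw , l = unb Ax in w , Aw , mono i≤k Uw , l

      -- A block needs the successor of a regular cardinal. Nothing is known about β, but t = β⁺ is
      -- regular, so that γ = t⁺ carries a block, and it contains β.
      double-successor : ∀ {p} (P : Carrier → Set p) → (∀ {x y} → P x → y < x → P y) →
        (∀ {β} → P β → Infinite ⟦ β ⟧< → ∃[ t ] (P t × ¬ (⟦ t ⟧< ≼ ⟦ β ⟧<))) →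
        ∀ {β} → P β → Full {A = I} ≼ ⟦ β ⟧< → ∃[ i ] (∀ {y} → y ≤ β → U i y)
      double-successor P down larger {β} Pβ σ≼β = i , λ y≤β → h (inj₁ (≤-<-trans y≤β (<-trans β<t t<γ)))
        where
        inf = ≼-trans infinite σ≼β
        next : ∀ {β} → P β → Infinite ⟦ β ⟧< →
               ∃[ t ] ((P t × ¬ (⟦ t ⟧< ≼ ⟦ β ⟧<)) × (∀ y → P y × ¬ (⟦ y ⟧< ≼ ⟦ β ⟧<) → t ≤ y))
        next Pβ inf = least em _ (larger Pβ inf)
        minimal : ∀ {β t} → P t → (∀ y → P y × ¬ (⟦ y ⟧< ≼ ⟦ β ⟧<) → t ≤ y) →
                  ∀ {x} → x < t → ⟦ x ⟧< ≼ ⟦ β ⟧<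
        minimal Pt t-least {x} x<t = byContra λ n → t-least x (down Pt x<t , n) x<t
        t-next = next Pβ inf
        t = proj₁ t-next
        Pt = proj₁ (proj₁ (proj₂ t-next))
        t-big = proj₂ (proj₁ (proj₂ t-next))
        β<t = ≼-below⇒≤ Λ t-big
        t-inf : Infinite ⟦ t ⟧<
        t-inf = ≼-trans inf (⊆⇒≼ λ l → <-trans l β<t)
        γ-next = next Pt t-inf
        γ = proj₁ γ-next
        Pγ = proj₁ (proj₁ (proj₂ γ-next))
        γ-big = proj₂ (proj₁ (proj₂ γ-next))
        t<γ = ≼-below⇒≤ Λ γ-big
        segment⇒< : ∀ {x} → Segment γ x → x < γ
        segment⇒< (inj₁ l)   = l
        segment⇒< (inj₂ bot) = ⊥-elim (bot t t<γ)
        blk : SuccessorBlock Λ (Segment γ) t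
        blk = record
          { absorbing = absorbing-below Λ t-inf
          ; regular   = small-covers⇒regular Λ inf β<t (minimal Pt (proj₂ (proj₂ t-next))) t-big
          ; cover     = λ x Sx → minimal Pγ (proj₂ (proj₂ γ-next)) (segment⇒< Sx)
          ; big       = λ i → γ-big (≼-trans (⊆⇒≼ inj₁) i)
          }
        stage = block-stage blk (≼-trans σ≼β (⊆⇒≼ λ l → <-trans l β<t))
        i = proj₁ stage
        h = proj₂ stage

      -- `P` contains no largest cardinal, so any x in it, once raised to size at least σ, is
      -- swallowed with all its predecessors by one stage. Without a cofinal map from σ these stages
      -- merge into one.
      exhausts : ∀ {P : Carrier → Set ℓ} → (∀ {x y} → P x → y < x → P y) →
        (∀ {β} → P β → Infinite ⟦ β ⟧< → ∃[ t ] (P t × ¬ (⟦ t ⟧< ≼ ⟦ β ⟧<))) →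
        ∃[ β ] (P β × Full {A = I} ≼ ⟦ β ⟧<) → ¬ CofinalMap σ Λ P →
        ∃[ i ] (∀ {x} → P x → U i x)
      exhausts {P} down larger (β , Pβ , σ≼β) no-cof = exhaust σ Λ U β mono stage no-cof
        where
        stage : ∀ {x} → P x → ∃[ i ] (∀ {y} → y ≤ x → P y → U i y)
        stage {x} Px =
          let i , h = double-successor P down larger {max x β} (max-elim P Px Pβ)
                        (≼-trans σ≼β (⊆⇒≼ λ l → <-≤-trans l (≤-maxʳ x β)))
          in i , λ y≤x _ → h (≤-trans y≤x (≤-maxˡ x β))

      module Successor {μ : Carrier} (pred : LeastDominating μ) where

        μ-initial : Initial Λ ⟦ μ ⟧<
        μ-initial y y<μ i = proj₂ pred y (λ x → ≼-trans (proj₁ pred x) i) y<μ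

        σ≼μ : Full {A = I} ≼ ⟦ μ ⟧<
        σ≼μ = ≼-trans (proj₂ small) (proj₁ pred _)

        μ-infinite : Infinite ⟦ μ ⟧<
        μ-infinite = ≼-trans infinite σ≼μ

        bottom : ∃[ γ ] (⊤ × (∀ y → ⊤ → γ ≤ y))
        bottom = least em (λ _ → ⊤) (μ , tt)

        opaque
          -- Here λ itself is a block over μ, and its name is the bottom element.
          regular-case : RegularPoint Λ μ → ∃[ i ] (∀ x → U i x)
          regular-case reg with block-stage {proj₁ bottom} (record
            { absorbing = absorbing-below Λ μ-infinite
            ; regular   = reg
            ; cover     = λ x _ → proj₁ pred x
            ; big       = λ i → Λ-initial μ (≼-trans (⊆⇒≼ λ _ → inj₂ λ y → proj₂ (proj₂ bottom) y tt) i)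
            }) σ≼μ
          ... | i , h = i , λ x → h (inj₂ λ y → proj₂ (proj₂ bottom) y tt)

        opaque
          -- Otherwise μ would be the successor of β, hence regular.
          larger : ¬ RegularPoint Λ μ → ∀ {β} → β < μ → Infinite ⟦ β ⟧< → ∃[ t ] (t < μ × ¬ (⟦ t ⟧< ≼ ⟦ β ⟧<))
          larger ¬reg {β} β<μ inf = ¬∀⇒∃¬′ λ h →
            ¬reg (small-covers⇒regular Λ inf β<μ (λ {x} → h x) (μ-initial β β<μ))

        opaque
          σ-below : ¬ (⟦ μ ⟧< ≼ Full {A = I}) → ∃[ β ] (β < μ × Full {A = I} ≼ ⟦ β ⟧<)
          σ-below μ⋠σ with compare Λ σ i₀ ⟦ μ ⟧< Full
          ... | inj₁ i               = ⊥-elim (μ⋠σ i)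
          ... | inj₂ (β , β<μ , i) = β , β<μ , ≼-trans i (⊆⇒≼ proj₂)

        -- A stage that is unbounded in λ and contains all ordinals below μ contains everything: any
        -- x lies below some w of the stage, and the enumeration of w by μ reaches x.
        singular-case : predecessor? ≡ yes (μ , pred) → ¬ RegularPoint Λ μ → ∃[ i ] (∀ x → U i x)
        singular-case pred≡ ¬reg = k , all
          where
          -- A singular μ cannot have the size of the regular σ.
          μ⋠σ : ¬ (⟦ μ ⟧< ≼ Full {A = I})
          μ⋠σ i = ¬reg (regular-transfer Λ σ regular μ-infinite μ-initial i σ≼μ)
          below-stage : ∃[ i ] (∀ {x} → x < μ → U i x)
          below-stage = exhausts (λ l l′ → <-trans l′ l) (larger ¬reg) (σ-below μ⋠σ)
                          (no-map-below pred μ-initial μ⋠σ)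
          unb : ∃[ i ] (i₀ σ.≤ i × UnboundedIn (λ _ → ⊤ₚ) (U i))
          unb = unbounded-stage σ≼μ (covered⇒bounds Λ (absorbing-below Λ μ-infinite)
                  (λ x _ → proj₁ pred x) λ i → Λ-initial μ (≼-trans (⊆⇒≼ λ _ → ttₚ) i))
          k-later = later (proj₁ below-stage) (proj₁ unb)
          k = proj₁ k-later
          all : ∀ x → U k x
          all x = let w , _ , Uw , x<w = proj₂ (proj₂ unb) {x} ttₚ
                      η , η<μ , e = covering-onto pred x<w
                      Uη = mono (proj₁ (proj₂ k-later)) (proj₂ below-stage η<μ)
                      Uw′ = mono (proj₂ (proj₂ k-later)) Uw
                  in subst (U k) (trans (cong (λ d → covering d w η) pred≡) e)
                       (closed k (σ.≤-trans (proj₁ (proj₂ unb)) (proj₂ (proj₂ k-later))) 4F Uw′ Uη Uη)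

      total : ∃[ i ] (∀ x → U i x)
      total = by-cases predecessor? refl
        where
        by-cases : ∀ d → predecessor? ≡ d → ∃[ i ] (∀ x → U i x)
        by-cases (no none) _ = let i , h = exhausts {P = λ _ → ⊤ₚ} (λ _ _ → ttₚ) larger
                                             (let β , e = small in β , ttₚ , e) no-map′
                               in i , λ x → h ttₚ
          where
          no-map′ : ¬ CofinalMap σ Λ (λ _ → ⊤ₚ)
          no-map′ c = no-map record
            { map = CofinalMap.map c ; map-in = λ _ → tt
            ; monotone = CofinalMap.monotone c ; cofinal = λ _ → CofinalMap.cofinal c ttₚ }
          larger : ∀ {β} → ⊤ₚ → Infinite ⟦ β ⟧< → ∃[ t ] (⊤ₚ × ¬ (⟦ t ⟧< ≼ ⟦ β ⟧<))
          larger {β} _ _ with ¬∀⇒∃¬ {P = λ x → ⟦ x ⟧< ≼ ⟦ β ⟧<} (λ h → none (least em Dominates (β , h)))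
          ... | t , ¬i = t , ttₚ , ¬i
        by-cases (yes (μ , pred)) eq with em {P = RegularPoint Λ μ}
        ... | yes reg = Successor.regular-case pred reg
        ... | no ¬reg = Successor.singular-case pred eq ¬reg

-- Cantor-Bernstein for setoids, and cardinals as well-orders with propositional equality.

module Cardinals where

  open import Axiom.ExcludedMiddle using (ExcludedMiddle)
  open import Axiom.UniquenessOfIdentityProofs.WithK using (uip)
  open import Data.Empty using (⊥-elim)
  open import Data.Fin.Base using (Fin; zero; suc; fromℕ<)
  open import Data.Fin.Properties using (fromℕ<-injective; fromℕ<-cong)
  open import Data.List.Base using (List; []; _∷_; tabulate)
  open import Data.List.Relation.Unary.Any as Any using (Any; here; there)
  open import Data.List.Membership.Propositional.Properties using (∈-tabulate⁺)
  open import Data.Nat.Base as ℕ using (ℕ)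
  open import Data.Product using (Σ-syntax; ∃-syntax; _×_; _,_; proj₁; proj₂)
  open import Data.Sum.Base using (inj₁; inj₂)
  open import Data.Unit.Base using (tt)
  open import Function.Base using (_∘_)
  open import Function.Bundles using (Func; Injection; Bijection)
  open import Level using (Level; _⊔_)
  open import Relation.Binary.Bundles using (Setoid; StrictTotalOrder)
  import Relation.Binary.Construct.On as On
  open import Relation.Binary.Definitions using (Tri; tri<; tri≈; tri>)
  open import Relation.Binary.PropositionalEquality using (_≡_; refl; sym; trans; cong; subst; setoid)
  open import Relation.Nullary using (¬_; Dec; yes; no)
  open import Defs
  open WellOrders
  open Sizes
  open Blocks
  open Stages

  ≲-trans : ∀ {a a′ b b′ c c′} {S : Setoid a a′} {T : Setoid b b′} {V : Setoid c c′} →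
            S ≲ T → T ≲ V → S ≲ V
  ≲-trans f g = record
    { to        = Injection.to g ∘ Injection.to f
    ; cong      = Injection.cong g ∘ Injection.cong f
    ; injective = Injection.injective f ∘ Injection.injective g
    }

  ≃⇒≳ : ∀ {a a′ b b′} {S : Setoid a a′} {T : Setoid b b′} → S ≃ T → T ≲ S
  ≃⇒≳ {S = S} {T} f = record
    { to        = to⁻
    ; cong      = λ {x} {y} e → injective (T.trans (to-to⁻ x) (T.trans e (T.sym (to-to⁻ y))))
    ; injective = λ {x} {y} e → T.trans (T.sym (to-to⁻ x)) (T.trans (cong′ e) (to-to⁻ y))
    }
    where
    open Bijection f using (to⁻; injective; surjective) renaming (cong to cong′)
    module S = Setoid S
    module T = Setoid T
    to-to⁻ : ∀ y → T._≈_ (Bijection.to f (to⁻ y)) y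
    to-to⁻ y = proj₂ (surjective y) S.refl

  module Comparison (em : ∀ {a} → ExcludedMiddle a) where
    open LEM em

    module _ {a a′ b b′} {S : Setoid a a′} {T : Setoid b b′} (i : S ≲ T) (j : T ≲ S) where
      private
        module S = Setoid S
        module T = Setoid T
        module i = Injection i
        module j = Injection j

        InImage : S.Carrier → Set _
        InImage x = ∃[ t ] (j.to t S.≈ x)

        -- The points reached from outside the image of `j` by going back and forth. The bijection
        -- follows `i` on them and inverts `j` on the others.
        data Forward : S.Carrier → Set (a ⊔ a′ ⊔ b ⊔ b′) where
          start : ∀ {x} → ¬ InImage x → Forward x
          next  : ∀ {x y} → Forward x → j.to (i.to x) S.≈ y → Forward y

        forward-resp : ∀ {x y} → x S.≈ y → Forward x → Forward y
        forward-resp e (start ¬im)  = start λ (t , h) → ¬im (t , S.trans h (S.sym e))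
        forward-resp e (next fx h)  = next fx (S.trans h e)

        image : ∀ {x} → ¬ Forward x → InImage x
        image ¬f = byContra λ ¬im → ¬f (start ¬im)

        choice : ∀ x → Dec (Forward x) → T.Carrier
        choice x (yes _) = i.to x
        choice x (no ¬f) = proj₁ (image ¬f)

        compat : ∀ {x y} (p : Dec (Forward x)) (q : Dec (Forward y)) → x S.≈ y → choice x p T.≈ choice y q
        compat (yes _) (yes _) e  = i.cong e
        compat (yes f) (no ¬f) e  = ⊥-elim (¬f (forward-resp e f))
        compat (no ¬f) (yes f) e  = ⊥-elim (¬f (forward-resp (S.sym e) f))
        compat (no ¬f) (no ¬g) e  = j.injective
          (S.trans (proj₂ (image ¬f)) (S.trans e (S.sym (proj₂ (image ¬g)))))

        reflects : ∀ {x y} (p : Dec (Forward x)) (q : Dec (Forward y)) → choice x p T.≈ choice y q → x S.≈ y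
        reflects (yes _) (yes _) e = i.injective e
        reflects (yes f) (no ¬f) e = ⊥-elim (¬f (next f (S.trans (j.cong e) (proj₂ (image ¬f)))))
        reflects (no ¬f) (yes f) e = ⊥-elim (¬f (next f (S.trans (j.cong (T.sym e)) (proj₂ (image ¬f)))))
        reflects (no ¬f) (no ¬g) e = S.trans (S.sym (proj₂ (image ¬f))) (S.trans (j.cong e) (proj₂ (image ¬g)))

        hit : ∀ t → Dec (Forward (j.to t)) → ∃[ x ] (∀ p → choice x p T.≈ t)
        hit t (no ¬f)               = j.to t , λ where
          (yes f)  → ⊥-elim (¬f f)
          (no ¬f′) → j.injective (proj₂ (image ¬f′))
        hit t (yes (start ¬im))     = ⊥-elim (¬im (t , S.refl))
        hit t (yes (next {x} f h))  = x , λ where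
          (yes _) → j.injective h
          (no ¬f) → ⊥-elim (¬f f)

      cantor-bernstein : S ≃ T
      cantor-bernstein = record
        { to        = λ x → choice x em
        ; cong      = λ {x} {y} → compat {x} {y} em em
        ; bijective = (λ {x} {y} → reflects {x} {y} em em) ,
                      λ t → let x , h = hit t em in
                            x , λ {z} e → T.trans (compat {z} {x} em em e) (h em)
        }

    module _ {a b} (S : Setoid a b) where
      private module S = Setoid S

      private
        record Enumeration (xs : List S.Carrier) : Set (a ⊔ b) where
          field
            size      : ℕ
            at        : Fin size → S.Carrier
            distinct  : ∀ {i j} → at i S.≈ at j → i ≡ j
            exhausted : ∀ {x} → Any (x S.≈_) xs → ∃[ i ] (x S.≈ at i)

        enumerate : ∀ xs → Enumeration xs
        enumerate [] = record { size = 0 ; at = λ () ; distinct = λ {} ; exhausted = λ () }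
        enumerate (x ∷ xs) with em {P = ∃[ i ] (x S.≈ Enumeration.at (enumerate xs) i)}
        ... | yes (i , e) = record
          { Enumeration (enumerate xs) ; exhausted = λ where
              (here h)  → i , S.trans h e
              (there h) → Enumeration.exhausted (enumerate xs) h }
        ... | no new = record
          { size      = ℕ.suc size
          ; at        = at′
          ; distinct  = λ {i} {j} → distinct′ i j
          ; exhausted = λ where
              (here h)  → zero , h
              (there h) → let i , e = exhausted h in suc i , e }
          where
          open Enumeration (enumerate xs)
          at′ : Fin (ℕ.suc size) → S.Carrier
          at′ zero    = x
          at′ (suc i) = at i
          distinct′ : ∀ i j → at′ i S.≈ at′ j → i ≡ j
          distinct′ zero    zero    _ = refl
          distinct′ zero    (suc j) e = ⊥-elim (new (j , e))
          distinct′ (suc i) zero    e = ⊥-elim (new (i , S.sym e))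
          distinct′ (suc i) (suc j) e = cong suc (distinct e)

      covered⇒finite : (xs : List S.Carrier) → (∀ x → Any (x S.≈_) xs) → Finite S
      covered⇒finite xs all = size , record
        { to        = λ x → proj₁ (index x)
        ; cong      = λ {x} {y} e → distinct (S.trans (S.sym (proj₂ (index x))) (S.trans e (proj₂ (index y))))
        ; bijective = (λ {x} {y} e → S.trans (proj₂ (index x)) (S.trans (S.reflexive (cong at e)) (S.sym (proj₂ (index y))))) ,
                      λ i → at i , λ {z} e → distinct (S.trans (S.sym (proj₂ (index z))) e)
        }
        where
        open Enumeration (enumerate xs)
        index : ∀ x → ∃[ i ] (x S.≈ at i)
        index x = exhausted (all x)

      ≲Fin⇒finite : ∀ {n} → S ≲ setoid (Fin n) → Finite S
      ≲Fin⇒finite {n} f with em {P = S.Carrier}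
      ... | no empty = covered⇒finite [] λ x → ⊥-elim (empty x)
      ... | yes x₀   = covered⇒finite (tabulate s) λ x → Any.map (λ { refl → s-to x }) (∈-tabulate⁺ (to x))
        where
        open Injection f
        s : Fin n → S.Carrier
        s i with em {P = ∃[ x ] (to x ≡ i)}
        ... | yes (x , _) = x
        ... | no _        = x₀
        s-to : ∀ x → x S.≈ s (to x)
        s-to x with em {P = ∃[ y ] (to y ≡ to x)}
        ... | yes (y , e) = injective (sym e)
        ... | no none     = ⊥-elim (none (x , refl))

  module Canonical (em : ∀ {a} → ExcludedMiddle a) (ac : AxiomOfChoice) where
    open LEM em
    open Cardinality em
    open Bounding em
    open Exhaustion em
    open Comparison em

    module _ {a b : Level} (S : Setoid a b) where
      open Setoid S renaming (refl to ≈-refl; sym to ≈-sym; trans to ≈-trans)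

      private opaque
        choice : Σ[ f ∈ Func S (setoid Carrier) ] (∀ x → x ≈ Func.to f x)
        choice = ac S (setoid Carrier) _≈_ (λ e → ≈-trans (≈-sym e)) (λ { refl h → h }) λ x → x , ≈-refl

      representative : Carrier → Carrier
      representative = Func.to (proj₁ choice)

      representative-≈ : ∀ x → x ≈ representative x
      representative-≈ = proj₂ choice

      representative-cong : ∀ {x y} → x ≈ y → representative x ≡ representative y
      representative-cong = Func.cong (proj₁ choice)

    -- Choice selects representatives of the classes of a setoid, so quotients are available.
    record Canon {a b : Level} (S : Setoid a b) : Set a where
      constructor canon
      field
        out   : Setoid.Carrier S
        fixed : representative S out ≡ out

    open Canon public using (out)

    module _ {a b : Level} {S : Setoid a b} where
      open Setoid S renaming (refl to ≈-refl; sym to ≈-sym; trans to ≈-trans)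

      class : Carrier → Canon S
      class x = canon (representative S x) (sym (representative-cong S (representative-≈ S x)))

      out-class : ∀ x → out (class x) ≈ x
      out-class x = ≈-sym (representative-≈ S x)

      out-injective : ∀ {c d : Canon S} → out c ≈ out d → c ≡ d
      out-injective {canon x p} {canon y q} e with trans (sym p) (trans (representative-cong S e) q)
      ... | refl = cong (canon x) (uip p q)

      class-cong : ∀ {x y} → x ≈ y → class x ≡ class y
      class-cong e = out-injective (≈-trans (out-class _) (≈-trans e (≈-sym (out-class _))))

      class-injective : ∀ {x y} → class x ≡ class y → x ≈ y
      class-injective {x} {y} e =
        ≈-trans (≈-sym (out-class x)) (≈-trans (Setoid.reflexive S (cong out e)) (out-class y))

      class-out : ∀ c → class (out c) ≡ c
      class-out c = out-injective (out-class (out c))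

    module _ {a b c d : Level} {S : Setoid a b} {T : Setoid c d} where

      ≲⇒≼ : S ≲ T → Full {A = Canon S} ≼ Full {A = Canon T}
      ≲⇒≼ f = inj (class ∘ to ∘ out) (λ _ → tt) λ _ _ e → out-injective (injective (class-injective e))
        where open Injection f

      ≼⇒≲ : Full {A = Canon S} ≼ Full {A = Canon T} → S ≲ T
      ≼⇒≲ (inj f _ f-inj) = record
        { to        = out ∘ f ∘ class
        ; cong      = λ e → Setoid.reflexive T (cong (out ∘ f) (class-cong e))
        ; injective = λ e → class-injective (f-inj tt tt (out-injective e))
        }

      ≼⇒≲-subset : ∀ {ℓ} (U : Subset T ℓ) → Full {A = Canon S} ≼ (member U ∘ out) → S ≲ ⟦ U ⟧
      ≼⇒≲-subset U (inj f f-in f-inj) = record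
        { to        = λ x → out (f (class x)) , f-in tt
        ; cong      = λ e → Setoid.reflexive T (cong (out ∘ f) (class-cong e))
        ; injective = λ e → class-injective (f-inj tt tt (out-injective {S = T} e))
        }

      ≲⇒≼-subset : ∀ {ℓ} (U : Subset T ℓ) → S ≲ ⟦ U ⟧ → Full {A = Canon S} ≼ (member U ∘ out)
      ≲⇒≼-subset U f = inj (λ c → class (proj₁ (to (out c))))
        (λ {c} _ → respect U (Setoid.sym T (out-class {S = T} _)) (proj₂ (to (out c))))
        λ _ _ e → out-injective (injective (class-injective {S = T} e))
        where open Injection f

    module _ {ℓ : Level} (κ : Cardinal ℓ) where
      private
        module κ = Cardinal κ
        module O = StrictTotalOrder κ.order

      ordinal : WellOrder ℓ
      ordinal = record
        { Carrier = Canon ∣ κ ∣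
        ; _<_     = λ c d → out c κ.< out d
        ; <-trans = O.trans
        ; cmp     = λ c d → tri (O.compare (out c) (out d))
        ; wf      = On.wellFounded out κ.wellFounded
        }
        where
        tri : ∀ {c d} → Tri (out c κ.< out d) (out c κ.≈ out d) (out d κ.< out c) →
              Tri (out c κ.< out d) (c ≡ d) (out d κ.< out c)
        tri (tri< l ¬e ¬g) = tri< l (λ { refl → ¬e O.Eq.refl }) ¬g
        tri (tri≈ ¬l e ¬g) = tri≈ ¬l (out-injective e) ¬g
        tri (tri> ¬l ¬e g) = tri> ¬l (λ { refl → ¬e O.Eq.refl }) g

      open WellOrder ordinal

      ≤⇒NonStrict : ∀ {x y} → class x ≤ class y → x κ.≤ y
      ≤⇒NonStrict {x} {y} h with O.compare x y
      ... | tri< l _ _ = inj₁ l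
      ... | tri≈ _ e _ = inj₂ e
      ... | tri> _ _ g = ⊥-elim (h (O.<-respˡ-≈ (O.Eq.sym (out-class {S = ∣ κ ∣} y))
                                   (O.<-respʳ-≈ (O.Eq.sym (out-class {S = ∣ κ ∣} x)) g)))

      NonStrict⇒≤ : ∀ {c d} → out c κ.≤ out d → c ≤ d
      NonStrict⇒≤ (inj₁ l) g = O.irrefl O.Eq.refl (O.trans l g)
      NonStrict⇒≤ (inj₂ e) g = O.irrefl (O.Eq.sym e) g

      ordinal-initial : ∀ x → ¬ (Full {A = Carrier} ≼ below ordinal x)
      ordinal-initial x i = κ.initial (out x) (cantor-bernstein
        record { to = proj₁ ; cong = λ e → e ; injective = λ e → e }
        (≼⇒≲-subset {T = ∣ κ ∣} (initialSegment κ.order (out x)) i))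

      regular⇒ : Regular κ → RegularOrder ordinal
      regular⇒ (_ , _ , least-size) V V-cof =
        ≼-trans (≲⇒≼-subset {T = ∣ κ ∣} U (least-size U λ x → cof (V-cof (class x))))
                (⊆⇒≼ λ {c} → subst V (class-out c))
        where
        U : Subset ∣ κ ∣ ℓ
        U = record { member = V ∘ class ; respect = λ e → subst V (class-cong e) }
        cof : ∀ {x} → ∃[ y ] (V y × class x ≤ y) → ∃[ y ] (V (class y) × x κ.≤ y)
        cof (y , Vy , l) = out y , subst V (sym (class-out y)) Vy ,
                           ≤⇒NonStrict (subst (class _ ≤_) (sym (class-out y)) l)

      infinite : ¬ Finite ∣ κ ∣ → Infinite {A = Carrier} Full
      infinite ¬fin = byContra λ ¬inf → ¬fin (finite ¬inf (em {P = Carrier}))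
        where
        finite : ¬ Infinite {A = Carrier} Full → Dec Carrier → Finite ∣ κ ∣
        finite _ (no empty) = covered⇒finite ∣ κ ∣ [] λ x → ⊥-elim (empty (class x))
        finite ¬inf (yes x) with ¬infinite⇒bounded ordinal x ¬inf
        ... | n , inj f f-in f-inj = ≲Fin⇒finite ∣ κ ∣ record
          { to        = λ x → fromℕ< (f-in {class x} tt)
          ; cong      = λ e → fromℕ<-cong _ _ (cong f (class-cong e)) (f-in tt) (f-in tt)
          ; injective = λ e → class-injective (f-inj tt tt (fromℕ<-injective _ _ _ _ e))
          }

-- Translating σ ∉ Θ into the absence of cofinal maps from σ.

module Cofinalities where

  open import Axiom.ExcludedMiddle using (ExcludedMiddle)
  open import Data.Empty using (⊥-elim)
  open import Data.Fin.Base using (Fin; zero)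
  open import Data.Product using (∃-syntax; _×_; _,_; proj₁; proj₂)
  open import Data.Sum.Base using (inj₁; inj₂)
  open import Data.Unit.Base using (tt)
  open import Function.Base using (id)
  open import Function.Bundles using (Injection; Bijection)
  import Function.Construct.Identity as Identity
  open import Level using (Level)
  open import Relation.Binary.Bundles using (Setoid; StrictTotalOrder)
  import Relation.Binary.Construct.On as On
  open import Relation.Binary.PropositionalEquality using (_≡_; refl; sym; trans; cong; subst; setoid)
  open import Relation.Nullary using (¬_; Dec; yes; no)
  open import Defs
  open WellOrders
  open Sizes
  open Blocks
  open Stages
  open JonssonAlgebras
  open Cardinals

  module Cofinality (em : ∀ {a} → ExcludedMiddle a) (ac : AxiomOfChoice) where
    open LEM em
    open Cardinality em
    open Bounding em
    open Exhaustion em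
    open Comparison em
    open Canonical em ac

    module _ {ℓ : Level} (κ σ : Cardinal ℓ) (i₀ : Canon ∣ σ ∣) (reg : RegularOrder (ordinal σ))
             (h : CofinalMap (ordinal σ) (ordinal κ) (Full {A = Canon ∣ κ ∣})) where
      private
        module K = WellOrder (ordinal κ)
        module I = WellOrder (ordinal σ)
        module κ = Cardinal κ
        open CofinalMap h
        open I.Minimum em i₀

        Reaches : K.Carrier → I.Carrier → Set ℓ
        Reaches x i = x K.≤ map i

        first : K.Carrier → I.Carrier
        first x = μ (Reaches x)

        first-reaches : ∀ x → x K.≤ map (first x)
        first-reaches x = μ-sat (Reaches x) (let i , l = cofinal {x} tt in i , K.<⇒≤ {x} {map i} l)

        -- `first` sends a cofinal subset of κ to a cofinal subset of σ, which has full size by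
        -- regularity.
        least-size : ∀ (V : Subset ∣ κ ∣ ℓ) → Cofinal κ V → ∣ σ ∣ ≲ ⟦ V ⟧
        least-size V V-cof = ≼⇒≲-subset {T = ∣ κ ∣} V
          (≼-trans (reg W W-cofinal) (onto⇒≽ (map i₀) first λ _ (d , Vd , e) → d , Vd , e))
          where
          W : I.Carrier → Set ℓ
          W y = ∃[ d ] (member V (out d) × first d ≡ y)
          W-cofinal : ∀ p → ∃[ y ] (W y × p I.≤ y)
          W-cofinal p =
            let i , l = cofinal {map p} tt
                y , Vy , m≤y = V-cof (out (map i))
                d = class y
                mi≤d : map i K.≤ d
                mi≤d = NonStrict⇒≤ κ {map i} {d} (≤-resp m≤y)
            in first d , (d , respect V (Setoid.sym ∣ κ ∣ (out-class {S = ∣ κ ∣} y)) Vy , refl) ,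
               λ f<p → first-reaches d (K.≤-<-trans {map (first d)} {map p} {d}
                 (monotone (I.<⇒≤ {first d} {p} f<p)) (K.<-≤-trans {map p} {map i} {d} l mi≤d))
            where
            ≤-resp : ∀ {x y} → x κ.≤ y → x κ.≤ out {S = ∣ κ ∣} (class y)
            ≤-resp (inj₁ l) = inj₁ (StrictTotalOrder.<-respʳ-≈ κ.order (Setoid.sym ∣ κ ∣ (out-class {S = ∣ κ ∣} _)) l)
            ≤-resp (inj₂ e) = inj₂ (Setoid.trans ∣ κ ∣ e (Setoid.sym ∣ κ ∣ (out-class {S = ∣ κ ∣} _)))

        Range : Subset ∣ κ ∣ ℓ
        Range = record
          { member  = λ x → ∃[ i ] (class x ≡ map i)
          ; respect = λ e (i , q) → i , trans (sym (class-cong e)) q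
          }

        range-cofinal : Cofinal κ Range
        range-cofinal x = let i , l = cofinal {class x} tt in
          out (map i) , (i , class-out (map i)) ,
          ≤⇒NonStrict κ (subst (class x K.≤_) (sym (class-out (map i))) (K.<⇒≤ {class x} {map i} l))

        range≲σ : ⟦ Range ⟧ ≲ ∣ σ ∣
        range≲σ = record
          { to        = λ (x , _) → out (index x)
          ; cong      = λ {(x , _)} {(y , _)} e → Setoid.reflexive ∣ σ ∣ (cong out
              (μ-cong (λ i q → trans (sym (class-cong e)) q) (λ i q → trans (class-cong e) q)))
          ; injective = λ {(x , p)} {(y , q)} e → class-injective (trans (index-sat p)
              (trans (cong map (out-injective {S = ∣ σ ∣} e)) (sym (index-sat q))))
          }
          where
          index : κ.Carrier → I.Carrier
          index x = μ (λ i → class x ≡ map i)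
          index-sat : ∀ {x} → member Range x → class x ≡ map (index x)
          index-sat = μ-sat _

      cofinalMap⇒Cf : Cf κ σ
      cofinalMap⇒Cf = (Range , range-cofinal , cantor-bernstein range≲σ (least-size Range range-cofinal)) ,
                      least-size

    module _ {ℓ : Level} (κ : Cardinal ℓ) (m : Canon ∣ κ ∣)
             (m-initial : Initial (ordinal κ) (below (ordinal κ) m)) where
      private
        module κ = Cardinal κ
        module K = WellOrder (ordinal κ)
        module O = StrictTotalOrder κ.order

      segment-order : StrictTotalOrder ℓ ℓ ℓ
      segment-order = On.strictTotalOrder {B = ∃[ x ] (x κ.< out m)} κ.order proj₁

      segment : Cardinal ℓ
      segment = record
        { order       = segment-order
        ; wellFounded = On.wellFounded proj₁ κ.wellFounded
        ; initial     = λ x b → m-initial (class (proj₁ x))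
            (O.<-respˡ-≈ (O.Eq.sym (out-class {S = ∣ κ ∣} (proj₁ x))) (proj₂ x)) (smaller x (≃⇒≳ b))
        }
        where
        smaller : ∀ x → StrictTotalOrder.Eq.setoid segment-order ≲ ⟦ initialSegment segment-order x ⟧ →
                  below (ordinal κ) m ≼ below (ordinal κ) (class (proj₁ x))
        smaller x i = inj (λ c → f c em) (λ {c} l → f-in c em l) (λ {c} {d} l l′ → f-inj c d em em l l′)
          where
          open Injection i
          f : ∀ c → Dec (c K.< m) → K.Carrier
          f c (yes l) = class (proj₁ (proj₁ (to (out c , l))))
          f c (no _)  = c
          f-in : ∀ c (p : Dec (c K.< m)) → c K.< m → f c p K.< class (proj₁ x)
          f-in c (yes l) _ = O.<-respˡ-≈ (O.Eq.sym (out-class {S = ∣ κ ∣} _))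
            (O.<-respʳ-≈ (O.Eq.sym (out-class {S = ∣ κ ∣} (proj₁ x))) (proj₂ (to (out c , l))))
          f-in c (no ¬l) l = ⊥-elim (¬l l)
          f-inj : ∀ c d (p : Dec (c K.< m)) (q : Dec (d K.< m)) → c K.< m → d K.< m → f c p ≡ f d q → c ≡ d
          f-inj c d (yes _) (yes _) _ _ e = out-injective (injective (class-injective {S = ∣ κ ∣} e))
          f-inj c d (no ¬l) _ l _ _       = ⊥-elim (¬l l)
          f-inj c d _ (no ¬l) _ l _       = ⊥-elim (¬l l)

      segment≲ : ∣ segment ∣ ≲ ∣ κ ∣
      segment≲ = record { to = proj₁ ; cong = id ; injective = id }

      ≲segment : ∀ {a b} {S : Setoid a b} → Full {A = Canon S} ≼ below (ordinal κ) m → S ≲ ∣ segment ∣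
      ≲segment i = record { to = to ; cong = cong′ ; injective = injective }
        where open Injection (≼⇒≲-subset {T = ∣ κ ∣} (initialSegment κ.order (out m)) i) renaming (cong to cong′)

      segment≲⇒≼ : ∀ {a b} {S : Setoid a b} → Canon S → ∣ segment ∣ ≲ S →
                   below (ordinal κ) m ≼ Full {A = Canon S}
      segment≲⇒≼ {S = S} c₀ i = inj (λ c → f c em) (λ _ → tt) (λ {c} {d} l l′ → f-inj c d em em l l′)
        where
        open Injection i
        f : ∀ c → Dec (c K.< m) → Canon S
        f c (yes l) = class (to (out c , l))
        f c (no _)  = c₀
        f-inj : ∀ c d (p : Dec (c K.< m)) (q : Dec (d K.< m)) → c K.< m → d K.< m → f c p ≡ f d q → c ≡ d
        f-inj c d (yes _) (yes _) _ _ e = out-injective (injective (class-injective {S = S} e))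
        f-inj c d (no ¬l) _ l _ _       = ⊥-elim (¬l l)
        f-inj c d _ (no ¬l) _ l _       = ⊥-elim (¬l l)

      segment-map : ∀ {σ : WellOrder ℓ} → CofinalMap σ (ordinal κ) (below (ordinal κ) m) →
                    CofinalMap σ (ordinal segment) (Full {A = Canon ∣ segment ∣})
      segment-map h = record
        { map      = λ i → class (out (map i) , map-in i)
        ; map-in   = λ _ → tt
        ; monotone = λ i≤j l → monotone i≤j
            (O.<-respˡ-≈ (out-class {S = ∣ segment ∣} _) (O.<-respʳ-≈ (out-class {S = ∣ segment ∣} _) l))
        ; cofinal  = λ {x} _ → let i , l = cofinal {class (proj₁ (out x))}
                                     (O.<-respˡ-≈ (O.Eq.sym (out-class {S = ∣ κ ∣} _)) (proj₂ (out x)))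
                               in i , O.<-respʳ-≈ (O.Eq.sym (out-class {S = ∣ segment ∣} _))
                                        (O.<-respˡ-≈ (out-class {S = ∣ κ ∣} _) l)
        }
        where open CofinalMap h

    module _ {ℓ : Level} (θ : Cardinal ℓ) (θ-regular : Regular θ) where

      Cf-unique : ∀ {σ : Cardinal ℓ} → Cf θ σ → ∣ σ ∣ ≃ ∣ θ ∣
      Cf-unique ((U , U-cof , U≃σ) , σ-least) with proj₂ θ-regular
      ... | (V , V-cof , V≃θ) , θ-least = cantor-bernstein
        (≲-trans (σ-least V V-cof) (Bijection.injection V≃θ))
        (≲-trans (θ-least U U-cof) (Bijection.injection U≃σ))

      -- A maximum alone would be a cofinal set, and θ embeds into each of its cofinal subsets.
      no-maximum : ∀ p → ∃[ q ] WellOrder._<_ (ordinal θ) p q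
      no-maximum p = byContra λ none → proj₁ θ-regular (≲Fin⇒finite ∣ θ ∣ (collapse none))
        where
        module O = StrictTotalOrder (Cardinal.order θ)
        open WellOrder (ordinal θ)
        top : Subset ∣ θ ∣ ℓ
        top = record { member = λ x → O._≈_ x (out p) ; respect = λ e h → O.Eq.trans (O.Eq.sym e) h }
        collapse : ¬ (∃[ q ] (p < q)) → ∣ θ ∣ ≲ setoid (Fin 1)
        collapse none = record
          { to        = λ _ → zero
          ; cong      = λ _ → refl
          ; injective = λ {x} {y} _ → Injection.injective only (O.Eq.trans (proj₂ (Injection.to only x))
                                         (O.Eq.sym (proj₂ (Injection.to only y))))
          }
          where
          only : ∣ θ ∣ ≲ ⟦ top ⟧
          only = proj₂ (proj₂ θ-regular) top λ x → out p , O.Eq.refl ,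
            ≤⇒NonStrict θ λ l → none (class x , subst (_< class x) (class-out p) l)

    module _ {ℓ : Level} (lam θ σ : Cardinal ℓ) (lam-infinite : Infinite {A = Canon ∣ lam ∣} Full)
             (σ≺lam : ∣ σ ∣ ≺ ∣ lam ∣) (σ-regular : Regular σ) (σ∉Θ : ¬ Θ lam θ σ) where
      private
        module Λ = WellOrder (ordinal lam)
        σ≲lam = proj₁ σ≺lam

      open Algebra em (ordinal lam) lam-infinite (ordinal-initial lam)

      σ-infinite : Infinite {A = Canon ∣ σ ∣} Full
      σ-infinite = infinite σ (proj₁ σ-regular)

      private
        i₀ : Canon ∣ σ ∣
        i₀ = _≼_.to σ-infinite 0

        σ-small : ∃[ x ] (Full {A = Canon ∣ σ ∣} ≼ below (ordinal lam) x)
        σ-small with compare (ordinal lam) (ordinal σ) i₀ Full Full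
        ... | inj₁ i           = ⊥-elim (proj₂ σ≺lam (cantor-bernstein σ≲lam (≼⇒≲ i)))
        ... | inj₂ (x , _ , i) = x , ≼-trans i (⊆⇒≼ proj₂)

        module _ {μ : Λ.Carrier} (pred : LeastDominating μ)
                 (μ-init : Initial (ordinal lam) (below (ordinal lam) μ))
                 (μ⋠σ : ¬ (below (ordinal lam) μ ≼ Full {A = Canon ∣ σ ∣}))
                 (h : CofinalMap (ordinal σ) (ordinal lam) (below (ordinal lam) μ)) where

          μ-cardinal : Cardinal ℓ
          μ-cardinal = segment lam μ μ-init

          successor : IsSuccessor lam μ-cardinal
          successor = (segment≲ lam μ μ-init , λ b → ordinal-initial lam μ (lam≼μ (≃⇒≳ b))) , minimal
            where
            lam≼μ : ∣ lam ∣ ≲ ∣ μ-cardinal ∣ → Full {A = Canon ∣ lam ∣} ≼ below (ordinal lam) μ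
            lam≼μ i = ≲⇒≼-subset {T = ∣ lam ∣} (initialSegment (Cardinal.order lam) (out μ))
                        record { to = to ; cong = cong′ ; injective = injective }
              where open Injection i renaming (cong to cong′)
            minimal : ∀ κ → ∣ μ-cardinal ∣ ≺ ∣ κ ∣ → ∣ lam ∣ ≲ ∣ κ ∣
            minimal κ (μ≲κ , μ≄κ) with compare (ordinal lam) (ordinal κ)
                (class (Injection.to μ≲κ (out (CofinalMap.map h i₀) , CofinalMap.map-in h i₀))) Full Full
            ... | inj₁ i           = ≼⇒≲ i
            ... | inj₂ (x , _ , i) = ⊥-elim (μ≄κ (cantor-bernstein μ≲κ
                    (≲segment lam μ μ-init (≼-trans i (≼-trans (⊆⇒≼ proj₂) (proj₁ pred x))))))

          σ≺μ : ∣ σ ∣ ≺ ∣ μ-cardinal ∣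
          σ≺μ = ≲segment lam μ μ-init (≼-trans (proj₂ σ-small) (proj₁ pred (proj₁ σ-small))) ,
                λ b → μ⋠σ (segment≲⇒≼ lam μ μ-init i₀ (≃⇒≳ b))

          -- The exceptional clause of `Θ`: λ = μ⁺ with cf μ = σ < μ.
          excluded : Θ lam θ σ
          excluded = inj₂ (inj₂ (μ-cardinal , successor , σ ,
            cofinalMap⇒Cf μ-cardinal σ i₀ (regular⇒ σ σ-regular) (segment-map lam μ μ-init h) ,
            σ≺μ , Identity.bijection ∣ σ ∣))

      admissible : Admissible (ordinal σ)
      admissible = record
        { regular      = regular⇒ σ σ-regular
        ; infinite     = σ-infinite
        ; small        = σ-small
        ; no-map       = λ h → σ∉Θ (inj₁ (cofinalMap⇒Cf lam σ i₀ (regular⇒ σ σ-regular) h))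
        ; no-map-below = λ {μ} pred μ-init μ⋠σ h → σ∉Θ (excluded {μ} pred μ-init μ⋠σ h)
        }

      no-map-θ : Regular θ → ¬ CofinalMap (ordinal σ) (ordinal θ) (Full {A = Canon ∣ θ ∣})
      no-map-θ θ-regular h = σ∉Θ (inj₂ (inj₁ (Cf-unique θ θ-regular {σ}
        (cofinalMap⇒Cf θ σ i₀ (regular⇒ σ σ-regular) h))))

-- Groups generated by involutions; local finiteness from uniformly bounded orbits.

module InvolutionGroups where

  open import Algebra.Bundles using (Group)
  open import Axiom.ExcludedMiddle using (ExcludedMiddle)
  open import Data.Empty using (⊥-elim)
  open import Data.Fin.Base as Fin using (Fin; zero; suc; combine; remQuot)
  open import Data.Fin.Properties using (remQuot-combine)
  open import Data.List.Base using (List; []; _∷_; _++_; map; concat; length; lookup; reverse; [_]; tabulate)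
  open import Data.List.Properties using (++-assoc; ++-identityʳ; unfold-reverse)
  open import Data.List.Membership.Propositional using (_∈_)
  open import Data.List.Membership.Propositional.Properties using (∈-tabulate⁺; ∈-tabulate⁻; ∈-concat⁺′; ∈-lookup)
  open import Data.List.Relation.Unary.All as All using (All; []; _∷_)
  import Data.List.Relation.Unary.All.Properties as Allₚ
  import Data.List.Relation.Unary.Any.Properties as Anyₚ
  open import Data.List.Relation.Unary.Any as Any using (Any; here; there)
  open import Data.Nat.Base as ℕ using (ℕ; s≤s)
  open import Data.Product using (Σ-syntax; ∃; ∃-syntax; _×_; _,_; proj₁; proj₂)
  open import Data.Vec.Base as Vec using (Vec; []; _∷_)
  import Data.Vec.Properties as Vecₚ
  open import Function.Base using (_∘_; id)
  open import Level using (Level) renaming (suc to lsuc)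
  open import Relation.Binary.PropositionalEquality using (_≡_; refl; sym; trans; cong; cong₂; subst)
  open import Relation.Nullary using (yes; no)
  open import Defs
  open Sizes
  open Cardinals

  Enumerable : ∀ {a} → Set a → Set a
  Enumerable A = Σ[ n ∈ ℕ ] Σ[ e ∈ (Fin n → A) ] (∀ x → ∃[ i ] (e i ≡ x))

  enumerable-Fin : ∀ n → Enumerable (Fin n)
  enumerable-Fin n = n , id , λ i → i , refl

  enumerable-Vec : ∀ {a} {A : Set a} → Enumerable A → ∀ k → Enumerable (Vec A k)
  enumerable-Vec _ ℕ.zero = 1 , (λ _ → []) , λ { [] → zero , refl }
  enumerable-Vec A@(n , e , onto) (ℕ.suc k) with enumerable-Vec A k
  ... | m , es , ontos = n ℕ.* m , at , onto′
    where
    at : Fin (n ℕ.* m) → Vec _ (ℕ.suc k)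
    at i = e (proj₁ (remQuot {n} m i)) ∷ es (proj₂ (remQuot {n} m i))
    onto′ : ∀ v → ∃[ i ] (at i ≡ v)
    onto′ (x ∷ v) with onto x | ontos v
    ... | i , refl | j , refl = combine i j , cong (λ (a , b) → e a ∷ es b) (remQuot-combine {n} {m} i j)

  -- Filling up with copies of `d` gives closed sets of different sizes the same index type, so that
  -- they share one finite type of action tables.
  pad : ∀ {a} {A : Set a} (xs : List A) (n : ℕ) → length xs ℕ.≤ n → A → Fin n → A
  pad []       n         _       d _       = d
  pad (x ∷ xs) (ℕ.suc n) (s≤s l) d zero    = x
  pad (x ∷ xs) (ℕ.suc n) (s≤s l) d (suc i) = pad xs n l d i

  pad-∈ : ∀ {a} {A : Set a} (xs : List A) n l {d : A} {P : A → Set a} →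
          (∀ {x} → x ∈ xs → P x) → P d → ∀ i → P (pad xs n l d i)
  pad-∈ []       n         l       h Pd i       = Pd
  pad-∈ (x ∷ xs) (ℕ.suc n) (s≤s l) h Pd zero    = h (here refl)
  pad-∈ (x ∷ xs) (ℕ.suc n) (s≤s l) {P = P} h Pd (suc i) = pad-∈ xs n l {P = P} (h ∘ there) Pd i

  pad-onto : ∀ {a} {A : Set a} (xs : List A) n l {d x : A} → x ∈ xs → ∃[ i ] (pad xs n l d i ≡ x)
  pad-onto (x ∷ xs) (ℕ.suc n) (s≤s l) (here refl) = zero , refl
  pad-onto (x ∷ xs) (ℕ.suc n) (s≤s l) (there p)   = let i , e = pad-onto xs n l p in suc i , e

  record Involutions (ℓ : Level) : Set (lsuc ℓ) where
    field
      Gen        : Set ℓ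
      Ω          : Set ℓ
      act        : Gen → Ω → Ω
      involutive : ∀ g ω → act g (act g ω) ≡ ω

    run : List Gen → Ω → Ω
    run []      ω = ω
    run (g ∷ w) ω = act g (run w ω)

    run-++ : ∀ v w ω → run (v ++ w) ω ≡ run v (run w ω)
    run-++ []      w ω = refl
    run-++ (g ∷ v) w ω = cong (act g) (run-++ v w ω)

    run-reverse : ∀ w ω → run (reverse w) (run w ω) ≡ ω
    run-reverse []      ω = refl
    run-reverse (g ∷ w) ω = trans (cong (λ v → run v (act g (run w ω))) (unfold-reverse g w))
      (trans (run-++ (reverse w) [ g ] (act g (run w ω)))
        (trans (cong (run (reverse w)) (involutive g (run w ω))) (run-reverse w ω)))

    run-reverse′ : ∀ w ω → run w (run (reverse w) ω) ≡ ω
    run-reverse′ []      ω = refl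
    run-reverse′ (g ∷ w) ω = trans (cong (λ v → act g (run w (run v ω))) (unfold-reverse g w))
      (trans (cong (act g ∘ run w) (run-++ (reverse w) [ g ] ω))
        (trans (cong (act g) (run-reverse′ w (act g ω))) (involutive g ω)))

    infix 4 _≗ᵣ_
    _≗ᵣ_ : List Gen → List Gen → Set ℓ
    v ≗ᵣ w = ∀ ω → run v ω ≡ run w ω

    reverse-cong : ∀ {v w} → v ≗ᵣ w → reverse v ≗ᵣ reverse w
    reverse-cong {v} {w} h ω = trans (cong (run (reverse v)) (sym (run-reverse′ w ω)))
      (trans (cong (run (reverse v)) (sym (h (run (reverse w) ω)))) (run-reverse v (run (reverse w) ω)))

    -- Words are identified when they act alike. As every generator is an involution, reversal
    -- inverts a word and no formal inverses are required.
    group : Group ℓ ℓ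
    group = record
      { Carrier = List Gen
      ; _≈_     = _≗ᵣ_
      ; _∙_     = _++_
      ; ε       = []
      ; _⁻¹     = reverse
      ; isGroup = record
        { isMonoid = record
          { isSemigroup = record
            { isMagma = record
              { isEquivalence = record
                { refl  = λ _ → refl
                ; sym   = λ h ω → sym (h ω)
                ; trans = λ h k ω → trans (h ω) (k ω)
                }
              ; ∙-cong = λ {v} {v′} {w} {w′} h k ω → trans (run-++ v w ω)
                  (trans (cong (run v) (k ω)) (trans (h (run w′ ω)) (sym (run-++ v′ w′ ω))))
              }
            ; assoc = λ u v w ω → cong (λ z → run z ω) (++-assoc u v w)
            }
          ; identity = (λ _ _ → refl) , λ w ω → cong (λ z → run z ω) (++-identityʳ w)
          }
        ; inverse = (λ w ω → trans (run-++ (reverse w) w ω) (run-reverse w ω)) ,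
                    (λ w ω → trans (run-++ w (reverse w) ω) (run-reverse′ w ω))
        ; ⁻¹-cong = λ {v} {w} → reverse-cong {v} {w}
        }
      }

    Over : List Gen → List Gen → Set ℓ
    Over gs w = All (_∈ gs) w

    over-reverse : ∀ {gs} w → Over gs w → Over gs (reverse w)
    over-reverse []      []       = []
    over-reverse (g ∷ w) (h ∷ hs) = subst (Over _) (sym (unfold-reverse g w))
      (Allₚ.++⁺ (over-reverse w hs) (h ∷ []))

    FinitelyManyWords : List Gen → Set ℓ
    FinitelyManyWords gs = Σ[ ws ∈ List (List Gen) ] ((∀ {w} → w ∈ ws → Over gs w) ×
      (∀ {v} → Over gs v → ∃[ w ] (w ∈ ws × v ≗ᵣ w)))

    -- One `N` serves all points. Finite closed sets without a common bound would not make the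
    -- generated group finite.
    BoundedOrbits : List Gen → Set ℓ
    BoundedOrbits gs = Σ[ N ∈ ℕ ] (∀ ω → Σ[ xs ∈ List Ω ] (length xs ℕ.≤ N × ω ∈ xs ×
      (∀ {g x} → g ∈ gs → x ∈ xs → act g x ∈ xs)))

    bounded-⊆ : ∀ {gs hs} → (∀ {g} → g ∈ gs → g ∈ hs) → BoundedOrbits hs → BoundedOrbits gs
    bounded-⊆ sub (N , h) = N , λ ω → let xs , l , ω∈ , cl = h ω in xs , l , ω∈ , cl ∘ sub

    module _ (em : ∀ {a} → ExcludedMiddle a) where

      -- The action on an orbit of length at most N is given by a table, so a word
      -- is determined by its values for the finitely many tables.
      module Tables (gs : List Gen) (N : ℕ)
                    (orbits : ∀ ω → Σ[ xs ∈ List Ω ] (length xs ℕ.≤ N × ω ∈ xs ×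
                       (∀ {g x} → g ∈ gs → x ∈ xs → act g x ∈ xs))) where

        Index : Set
        Index = Fin (length gs)

        Table : Set
        Table = Vec (Vec (Fin N) N) (length gs)

        step : Table → Index → Fin N → Fin N
        step t j i = Vec.lookup (Vec.lookup t j) i

        eval : Table → List Index → Fin N → Fin N
        eval t []      i = i
        eval t (j ∷ w) i = step t j (eval t w i)

        word : List Index → List Gen
        word = map (lookup gs)

        tables : Enumerable Table
        tables = enumerable-Vec (enumerable-Vec (enumerable-Fin N) N) (length gs)

        Behaviour : Set
        Behaviour = Vec (Vec (Fin N) N) (proj₁ tables)

        behaviour : List Index → Behaviour
        behaviour w = Vec.tabulate λ p → Vec.tabulate (eval (proj₁ (proj₂ tables) p) w)

        eval-≡ : ∀ {v w} → behaviour v ≡ behaviour w → ∀ t i → eval t v i ≡ eval t w i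
        eval-≡ {v} {w} e t i with proj₂ (proj₂ tables) t
        ... | p , refl = trans (sym (at v)) (trans (cong (λ b → Vec.lookup (Vec.lookup b p) i) e) (at w))
          where
          at : ∀ u → Vec.lookup (Vec.lookup (behaviour u) p) i ≡ eval (proj₁ (proj₂ tables) p) u i
          at u = trans (cong (λ r → Vec.lookup r i)
                         (Vecₚ.lookup∘tabulate (λ p → Vec.tabulate (eval (proj₁ (proj₂ tables) p) u)) p))
                       (Vecₚ.lookup∘tabulate (eval (proj₁ (proj₂ tables) p) u) i)

        module _ (ω : Ω) where
          private
            xs = proj₁ (orbits ω)
            len = proj₁ (proj₂ (orbits ω))
            ω∈xs = proj₁ (proj₂ (proj₂ (orbits ω)))
            closed = proj₂ (proj₂ (proj₂ (orbits ω)))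

          point : Fin N → Ω
          point = pad xs N len ω

          point-step : ∀ j i → ∃[ i′ ] (point i′ ≡ act (lookup gs j) (point i))
          point-step j i = pad-onto xs N len (closed (∈-lookup {xs = gs} j) (pad-∈ xs N len {P = _∈ xs} id ω∈xs i))

          table : Table
          table = Vec.tabulate λ j → Vec.tabulate λ i → proj₁ (point-step j i)

          step-table : ∀ j i → point (step table j i) ≡ act (lookup gs j) (point i)
          step-table j i = trans (cong point (trans
              (cong (λ r → Vec.lookup r i) (Vecₚ.lookup∘tabulate (λ j → Vec.tabulate λ i → proj₁ (point-step j i)) j))
              (Vecₚ.lookup∘tabulate (λ i → proj₁ (point-step j i)) i)))
            (proj₂ (point-step j i))

          run-point : ∀ w i → run (word w) (point i) ≡ point (eval table w i)
          run-point []      i = refl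
          run-point (j ∷ w) i = trans (cong (act (lookup gs j)) (run-point w i)) (sym (step-table j (eval table w i)))

          same-behaviour : ∀ v w → behaviour v ≡ behaviour w → run (word v) ω ≡ run (word w) ω
          same-behaviour v w e with pad-onto xs N len {d = ω} ω∈xs
          ... | i , i≡ = trans (cong (run (word v)) (sym i≡)) (trans (run-point v i)
                (trans (cong point (eval-≡ {v} {w} e table i)) (trans (sym (run-point w i)) (cong (run (word w)) i≡))))

        behaviours : Enumerable Behaviour
        behaviours = enumerable-Vec (enumerable-Vec (enumerable-Fin N) N) (proj₁ tables)

        choose : Behaviour → List Index
        choose b with em {P = ∃[ w ] (behaviour w ≡ b)}
        ... | yes (w , _) = w
        ... | no _        = []

        choose-behaviour : ∀ w → behaviour (choose (behaviour w)) ≡ behaviour w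
        choose-behaviour w with em {P = ∃[ v ] (behaviour v ≡ behaviour w)}
        ... | yes (_ , e) = e
        ... | no none     = ⊥-elim (none (w , refl))

        over-word : ∀ w → Over gs (word w)
        over-word []      = []
        over-word (j ∷ w) = ∈-lookup {xs = gs} j ∷ over-word w

        index-word : ∀ {v} → Over gs v → ∃[ w ] (word w ≡ v)
        index-word []       = [] , refl
        index-word (h ∷ hs) = let w , e = index-word hs in
          Any.index h ∷ w , cong₂ _∷_ (sym (Anyₚ.lookup-index h)) e

        words : List (List Gen)
        words = tabulate (λ p → word (choose (proj₁ (proj₂ behaviours) p)))

        finitely-many-words : FinitelyManyWords gs
        finitely-many-words = words , over , λ {v} h → find h
          where
          over : ∀ {w} → w ∈ words → Over gs w
          over w∈ with ∈-tabulate⁻ w∈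
          ... | p , refl = over-word (choose (proj₁ (proj₂ behaviours) p))
          find : ∀ {v} → Over gs v → ∃[ w ] (w ∈ words × v ≗ᵣ w)
          find h with index-word h
          ... | v , refl with proj₂ (proj₂ behaviours) (behaviour v)
          ...   | p , e = _ , ∈-tabulate⁺ p , λ ω → same-behaviour ω v (choose (proj₁ (proj₂ behaviours) p))
                  (sym (trans (cong (behaviour ∘ choose) e) (choose-behaviour v)))

      opaque
        bounded⇒finite : ∀ gs → BoundedOrbits gs → FinitelyManyWords gs
        bounded⇒finite gs (N , orbits) = Tables.finitely-many-words gs N orbits

      -- A subgroup generated by words lies in the group of words over their letters. Each of the
      -- finitely many words representing that group contributes at most one element of the subgroup
      -- up to equality.
      locallyFinite : (∀ gs → FinitelyManyWords gs) → LocallyFinite group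
      locallyFinite fin U (xs , isSub , inU , U-least) =
        covered⇒finite ⟦ U ⟧ (concat (map members ws)) λ (x , Ux) → found x Ux
        where
        open Comparison em
        gs = concat xs
        ws = proj₁ (fin gs)
        Spanned : Subset (Group.setoid group) ℓ
        Spanned = record
          { member  = λ x → ∃[ w ] (Over gs w × x ≗ᵣ w)
          ; respect = λ h (w , o , k) → w , o , λ ω → trans (sym (h ω)) (k ω)
          }
        spanned-subgroup : IsSubgroup group Spanned
        spanned-subgroup = record
          { ε-closed  = [] , [] , λ _ → refl
          ; ∙-closed  = λ {x} {y} (v , o , h) (w , o′ , h′) → v ++ w , Allₚ.++⁺ o o′ ,
                          Group.∙-cong group {x} {v} {y} {w} h h′
          ; ⁻¹-closed = λ {x} (w , o , h) → reverse w , over-reverse w o , reverse-cong {x} {w} h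
          }
        spanned : ∀ ys → (∀ {y} → y ∈ ys → y ∈ xs) → All (member Spanned) ys
        spanned []       _   = []
        spanned (y ∷ ys) sub = (y , All.tabulate (λ g∈ → ∈-concat⁺′ g∈ (sub (here refl))) , λ _ → refl) ∷
                               spanned ys (sub ∘ there)
        members : List Gen → List (∃ (member U))
        members w with em {P = ∃[ x ] (member U x × x ≗ᵣ w)}
        ... | yes (x , Ux , _) = (x , Ux) ∷ []
        ... | no _             = []
        members-∋ : ∀ {x w} → member U x → x ≗ᵣ w → Any (λ (y , _) → x ≗ᵣ y) (members w)
        members-∋ {x} {w} Ux h with em {P = ∃[ x ] (member U x × x ≗ᵣ w)}
        ... | yes (y , _ , k) = here λ ω → trans (h ω) (sym (k ω))
        ... | no none         = ⊥-elim (none (x , Ux , h))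
        found : ∀ x → member U x → Any (λ (y , _) → x ≗ᵣ y) (concat (map members ws))
        found x Ux with U-least Spanned spanned-subgroup (spanned xs id) Ux
        ... | v , o , h with proj₂ (proj₂ (fin gs)) o
        ...   | w , w∈ , k = Anyₚ.concat⁺ (Anyₚ.map⁺ (Any.map (λ { refl → members-∋ Ux λ ω → trans (h ω) (k ω) }) w∈))

-- Elements of a locally finite group as products of two involutive permutations.

module Reflections where

  open import Algebra.Bundles using (Group)
  import Algebra.Properties.Group as GroupProperties
  open import Axiom.ExcludedMiddle using (ExcludedMiddle)
  open import Data.Bool.Base using (Bool; true; false)
  open import Data.List.Base using (List; []; _∷_; map; length; tabulate)
  open import Data.List.Properties using (length-map)
  open import Data.List.Membership.Propositional using (_∈_)
  open import Data.List.Membership.Propositional.Properties using (∈-map⁺; ∈-map⁻; ∈-tabulate⁺; ∈-tabulate⁻)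
  open import Data.List.Relation.Unary.All as All using (All; []; _∷_)
  open import Data.List.Relation.Unary.Any using (here; there)
  import Data.Nat.Properties as ℕₚ
  open import Data.Product using (Σ-syntax; ∃-syntax; _×_; _,_; proj₁; proj₂)
  open import Function.Base using (_∘_; id)
  open import Function.Bundles using (Bijection)
  open import Level using (Level)
  open import Relation.Binary.Bundles using (Setoid)
  open import Relation.Binary.PropositionalEquality using (_≡_; refl; sym; trans; cong; cong₂; subst; isEquivalence; module ≡-Reasoning)
  open import Defs
  open WellOrders
  open Sizes
  open Cardinals
  open InvolutionGroups

  module Reflection (em : ∀ {a} → ExcludedMiddle a) (ac : AxiomOfChoice)
                    {ℓ : Level} (G : Group ℓ ℓ) (G-locallyFinite : LocallyFinite G) where
    open LEM em
    open Canonical em ac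

    private
      module G = Group G

    C : Set ℓ
    C = Canon G.setoid

    private
      out≈ : ∀ x → out (class {S = G.setoid} x) G.≈ x
      out≈ = out-class {S = G.setoid}

      opaque
        mul : C → C → C
        mul x y = class (out x G.∙ out y)

        unit : C
        unit = class G.ε

        invert : C → C
        invert x = class (out x G.⁻¹)

        out-mul : ∀ x y → out (mul x y) G.≈ out x G.∙ out y
        out-mul x y = out≈ _

        out-unit : out unit G.≈ G.ε
        out-unit = out≈ _

        out-invert : ∀ x → out (invert x) G.≈ out x G.⁻¹
        out-invert x = out≈ _

      by-out : ∀ {x y : C} → out x G.≈ out y → x ≡ y
      by-out = out-injective {S = G.setoid}

    strict : Group ℓ ℓ
    strict = record
      { Carrier = C
      ; _≈_     = _≡_
      ; _∙_     = mul
      ; ε       = unit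
      ; _⁻¹     = invert
      ; isGroup = record
        { isMonoid = record
          { isSemigroup = record
            { isMagma = record { isEquivalence = isEquivalence ; ∙-cong = cong₂ mul }
            ; assoc   = λ x y z → by-out (G.trans (out-mul _ z) (G.trans (G.∙-congʳ (out-mul x y))
                          (G.trans (G.assoc _ _ _) (G.trans (G.∙-congˡ (G.sym (out-mul y z))) (G.sym (out-mul x _))))))
            }
          ; identity = (λ x → by-out (G.trans (out-mul _ x) (G.trans (G.∙-congʳ out-unit) (G.identityˡ _)))) ,
                       (λ x → by-out (G.trans (out-mul x _) (G.trans (G.∙-congˡ out-unit) (G.identityʳ _))))
          }
        ; inverse = (λ x → by-out (G.trans (out-mul _ x) (G.trans (G.∙-congʳ (out-invert x))
                             (G.trans (G.inverseˡ _) (G.sym out-unit))))) ,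
                    (λ x → by-out (G.trans (out-mul x _) (G.trans (G.∙-congˡ (out-invert x))
                             (G.trans (G.inverseʳ _) (G.sym out-unit)))))
        ; ⁻¹-cong = cong invert
        }
      }

    class-∙ : ∀ g h → class (g G.∙ h) ≡ mul (class g) (class h)
    class-∙ g h = by-out (G.trans (out≈ _) (G.sym (G.trans (out-mul _ _) (G.∙-cong (out≈ _) (out≈ _)))))

    class-ε : class G.ε ≡ unit
    class-ε = by-out (G.trans (out≈ _) (G.sym out-unit))

    open Group strict using (_∙_; ε; _⁻¹; assoc; identityˡ; identityʳ; inverseˡ; inverseʳ)
    open GroupProperties strict using (⁻¹-anti-homo-∙; ⁻¹-involutive; ε⁻¹≈ε)

    data Span (P : C → Set ℓ) : C → Set ℓ where
      one  : Span P ε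
      gen  : ∀ {g h} → P g → Span P h → Span P (g ∙ h)
      inv  : ∀ {g h} → P g → Span P h → Span P (g ⁻¹ ∙ h)

    module _ {P : C → Set ℓ} where

      span-∙ : ∀ {x y} → Span P x → Span P y → Span P (x ∙ y)
      span-∙ {y = y} one sy = subst (Span P) (sym (identityˡ y)) sy
      span-∙ (gen p sx) sy   = subst (Span P) (sym (assoc _ _ _)) (gen p (span-∙ sx sy))
      span-∙ (inv p sx) sy   = subst (Span P) (sym (assoc _ _ _)) (inv p (span-∙ sx sy))

      span-gen : ∀ {g} → P g → Span P g
      span-gen {g} p = subst (Span P) (identityʳ g) (gen p one)

      span-⁻¹ : ∀ {x} → Span P x → Span P (x ⁻¹)
      span-⁻¹ one       = subst (Span P) (sym ε⁻¹≈ε) one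
      span-⁻¹ (gen p sx) = subst (Span P) (sym (⁻¹-anti-homo-∙ _ _))
        (span-∙ (span-⁻¹ sx) (subst (Span P) (identityʳ _) (inv p one)))
      span-⁻¹ (inv {g} p sx) = subst (Span P) (sym (⁻¹-anti-homo-∙ _ _))
        (span-∙ (span-⁻¹ sx) (subst (Span P) (sym (⁻¹-involutive g)) (span-gen p)))

      span-⊆ : ∀ {Q : C → Set ℓ} → (∀ {g} → P g → Q g) → ∀ {x} → Span P x → Span Q x
      span-⊆ f one      = one
      span-⊆ f (gen p s) = gen (f p) (span-⊆ f s)
      span-⊆ f (inv p s) = inv (f p) (span-⊆ f s)

    -- Local finiteness puts the generated subgroup in bijection with some `Fin n`, and the inverse
    -- of the bijection lists it.
    span-finite : ∀ gs → Σ[ xs ∈ List C ]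
                  ((∀ {x} → x ∈ xs → Span (_∈ gs) x) × (∀ {x} → Span (_∈ gs) x → x ∈ xs))
    span-finite gs = tabulate at , only , λ {x} s →
      subst (_∈ tabulate at) (at-index s) (∈-tabulate⁺ (Bijection.to bij (out x , sub s)))
      where
      U : Subset G.setoid ℓ
      U = record { member = Span (_∈ gs) ∘ class ; respect = λ e → subst (Span (_∈ gs)) (class-cong e) }
      sub : ∀ {x} → Span (_∈ gs) x → Span (_∈ gs) (class (out x))
      sub {x} = subst (Span (_∈ gs)) (sym (class-out x))
      U-subgroup : IsSubgroup G U
      U-subgroup = record
        { ε-closed  = subst (Span (_∈ gs)) (by-out (G.trans out-unit (G.sym (out≈ _)))) one
        ; ∙-closed  = λ s t → subst (Span (_∈ gs)) (by-out (G.trans (out-mul _ _)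
                        (G.trans (G.∙-cong (out≈ _) (out≈ _)) (G.sym (out≈ _))))) (span-∙ s t)
        ; ⁻¹-closed = λ s → subst (Span (_∈ gs)) (by-out (G.trans (out-invert _)
                        (G.trans (G.⁻¹-cong (out≈ _)) (G.sym (out≈ _))))) (span-⁻¹ s)
        }
      contains : ∀ hs → (∀ {h} → h ∈ hs → h ∈ gs) → All (member U) (map out hs)
      contains []       _ = []
      contains (h ∷ hs) f = sub (span-gen (f (here refl))) ∷ contains hs (f ∘ there)
      minimal : ∀ (V : Subset G.setoid ℓ) → IsSubgroup G V → All (member V) (map out gs) →
                ∀ {x} → Span (_∈ gs) x → member V (out x)
      minimal V isSub all = go
        where
        open IsSubgroup isSub
        inV : ∀ {g} → g ∈ gs → member V (out g)
        inV g∈ = All.lookup all (∈-map⁺ out g∈)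
        go : ∀ {x} → Span (_∈ gs) x → member V (out x)
        go one       = respect V (G.sym out-unit) ε-closed
        go (gen p s) = respect V (G.sym (out-mul _ _)) (∙-closed (inV p) (go s))
        go (inv p s) = respect V (G.sym (out-mul _ _)) (∙-closed
          (respect V (G.sym (out-invert _)) (⁻¹-closed (inV p))) (go s))
      finite : Finite ⟦ U ⟧
      finite = G-locallyFinite U (map out gs , U-subgroup , contains gs id ,
        λ V isSub all s → respect V (out≈ _) (minimal V isSub all s))
      bij = proj₂ finite
      at = λ i → class (proj₁ (Bijection.to⁻ bij i))
      only : ∀ {x} → x ∈ tabulate at → Span (_∈ gs) x
      only x∈ with ∈-tabulate⁻ x∈
      ... | i , refl = proj₂ (Bijection.to⁻ bij i)
      at-index : ∀ {x} (s : Span (_∈ gs) x) → at (Bijection.to bij (out x , sub s)) ≡ x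
      at-index {x} s = trans (class-cong (Bijection.injective bij
        {Bijection.to⁻ bij (Bijection.to bij (out x , sub s))} {out x , sub s}
        (proj₂ (Bijection.surjective bij (Bijection.to bij (out x , sub s))) (Setoid.refl ⟦ U ⟧ {x = Bijection.to⁻ bij (Bijection.to bij (out x , sub s))})))) (class-out x)

    module _ (g : C) where

      Cyclic : C → Set ℓ
      Cyclic = Span (_≡ g)

      commutes : ∀ {h} → Cyclic h → h ∙ g ≡ g ∙ h
      commutes one = trans (identityˡ g) (sym (identityʳ g))
      commutes (gen {h = h} refl s) = trans (assoc g h g) (cong (g ∙_) (commutes s))
      commutes (inv {h = h} refl s) = begin
        (g ⁻¹ ∙ h) ∙ g    ≡⟨ assoc _ _ _ ⟩
        g ⁻¹ ∙ (h ∙ g)    ≡⟨ cong (g ⁻¹ ∙_) (commutes s) ⟩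
        g ⁻¹ ∙ (g ∙ h)    ≡⟨ assoc _ _ _ ⟨
        (g ⁻¹ ∙ g) ∙ h    ≡⟨ cong (_∙ h) (trans (inverseˡ g) (sym (inverseʳ g))) ⟩
        (g ∙ g ⁻¹) ∙ h    ≡⟨ assoc _ _ _ ⟩
        g ∙ (g ⁻¹ ∙ h)    ∎
        where open ≡-Reasoning

      private
        cancel : ∀ x y → (x ∙ y ⁻¹) ∙ y ≡ x
        cancel x y = trans (assoc x (y ⁻¹) y) (trans (cong (x ∙_) (inverseˡ y)) (identityʳ x))

        cancel′ : ∀ x y → (x ∙ y) ∙ y ⁻¹ ≡ x
        cancel′ x y = trans (assoc x y (y ⁻¹)) (trans (cong (x ∙_) (inverseʳ y)) (identityʳ x))

      Cosets : Setoid ℓ ℓ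
      Cosets = record
        { Carrier       = C
        ; _≈_           = λ x y → Cyclic (x ∙ y ⁻¹)
        ; isEquivalence = record
          { refl  = λ {x} → subst Cyclic (sym (inverseʳ x)) one
          ; sym   = λ {x} {y} s → subst Cyclic (trans (⁻¹-anti-homo-∙ x (y ⁻¹)) (cong (_∙ x ⁻¹) (⁻¹-involutive y))) (span-⁻¹ s)
          ; trans = λ {x} {y} {z} s t → subst Cyclic
              (trans (sym (assoc (x ∙ y ⁻¹) y (z ⁻¹))) (cong (_∙ z ⁻¹) (cancel x y))) (span-∙ s t)
          }
        }

      -- A chosen representative of the coset ⟨g⟩ x. Then x is `offset x` times `centre x`, and the
      -- reflections act on the offset.
      centre : C → C
      centre = representative Cosets

      offset : C → C
      offset x = x ∙ centre x ⁻¹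

      offset-cyclic : ∀ x → Cyclic (offset x)
      offset-cyclic = representative-≈ Cosets

      offset-centre : ∀ x → offset x ∙ centre x ≡ x
      offset-centre x = cancel x (centre x)

      centre-∙ : ∀ {h} x → Cyclic h → centre (h ∙ centre x) ≡ centre x
      centre-∙ {h} x s = sym (representative-cong Cosets (Setoid.trans Cosets {x} {centre x} {h ∙ centre x} (offset-cyclic x)
        (Setoid.sym Cosets {h ∙ centre x} {centre x} (subst Cyclic (sym (cancel′ h (centre x))) s))))

      offset-∙ : ∀ {h} x → Cyclic h → offset (h ∙ centre x) ≡ h
      offset-∙ {h} x s = trans (cong (λ c → (h ∙ centre x) ∙ c ⁻¹) (centre-∙ x s)) (cancel′ h (centre x))

      -- Multiplication by g is the composite of these two reflections of each coset ⟨g⟩ c,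
      -- which send h c to h⁻¹ c and to g h⁻¹ c.
      turn : Bool → C → C
      turn false h = h ⁻¹
      turn true  h = g ∙ h ⁻¹

      turn-cyclic : ∀ b {h} → Cyclic h → Cyclic (turn b h)
      turn-cyclic false s = span-⁻¹ s
      turn-cyclic true  s = gen refl (span-⁻¹ s)

      turn-involutive : ∀ b {h} → Cyclic h → turn b (turn b h) ≡ h
      turn-involutive false {h} s = ⁻¹-involutive h
      turn-involutive true {h} s = begin
        g ∙ (g ∙ h ⁻¹) ⁻¹      ≡⟨ cong (g ∙_) (⁻¹-anti-homo-∙ g (h ⁻¹)) ⟩
        g ∙ (h ⁻¹ ⁻¹ ∙ g ⁻¹)   ≡⟨ cong (λ k → g ∙ (k ∙ g ⁻¹)) (⁻¹-involutive h) ⟩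
        g ∙ (h ∙ g ⁻¹)         ≡⟨ assoc g h (g ⁻¹) ⟨
        (g ∙ h) ∙ g ⁻¹         ≡⟨ cong (_∙ g ⁻¹) (commutes s) ⟨
        (h ∙ g) ∙ g ⁻¹         ≡⟨ cancel′ h g ⟩
        h                      ∎
        where open ≡-Reasoning

      reflect : Bool → C → C
      reflect b x = turn b (offset x) ∙ centre x

      reflect-reflect : ∀ b b′ x → reflect b′ (reflect b x) ≡ turn b′ (turn b (offset x)) ∙ centre x
      reflect-reflect b b′ x = cong₂ (λ h c → turn b′ h ∙ c) (offset-∙ x s) (centre-∙ x s)
        where s = turn-cyclic b (offset-cyclic x)

      reflect-involutive : ∀ b x → reflect b (reflect b x) ≡ x
      reflect-involutive b x = trans (reflect-reflect b b x)
        (trans (cong (_∙ centre x) (turn-involutive b (offset-cyclic x))) (offset-centre x))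

      reflect-product : ∀ x → reflect true (reflect false x) ≡ g ∙ x
      reflect-product x = begin
        reflect true (reflect false x)         ≡⟨ reflect-reflect false true x ⟩
        (g ∙ offset x ⁻¹ ⁻¹) ∙ centre x        ≡⟨ assoc _ _ _ ⟩
        g ∙ (offset x ⁻¹ ⁻¹ ∙ centre x)        ≡⟨ cong (λ h → g ∙ (h ∙ centre x)) (⁻¹-involutive _) ⟩
        g ∙ (offset x ∙ centre x)              ≡⟨ cong (g ∙_) (offset-centre x) ⟩
        g ∙ x                                  ∎
        where open ≡-Reasoning

      -- The factor varies with x but never leaves ⟨g⟩. Hence the orbit of x under several
      -- reflections stays in F x for the finite subgroup F that their elements generate.
      reflect-translates : ∀ b x → ∃[ h ] (Cyclic h × reflect b x ≡ h ∙ x)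
      reflect-translates b x = turn b (offset x) ∙ offset x ⁻¹ ,
        span-∙ (turn-cyclic b (offset-cyclic x)) (span-⁻¹ (offset-cyclic x)) , (begin
          turn b (offset x) ∙ centre x                          ≡⟨ cong (turn b (offset x) ∙_) centre≡ ⟩
          turn b (offset x) ∙ (offset x ⁻¹ ∙ x)                 ≡⟨ assoc _ _ _ ⟨
          (turn b (offset x) ∙ offset x ⁻¹) ∙ x                 ∎)
        where
        open ≡-Reasoning
        centre≡ : centre x ≡ offset x ⁻¹ ∙ x
        centre≡ = begin
          centre x                                ≡⟨ identityˡ _ ⟨
          ε ∙ centre x                            ≡⟨ cong (_∙ centre x) (inverseˡ (offset x)) ⟨
          (offset x ⁻¹ ∙ offset x) ∙ centre x     ≡⟨ assoc _ _ _ ⟩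
          offset x ⁻¹ ∙ (offset x ∙ centre x)     ≡⟨ cong (offset x ⁻¹ ∙_) (offset-centre x) ⟩
          offset x ⁻¹ ∙ x                         ∎

    reflections : Involutions ℓ
    reflections = record
      { Gen        = Bool × C
      ; Ω          = C
      ; act        = λ (b , g) → reflect g b
      ; involutive = λ (b , g) → reflect-involutive g b
      }

    reflections-bounded : ∀ gs → Involutions.BoundedOrbits reflections gs
    reflections-bounded gs = length F , λ x →
      map (_∙ x) F , ℕₚ.≤-reflexive (length-map (_∙ x) F) ,
      subst (_∈ map (_∙ x) F) (identityˡ x) (∈-map⁺ (_∙ x) (member-F one)) ,
      λ {g} → closed x {g}
      where
      F : List C
      F = proj₁ (span-finite (map proj₂ gs))
      spanned : ∀ {x} → x ∈ F → Span (_∈ map proj₂ gs) x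
      spanned = proj₁ (proj₂ (span-finite (map proj₂ gs)))
      member-F : ∀ {x} → Span (_∈ map proj₂ gs) x → x ∈ F
      member-F = proj₂ (proj₂ (span-finite (map proj₂ gs)))
      closed : ∀ x {g y} → g ∈ gs → y ∈ map (_∙ x) F → reflect (proj₂ g) (proj₁ g) y ∈ map (_∙ x) F
      closed x {b , g} g∈ y∈ with ∈-map⁻ (_∙ x) y∈
      ... | f , f∈ , refl with reflect-translates g b (f ∙ x)
      ...   | h , sh , e = subst (_∈ map (_∙ x) F) (trans (assoc h f x) (sym e))
              (∈-map⁺ (_∙ x) (member-F (span-∙ (span-⊆ (λ { refl → ∈-map⁺ proj₂ g∈ }) sh) (spanned f∈))))

-- Toggles between rows: the commutator formula and bounded orbits.

module Toggles where

  open import Axiom.ExcludedMiddle using (ExcludedMiddle)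
  open import Data.Bool.Base using (Bool; true; false; _xor_; _∧_)
  open import Data.Bool.Properties using (xor-same; xor-comm; xor-assoc; xor-identityʳ)
  open import Data.Bool.Solver using (module xor-∧-Solver)
  open import Data.Empty using (⊥-elim)
  open import Data.Fin.Base using (Fin)
  open import Data.List.Base using (List; []; _∷_; _++_; map; length; cartesianProductWith)
  open import Data.List.Properties using (length-map; length-++)
  open import Data.List.Membership.Propositional using (_∈_)
  open import Data.List.Membership.Propositional.Properties using (∈-map⁺; ∈-map⁻; ∈-++⁺ˡ; ∈-++⁺ʳ; ∈-++⁻; ∈-cartesianProductWith⁺; ∈-cartesianProductWith⁻)
  open import Data.List.Relation.Unary.Any using (here; there)
  open import Data.Nat.Base as ℕ using (ℕ)
  import Data.Nat.Properties as ℕₚ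
  open import Data.Product using (Σ-syntax; _×_; _,_; proj₁; proj₂)
  open import Data.Sum.Base using (_⊎_; inj₁; inj₂)
  open import Function.Base using (_∘_; id)
  open import Level using (Level)
  open import Relation.Binary.Bundles using (Setoid)
  open import Relation.Binary.Definitions using (tri<; tri≈; tri>)
  open import Relation.Binary.PropositionalEquality using (_≡_; refl; sym; trans; cong; cong₂; subst; module ≡-Reasoning)
  open import Relation.Nullary using (¬_; yes; no; does)
  open import Defs
  open WellOrders
  open Sizes
  open Cardinals
  open InvolutionGroups

  length-cartesianProductWith : ∀ {a b c} {A : Set a} {B : Set b} {C : Set c} (f : A → B → C) xs ys →
                                length (cartesianProductWith f xs ys) ≡ length xs ℕ.* length ys
  length-cartesianProductWith f []       ys = refl
  length-cartesianProductWith f (x ∷ xs) ys = trans (length-++ (map (f x) ys))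
    (cong₂ ℕ._+_ (length-map (f x) ys) (length-cartesianProductWith f xs ys))

  module Toggle (em : ∀ {a} → ExcludedMiddle a) (ac : AxiomOfChoice) {ℓ : Level}
                (T : WellOrder ℓ) (Λ : Set ℓ) {n : ℕ} (op : Fin n → Λ → Λ → Λ → Λ) where
    open LEM em
    open Canonical em ac
    private module T = WellOrder T

    -- The rows `mid p` are those indexed by θ, while `bot` and `top` are -∞ and +∞. A toggle with
    -- target `top` writes only into `end`, where its effect can be read.
    data Row : Set ℓ where
      bot : Row
      mid : T.Carrier → Row
      top : Row
      end : Row

    infix 4 _⊏_
    data _⊏_ : Row → Row → Set ℓ where
      bot-mid : ∀ {p} → bot ⊏ mid p
      bot-top : bot ⊏ top
      bot-end : bot ⊏ end
      mid-mid : ∀ {p q} → p T.< q → mid p ⊏ mid q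
      mid-top : ∀ {p} → mid p ⊏ top
      mid-end : ∀ {p} → mid p ⊏ end
      top-end : top ⊏ end

    ⊏-trans : ∀ {r s t} → r ⊏ s → s ⊏ t → r ⊏ t
    ⊏-trans bot-mid (mid-mid _) = bot-mid
    ⊏-trans bot-mid mid-top     = bot-top
    ⊏-trans bot-mid mid-end     = bot-end
    ⊏-trans bot-top top-end     = bot-end
    ⊏-trans (mid-mid p) (mid-mid q) = mid-mid (T.<-trans p q)
    ⊏-trans (mid-mid p) mid-top = mid-top
    ⊏-trans (mid-mid p) mid-end = mid-end
    ⊏-trans mid-top top-end     = mid-end

    ⊏-irrefl : ∀ {r} → ¬ (r ⊏ r)
    ⊏-irrefl (mid-mid l) = T.<-irrefl l

    infix 4 _⊑_
    _⊑_ : Row → Row → Set ℓ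
    r ⊑ s = ¬ (s ⊏ r)

    ⊏-or-⊑ : ∀ r s → (r ⊏ s) ⊎ (s ⊑ r)
    ⊏-or-⊑ r s with em {P = r ⊏ s}
    ... | yes l = inj₁ l
    ... | no ¬l = inj₂ ¬l

    ⊏⇒⊑ : ∀ {r s} → r ⊏ s → r ⊑ s
    ⊏⇒⊑ l g = ⊏-irrefl (⊏-trans l g)

    ⊑-⊏ : ∀ {r s t} → r ⊑ s → s ⊏ t → r ⊏ t
    ⊑-⊏ {bot} {bot} h l = l
    ⊑-⊏ {bot} {mid _} h l = ⊏-trans bot-mid l
    ⊑-⊏ {bot} {top} h l = ⊏-trans bot-top l
    ⊑-⊏ {mid p} {bot} h l = ⊥-elim (h bot-mid)
    ⊑-⊏ {mid p} {mid q} h l with T.cmp p q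
    ... | tri< p<q _ _  = ⊏-trans (mid-mid p<q) l
    ... | tri≈ _ refl _ = l
    ... | tri> _ _ q<p  = ⊥-elim (h (mid-mid q<p))
    ⊑-⊏ {mid p} {top} h l = ⊏-trans mid-top l
    ⊑-⊏ {top} {bot} h l = ⊥-elim (h bot-top)
    ⊑-⊏ {top} {mid _} h l = ⊥-elim (h mid-top)
    ⊑-⊏ {top} {top} h l = l
    ⊑-⊏ {end} {bot} h l = ⊥-elim (h bot-end)
    ⊑-⊏ {end} {mid _} h l = ⊥-elim (h mid-end)
    ⊑-⊏ {end} {top} h l = ⊥-elim (h top-end)

    ⊑-trans : ∀ {r s t} → r ⊑ s → s ⊑ t → r ⊑ t
    ⊑-trans h k t⊏r with ⊏-or-⊑ _ _
    ... | inj₁ l = h l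
    ... | inj₂ g = k (⊑-⊏′ g t⊏r)
      where
      ⊑-⊏′ : ∀ {r s t} → r ⊑ s → t ⊏ r → t ⊏ s
      ⊑-⊏′ {r} {s} {t} h l = byContra λ t⋢s → h (⊑-⊏ t⋢s l)

    W : Set ℓ
    W = List Λ

    pointwise : Setoid ℓ ℓ
    pointwise = record
      { Carrier       = Row → W → Bool
      ; _≈_           = λ f g → ∀ s w → f s w ≡ g s w
      ; isEquivalence = record
        { refl  = λ _ _ → refl
        ; sym   = λ h s w → sym (h s w)
        ; trans = λ h k s w → trans (h s w) (k s w)
        }
      }

    opaque
      D : Set ℓ
      D = Canon pointwise

      val : D → Row → W → Bool
      val = out

      table : (Row → W → Bool) → D
      table f = class {S = pointwise} f

      val-table : ∀ f s w → val (table f) s w ≡ f s w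
      val-table f = out-class {S = pointwise} f

      D-ext : ∀ {d e} → (∀ s w → val d s w ≡ val e s w) → d ≡ e
      D-ext = out-injective {S = pointwise}

    infixl 6 _⊕_
    opaque
      _⊕_ : D → D → D
      d ⊕ e = table λ s w → val d s w xor val e s w

      val-⊕ : ∀ d e s w → val (d ⊕ e) s w ≡ val d s w xor val e s w
      val-⊕ d e = val-table _

      𝟎 : D
      𝟎 = table λ _ _ → false

      val-𝟎 : ∀ s w → val 𝟎 s w ≡ false
      val-𝟎 = val-table _

    ⊕-assoc : ∀ d e f → (d ⊕ e) ⊕ f ≡ d ⊕ (e ⊕ f)
    ⊕-assoc d e f = D-ext λ s w → trans (val-⊕ _ _ s w) (trans (cong (_xor val f s w) (val-⊕ d e s w))
      (trans (xor-assoc (val d s w) _ _) (sym (trans (val-⊕ _ _ s w) (cong (val d s w xor_) (val-⊕ e f s w))))))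

    ⊕-comm : ∀ d e → d ⊕ e ≡ e ⊕ d
    ⊕-comm d e = D-ext λ s w → trans (val-⊕ d e s w) (trans (xor-comm (val d s w) _) (sym (val-⊕ e d s w)))

    ⊕-𝟎 : ∀ d → d ⊕ 𝟎 ≡ d
    ⊕-𝟎 d = D-ext λ s w → trans (val-⊕ d 𝟎 s w) (trans (cong (val d s w xor_) (val-𝟎 s w)) (xor-identityʳ _))

    ⊕-same : ∀ d → d ⊕ d ≡ 𝟎
    ⊕-same d = D-ext λ s w → trans (val-⊕ d d s w) (trans (xor-same (val d s w)) (sym (val-𝟎 s w)))

    ⊕-cancel : ∀ d e → d ⊕ (d ⊕ e) ≡ e
    ⊕-cancel d e = trans (sym (⊕-assoc d d e)) (trans (cong (_⊕ e) (⊕-same d)) (trans (⊕-comm 𝟎 e) (⊕-𝟎 e)))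

    ⊕-swap : ∀ d e f → d ⊕ (e ⊕ f) ≡ e ⊕ (d ⊕ f)
    ⊕-swap d e f = trans (sym (⊕-assoc d e f)) (trans (cong (_⊕ f) (⊕-comm d e)) (⊕-assoc e d f))

    gate : Row → Row → Bool
    gate r s = does (em {P = r ⊏ s})

    gate-yes : ∀ {r s} → r ⊏ s → gate r s ≡ true
    gate-yes {r} {s} l with em {P = r ⊏ s}
    ... | yes _ = refl
    ... | no ¬l = ⊥-elim (¬l l)

    gate-no : ∀ {r s} → s ⊑ r → gate r s ≡ false
    gate-no {r} {s} h with em {P = r ⊏ s}
    ... | yes l = ⊥-elim (h l)
    ... | no _  = refl

    opaque
      copy : (W → W) → Row → Row → D → D
      copy m q r d = table λ s w → gate r s ∧ val d q (m w)

      val-copy : ∀ m q r d s w → val (copy m q r d) s w ≡ gate r s ∧ val d q (m w)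
      val-copy m q r d = val-table _

    -- This is T(m; q, r): row `q`, read at the displaced stack `m w`, is added to every row above
    -- `r`.
    toggle : (W → W) → Row → Row → D → D
    toggle m q r d = d ⊕ copy m q r d

    val-toggle : ∀ m q r d s w → val (toggle m q r d) s w ≡ val d s w xor (gate r s ∧ val d q (m w))
    val-toggle m q r d s w = trans (val-⊕ _ _ s w) (cong (val d s w xor_) (val-copy m q r d s w))

    val-toggle-low : ∀ m q r d {s} w → s ⊑ r → val (toggle m q r d) s w ≡ val d s w
    val-toggle-low m q r d {s} w h = trans (val-toggle m q r d s w)
      (trans (cong (λ b → val d s w xor (b ∧ val d q (m w))) (gate-no h)) (xor-identityʳ _))

    toggle-cong : ∀ {m m′} → (∀ w → m w ≡ m′ w) → ∀ q r d → toggle m q r d ≡ toggle m′ q r d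
    toggle-cong {m} {m′} h q r d = D-ext λ s w → trans (val-toggle m q r d s w)
      (trans (cong (λ v → val d s w xor (gate r s ∧ val d q v)) (h w)) (sym (val-toggle m′ q r d s w)))

    -- Row `q` does not lie above `r`, so it is unchanged and the same amount is added twice.
    toggle-involutive : ∀ m {q r} → q ⊑ r → ∀ d → toggle m q r (toggle m q r d) ≡ d
    toggle-involutive m {q} {r} h d = D-ext λ s w → begin
      val (toggle m q r (toggle m q r d)) s w
        ≡⟨ val-toggle m q r _ s w ⟩
      val (toggle m q r d) s w xor (gate r s ∧ val (toggle m q r d) q (m w))
        ≡⟨ cong₂ (λ a b → a xor (gate r s ∧ b)) (val-toggle m q r d s w) (val-toggle-low m q r d (m w) h) ⟩
      (val d s w xor (gate r s ∧ val d q (m w))) xor (gate r s ∧ val d q (m w))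
        ≡⟨ xor-assoc (val d s w) _ _ ⟩
      val d s w xor ((gate r s ∧ val d q (m w)) xor (gate r s ∧ val d q (m w)))
        ≡⟨ cong (val d s w xor_) (xor-same (gate r s ∧ val d q (m w))) ⟩
      val d s w xor false
        ≡⟨ xor-identityʳ _ ⟩
      val d s w ∎
      where open ≡-Reasoning

    -- Since q₁ lies above r₂, the second toggle puts a copy of row q₂ into row q₁, and the first
    -- one forwards it to the rows above r₁. All other contributions occur twice and cancel.
    commutator : ∀ m₁ m₂ {q₁ r₁ q₂ r₂} → q₁ ⊑ r₁ → q₂ ⊑ r₂ → r₂ ⊏ q₁ → ∀ d →
      toggle m₁ q₁ r₁ (toggle m₂ q₂ r₂ (toggle m₁ q₁ r₁ (toggle m₂ q₂ r₂ d))) ≡ toggle (m₂ ∘ m₁) q₂ r₁ d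
    commutator m₁ m₂ {q₁} {r₁} {q₂} {r₂} h₁ h₂ l d = D-ext λ s w → begin
      val (t₁ c) s w
        ≡⟨ val-toggle m₁ q₁ r₁ c s w ⟩
      val c s w xor (gate r₁ s ∧ val c q₁ (m₁ w))
        ≡⟨ cong₂ (λ x y → x xor (gate r₁ s ∧ y)) (val-c s w) (c-q₁ (m₁ w)) ⟩
      (((val d s w xor (gate r₂ s ∧ val d q₂ (m₂ w))) xor (gate r₁ s ∧ (val d q₁ (m₁ w) xor val d q₂ (m₂ (m₁ w)))))
         xor (gate r₂ s ∧ val d q₂ (m₂ w))) xor (gate r₁ s ∧ val d q₁ (m₁ w))
        ≡⟨ solve 6 (λ x y u v A B → (((x :+ B :* y) :+ A :* (u :+ v)) :+ B :* y) :+ A :* u := x :+ A :* v) refl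
             (val d s w) (val d q₂ (m₂ w)) (val d q₁ (m₁ w)) (val d q₂ (m₂ (m₁ w))) (gate r₁ s) (gate r₂ s) ⟩
      val d s w xor (gate r₁ s ∧ val d q₂ (m₂ (m₁ w)))
        ≡⟨ val-toggle (m₂ ∘ m₁) q₂ r₁ d s w ⟨
      val (toggle (m₂ ∘ m₁) q₂ r₁ d) s w ∎
      where
      open ≡-Reasoning
      open xor-∧-Solver
      t₁ = toggle m₁ q₁ r₁
      t₂ = toggle m₂ q₂ r₂
      a = t₂ d
      b = t₁ a
      c = t₂ b
      q₂⊑r₁ : q₂ ⊑ r₁
      q₂⊑r₁ = ⊑-trans h₂ (⊑-trans (⊏⇒⊑ l) h₁)
      a-q₁ : ∀ w → val a q₁ w ≡ val d q₁ w xor val d q₂ (m₂ w)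
      a-q₁ w = trans (val-toggle m₂ q₂ r₂ d q₁ w)
        (cong (λ g → val d q₁ w xor (g ∧ val d q₂ (m₂ w))) (gate-yes l))
      b-q₂ : ∀ w → val b q₂ w ≡ val d q₂ w
      b-q₂ w = trans (val-toggle-low m₁ q₁ r₁ a w q₂⊑r₁) (val-toggle-low m₂ q₂ r₂ d w h₂)
      val-b : ∀ s w → val b s w ≡ (val d s w xor (gate r₂ s ∧ val d q₂ (m₂ w)))
                                   xor (gate r₁ s ∧ (val d q₁ (m₁ w) xor val d q₂ (m₂ (m₁ w))))
      val-b s w = trans (val-toggle m₁ q₁ r₁ a s w)
        (cong₂ (λ x y → x xor (gate r₁ s ∧ y)) (val-toggle m₂ q₂ r₂ d s w) (a-q₁ (m₁ w)))
      val-c : ∀ s w → val c s w ≡ ((val d s w xor (gate r₂ s ∧ val d q₂ (m₂ w)))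
                xor (gate r₁ s ∧ (val d q₁ (m₁ w) xor val d q₂ (m₂ (m₁ w)))))
                xor (gate r₂ s ∧ val d q₂ (m₂ w))
      val-c s w = trans (val-toggle m₂ q₂ r₂ b s w)
        (cong₂ (λ x y → x xor (gate r₂ s ∧ y)) (val-b s w) (b-q₂ (m₂ w)))
      c-q₁ : ∀ w → val c q₁ w ≡ val d q₁ w
      c-q₁ w = begin
        val c q₁ w
          ≡⟨ val-toggle m₂ q₂ r₂ b q₁ w ⟩
        val b q₁ w xor (gate r₂ q₁ ∧ val b q₂ (m₂ w))
          ≡⟨ cong₂ (λ g y → val b q₁ w xor (g ∧ y)) (gate-yes l) (b-q₂ (m₂ w)) ⟩
        val b q₁ w xor val d q₂ (m₂ w)
          ≡⟨ cong (_xor val d q₂ (m₂ w)) (trans (val-toggle-low m₁ q₁ r₁ a w h₁) (a-q₁ w)) ⟩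
        (val d q₁ w xor val d q₂ (m₂ w)) xor val d q₂ (m₂ w)
          ≡⟨ xor-assoc (val d q₁ w) _ _ ⟩
        val d q₁ w xor (val d q₂ (m₂ w) xor val d q₂ (m₂ w))
          ≡⟨ cong (val d q₁ w xor_) (xor-same (val d q₂ (m₂ w))) ⟩
        val d q₁ w xor false
          ≡⟨ xor-identityʳ _ ⟩
        val d q₁ w ∎

    data Move : Set ℓ where
      stay : Move
      push : Λ → Move
      eval : Fin n → Move

    -- On stacks, every term in the operations op is a composite of moves.
    move : Move → W → W
    move stay     w = w
    move (push x) w = x ∷ w
    move (eval k) (x ∷ y ∷ z ∷ w) = op k x y z ∷ w
    move (eval k) w = w

    toggles : Involutions ℓ
    toggles = record
      { Gen        = Row × Move
      ; Ω          = D
      ; act        = λ (q , m) → toggle (move m) q q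
      ; involutive = λ (q , m) → toggle-involutive (move m) ⊏-irrefl
      }

    open Involutions toggles using (act; run; Over; BoundedOrbits; bounded-⊆; FinitelyManyWords; bounded⇒finite)

    Vanishes : Row → D → Set ℓ
    Vanishes r d = ∀ s → s ⊑ r → ∀ w → val d s w ≡ false

    copy-vanishes : ∀ m q r d → Vanishes r (copy m q r d)
    copy-vanishes m q r d s h w = trans (val-copy m q r d s w) (cong (_∧ val d q (m w)) (gate-no h))

    ⊕-vanishes : ∀ {r d e} → Vanishes r d → Vanishes r e → Vanishes r (d ⊕ e)
    ⊕-vanishes hd he s h w = trans (val-⊕ _ _ s w) (cong₂ _xor_ (hd s h w) (he s h w))

    copy-⊕ : ∀ m {q r} d u → Vanishes q u → copy m q r (d ⊕ u) ≡ copy m q r d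
    copy-⊕ m {q} {r} d u hu = D-ext λ s w → trans (val-copy m q r (d ⊕ u) s w)
      (trans (cong (gate r s ∧_) (trans (val-⊕ d u q (m w))
        (trans (cong (val d q (m w) xor_) (hu q ⊏-irrefl (m w))) (xor-identityʳ _))))
        (sym (val-copy m q r d s w)))

    vanishes-⊑ : ∀ {r r′ d} → r′ ⊑ r → Vanishes r d → Vanishes r′ d
    vanishes-⊑ l h s s⊑r′ = h s (⊑-trans s⊑r′ l)

    toggle-⊕ : ∀ m {q r} d u → Vanishes q u → toggle m q r (d ⊕ u) ≡ toggle m q r d ⊕ u
    toggle-⊕ m {q} {r} d u hu = trans (cong ((d ⊕ u) ⊕_) (copy-⊕ m d u hu))
      (trans (⊕-assoc d u _) (trans (cong (d ⊕_) (⊕-comm u _)) (sym (⊕-assoc d _ u))))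

    -- The span of the values of `f` over the field with two elements, possibly with repetitions.
    sums : (D → D) → List D → List D
    sums f []       = 𝟎 ∷ []
    sums f (d ∷ ds) = sums f ds ++ map (f d ⊕_) (sums f ds)

    𝟎∈sums : ∀ f ds → 𝟎 ∈ sums f ds
    𝟎∈sums f []       = here refl
    𝟎∈sums f (d ∷ ds) = ∈-++⁺ˡ (𝟎∈sums f ds)

    sums-vanish : ∀ f ds {r} → (∀ d → Vanishes r (f d)) → ∀ {u} → u ∈ sums f ds → Vanishes r u
    sums-vanish f []       hf (here refl) s _ = val-𝟎 s
    sums-vanish f (d ∷ ds) hf u∈ with ∈-++⁻ (sums f ds) u∈
    ... | inj₁ u∈′ = sums-vanish f ds hf u∈′
    ... | inj₂ u∈′ with ∈-map⁻ (f d ⊕_) u∈′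
    ...   | v , v∈ , refl = ⊕-vanishes (hf d) (sums-vanish f ds hf v∈)

    sums-closed : ∀ f ds {d u} → d ∈ ds → u ∈ sums f ds → f d ⊕ u ∈ sums f ds
    sums-closed f (e ∷ ds) {d} d∈ u∈ with ∈-++⁻ (sums f ds) u∈
    sums-closed f (e ∷ ds) (here refl) u∈ | inj₁ u∈′ = ∈-++⁺ʳ (sums f ds) (∈-map⁺ (f e ⊕_) u∈′)
    sums-closed f (e ∷ ds) (there d∈)  u∈ | inj₁ u∈′ = ∈-++⁺ˡ (sums-closed f ds d∈ u∈′)
    sums-closed f (e ∷ ds) d∈ u∈ | inj₂ u∈′ with ∈-map⁻ (f e ⊕_) u∈′
    sums-closed f (e ∷ ds) (here refl) u∈ | inj₂ u∈′ | v , v∈ , refl =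
      ∈-++⁺ˡ (subst (_∈ sums f ds) (sym (⊕-cancel (f e) v)) v∈)
    sums-closed f (e ∷ ds) {d} (there d∈) u∈ | inj₂ u∈′ | v , v∈ , refl =
      ∈-++⁺ʳ (sums f ds) (subst (_∈ map (f e ⊕_) (sums f ds)) (⊕-swap (f e) (f d) v)
        (∈-map⁺ (f e ⊕_) (sums-closed f ds d∈ v∈)))

    length-sums : ∀ f ds → length (sums f ds) ≡ 2 ℕ.^ length ds
    length-sums f []       = refl
    length-sums f (d ∷ ds) = trans (length-++ (sums f ds)) (cong₂ ℕ._+_ (length-sums f ds)
      (trans (length-map (f d ⊕_) (sums f ds)) (trans (length-sums f ds) (sym (ℕₚ.+-identityʳ _)))))

    -- Only rows above q change under a generator at row q, and generators at rows ⊑ q do not read them.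
    bounded-step : ∀ q m gs → (∀ {g} → g ∈ gs → proj₁ g ⊑ q) → BoundedOrbits gs → BoundedOrbits ((q , m) ∷ gs)
    bounded-step q m gs low (N , orbits) = N ℕ.* 2 ℕ.^ N , λ d → orbit d (orbits d)
      where
      f = copy (move m) q q
      orbit : ∀ d → Σ[ xs ∈ List D ] (length xs ℕ.≤ N × d ∈ xs × (∀ {g x} → g ∈ gs → x ∈ xs → act g x ∈ xs)) →
              Σ[ xs ∈ List D ] (length xs ℕ.≤ N ℕ.* 2 ℕ.^ N × d ∈ xs ×
                (∀ {g x} → g ∈ (q , m) ∷ gs → x ∈ xs → act g x ∈ xs))
      orbit d (xs , len , d∈ , closed) = ys , len′ , subst (_∈ ys) (⊕-𝟎 d) (add d∈ (𝟎∈sums f xs)) , closed′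
        where
        -- The old generators move only the first summand and the new one changes only the second.
        ys = cartesianProductWith _⊕_ xs (sums f xs)
        add : ∀ {x u} → x ∈ xs → u ∈ sums f xs → x ⊕ u ∈ ys
        add = ∈-cartesianProductWith⁺ _⊕_
        len′ : length ys ℕ.≤ N ℕ.* 2 ℕ.^ N
        len′ = subst (ℕ._≤ _) (sym (trans (length-cartesianProductWith _⊕_ xs (sums f xs))
                  (cong (length xs ℕ.*_) (length-sums f xs))))
                 (ℕₚ.*-mono-≤ len (ℕₚ.^-monoʳ-≤ 2 len))
        closed′ : ∀ {g x} → g ∈ (q , m) ∷ gs → x ∈ ys → act g x ∈ ys
        closed′ g∈ y∈ with ∈-cartesianProductWith⁻ _⊕_ xs (sums f xs) y∈
        closed′ (here refl) y∈ | x , u , x∈ , u∈ , refl = subst (_∈ ys) (sym eq) (add x∈ (sums-closed f xs x∈ u∈))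
          where
          eq : act (q , m) (x ⊕ u) ≡ x ⊕ (f x ⊕ u)
          eq = trans (toggle-⊕ (move m) x u (sums-vanish f xs (copy-vanishes (move m) q q) u∈)) (⊕-assoc x (f x) u)
        closed′ {g} (there g∈) y∈ | x , u , x∈ , u∈ , refl = subst (_∈ ys) (sym (toggle-⊕ (move (proj₂ g)) x u
            (vanishes-⊑ {d = u} (low g∈) (sums-vanish f xs (copy-vanishes (move m) q q) u∈))))
          (add (closed g∈ x∈) u∈)

    -- Highest row first, so that `bounded-step` adds generators from the lowest row upwards.
    data Sorted : List (Row × Move) → Set ℓ where
      []  : Sorted []
      _∷_ : ∀ {q m gs} → (∀ {g} → g ∈ gs → proj₁ g ⊑ q) → Sorted gs → Sorted ((q , m) ∷ gs)

    sorted-bounded : ∀ {gs} → Sorted gs → BoundedOrbits gs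
    sorted-bounded []      = 1 , λ d → d ∷ [] , ℕₚ.≤-refl , here refl , λ ()
    sorted-bounded (h ∷ s) = bounded-step _ _ _ h (sorted-bounded s)

    insert : ∀ g {gs} → Sorted gs → Σ[ hs ∈ List (Row × Move) ] (Sorted hs ×
             (∀ {h} → h ∈ g ∷ gs → h ∈ hs) × (∀ {h} → h ∈ hs → h ∈ g ∷ gs))
    insert g [] = g ∷ [] , (λ ()) ∷ [] , id , id
    insert g@(q , m) {gs = (q′ , m′) ∷ gs} (h ∷ s) with ⊏-or-⊑ q q′
    ... | inj₂ q′⊑q = g ∷ (q′ , m′) ∷ gs ,
            (λ { (here refl) → q′⊑q ; (there k) → ⊑-trans (h k) q′⊑q }) ∷ (h ∷ s) , id , id
    ... | inj₁ q⊏q′ with insert g s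
    ...   | hs , sorted , to , from = (q′ , m′) ∷ hs , (λ k → bound (from k)) ∷ sorted , to′ , from′
      where
      bound : ∀ {k} → k ∈ g ∷ gs → proj₁ k ⊑ q′
      bound (here refl) = ⊏⇒⊑ q⊏q′
      bound (there k∈)  = h k∈
      to′ : ∀ {k} → k ∈ g ∷ (q′ , m′) ∷ gs → k ∈ (q′ , m′) ∷ hs
      to′ (here refl)         = there (to (here refl))
      to′ (there (here refl)) = here refl
      to′ (there (there k∈))  = there (to (there k∈))
      from′ : ∀ {k} → k ∈ (q′ , m′) ∷ hs → k ∈ g ∷ (q′ , m′) ∷ gs
      from′ (here refl) = there (here refl)
      from′ (there k∈) with from k∈
      ... | here refl = here refl
      ... | there k∈′ = there (there k∈′)

    sort : ∀ gs → Σ[ hs ∈ List (Row × Move) ] (Sorted hs × (∀ {h} → h ∈ gs → h ∈ hs))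
    sort []       = [] , [] , λ ()
    sort (g ∷ gs) with sort gs
    ... | hs , sorted , to with insert g sorted
    ...   | ks , sorted′ , to′ , _ = ks , sorted′ , λ { (here refl) → to′ (here refl) ; (there h) → to′ (there (to h)) }

    toggles-finite : ∀ gs → FinitelyManyWords gs
    toggles-finite gs = let hs , sorted , to = sort gs in
      bounded⇒finite em gs (bounded-⊆ to (sorted-bounded sorted))

-- Toggles in a σ-chain: from single rows to all elements of λ.

module ToggleChains where

  open import Axiom.ExcludedMiddle using (ExcludedMiddle)
  open import Data.Fin.Base using (Fin; zero; suc)
  open import Data.Fin.Patterns using (0F; 1F; 2F)
  open import Data.List.Base using (_∷_)
  open import Data.Nat.Base as ℕ using (ℕ)
  open import Data.Product using (∃-syntax; _×_; _,_; proj₁; proj₂)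
  open import Data.Sum.Base using (inj₁; inj₂)
  open import Data.Unit.Polymorphic.Base using (⊤; tt)
  open import Function.Base using (_∘_; id)
  open import Level using (Level)
  open import Relation.Binary.PropositionalEquality using (_≡_; refl)
  open import Relation.Nullary using (¬_)
  open import Defs
  open WellOrders
  open Sizes
  open Stages
  open Toggles

  module ToggleChain (em : ∀ {a} → ExcludedMiddle a) (ac : AxiomOfChoice) {ℓ : Level}
                     (T : WellOrder ℓ) (T-unbounded : ∀ p → ∃[ q ] WellOrder._<_ T p q)
                     (Λ : Set ℓ) {n : ℕ} (op : Fin n → Λ → Λ → Λ → Λ)
                     (σ : WellOrder ℓ) (i₀ : WellOrder.Carrier σ) (t₀ : WellOrder.Carrier T)
                     (no-map : ∀ {P : WellOrder.Carrier T → Set ℓ} → (∀ p → ∃[ q ] (P q × WellOrder._<_ T p q)) →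
                               ¬ CofinalMap σ T P)
                     (indecomposable : ∀ (U : WellOrder.Carrier σ → Λ → Set ℓ) →
                        (∀ {i j} → WellOrder._≤_ σ i j → ∀ {x} → U i x → U j x) →
                        (∀ x → ∃[ i ] U i x) → ∀ i₁ →
                        (∀ i → WellOrder._≤_ σ i₁ i → ∀ k {x y z} → U i x → U i y → U i z → U i (op k x y z)) →
                        ∃[ i ] (∀ x → U i x)) where
    open LEM em
    open Exhaustion em
    open Toggle em ac T Λ op
    private
      module T = WellOrder T
      module σ = WellOrder σ
      I = σ.Carrier

    collect : ∀ {p} (k : ℕ) (P : I → Fin k → Set p) → (∀ {i j} → i σ.≤ j → ∀ {x} → P i x → P j x) →
              (∀ x → ∃[ i ] P i x) → ∃[ i ] (∀ x → P i x)
    collect ℕ.zero    P mono h = i₀ , λ ()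
    collect (ℕ.suc k) P mono h with h zero | collect k (λ i x → P i (suc x)) (λ l {x} → mono l {suc x}) (h ∘ suc)
    ... | i , p | j , q = σ.max i j , λ { zero → mono (σ.≤-maxˡ i j) p ; (suc x) → mono (σ.≤-maxʳ i j) (q x) }

    module _ (C : I → (D → D) → Set ℓ) (mono : ∀ {i j} → i σ.≤ j → ∀ {f} → C i f → C j f)
             (compose : ∀ {i f g} → C i f → C i g → C i (f ∘ g))
             (resp : ∀ {i f g} → (∀ d → f d ≡ g d) → C i f → C i g)
             (cover : ∀ q m → ∃[ i ] C i (toggle (move m) q q)) where

      -- The commutator is a product of four factors without inverses, because toggles are
      -- involutions; closure under composition is enough.
      product : ∀ {i} m₁ m₂ {q₁ r₁ q₂ r₂} → q₁ ⊑ r₁ → q₂ ⊑ r₂ → r₂ ⊏ q₁ →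
                C i (toggle m₁ q₁ r₁) → C i (toggle m₂ q₂ r₂) → C i (toggle (m₂ ∘ m₁) q₂ r₁)
      product m₁ m₂ h₁ h₂ l c₁ c₂ = resp (commutator m₁ m₂ h₁ h₂ l) (compose c₁ (compose c₂ (compose c₁ c₂)))

      -- One row q beyond x serves every p up to x, so each initial segment is settled at a single
      -- stage. The absence of cofinal maps from σ then yields one stage for all p.
      identities : ∃[ i ] (∀ p → ∃[ q ] (C i (toggle id (mid q) (mid q)) × p T.< q))
      identities = let i , h = exhaust σ T {P = λ _ → ⊤} U t₀ (λ i≤j (q , c , l) → q , mono i≤j c , l)
                                 stage (no-map λ p → let q , l = T-unbounded p in q , tt , l)
                   in i , λ p → h tt
        where
        U : I → T.Carrier → Set ℓ
        U i p = ∃[ q ] (C i (toggle id (mid q) (mid q)) × p T.< q)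
        stage : ∀ {x} → ⊤ → ∃[ i ] (∀ {y} → y T.≤ x → ⊤ → U i y)
        stage {x} _ = let q , l = T-unbounded x
                          i , c = cover (mid q) stay
                      in i , λ y≤x _ → q , c , T.≤-<-trans y≤x l

      module Rows (i₁ : I) (Q-unbounded : ∀ p → ∃[ q ] (C i₁ (toggle id (mid q) (mid q)) × p T.< q)) where

        Q : T.Carrier → Set ℓ
        Q p = C i₁ (toggle id (mid p) (mid p))

        Available : I → (W → W) → T.Carrier → Set ℓ
        Available i m p = ∃[ r ] (p T.≤ r × C i (toggle m (mid p) (mid r)))

        mid-⊑ : ∀ {p q} → p T.≤ q → mid p ⊑ mid q
        mid-⊑ h (mid-mid l) = h l

        -- Sources range over the rows of `Q`, while the target stays free because every composition
        -- pushes it upwards.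
        S : I → (W → W) → Set ℓ
        S i m = ∀ p → Q p → Available i m p

        S-mono : ∀ {i j} → i σ.≤ j → ∀ {m} → S i m → S j m
        S-mono i≤j s p q = let r , l , c = s p q in r , l , mono i≤j c

        -- `Q` is unbounded, so a source for `m′` exists above the target of `m`; this is the order
        -- of rows that the commutator formula wants.
        S-∘ : ∀ {i} → i₁ σ.≤ i → ∀ {m m′} → S i m → S i m′ → S i (m ∘ m′)
        S-∘ i₁≤i {m} {m′} s s′ p q =
          let r , p≤r , c = s p q
              p′ , q′ , r<p′ = Q-unbounded r
              r′ , p′≤r′ , c′ = s′ p′ q′
          in r′ , T.≤-trans p≤r (T.<⇒≤ (T.<-≤-trans r<p′ p′≤r′)) ,
             product m′ m (mid-⊑ p′≤r′) (mid-⊑ p≤r) (mid-mid r<p′) c′ c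

        S-resp : ∀ {i m m′} → (∀ w → m w ≡ m′ w) → S i m → S i m′
        S-resp h s p q = let r , l , c = s p q in r , l , resp (toggle-cong h (mid p) (mid r)) c

        -- A single T(m; x, x) settles all sources y < x in `Q` at once: its commutator with T(1; y,
        -- y) is T(m; y, x).
        S-cover : ∀ m → ∃[ i ] S i (move m)
        S-cover m = let i , h = exhaust σ T {P = Q} U t₀ U-mono stage
                                  (no-map λ p → let q , c , l = Q-unbounded p in q , c , l)
                    in σ.max i i₁ , λ p q → h q
          where
          U : I → T.Carrier → Set ℓ
          U i p = Available (σ.max i i₁) (move m) p
          max-mono : ∀ {i j} → i σ.≤ j → σ.max i i₁ σ.≤ σ.max j i₁
          max-mono {i} {j} i≤j = σ.max-elim (σ._≤ σ.max j i₁) {i} {i₁}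
            (σ.≤-trans {i} {j} {σ.max j i₁} i≤j (σ.≤-maxˡ j i₁)) (σ.≤-maxʳ j i₁)
          U-mono : ∀ {i j} → i σ.≤ j → ∀ {x} → U i x → U j x
          U-mono i≤j (r , l , c) = r , l , mono (max-mono i≤j) c
          stage : ∀ {x} → Q x → ∃[ i ] (∀ {y} → y T.≤ x → Q y → U i y)
          stage {x} qx = i , reach
            where
            i = proj₁ (cover (mid x) m)
            c : C (σ.max i i₁) (toggle (move m) (mid x) (mid x))
            c = mono (σ.≤-maxˡ i i₁) (proj₂ (cover (mid x) m))
            reach : ∀ {y} → y T.≤ x → Q y → U i y
            reach {y} y≤x qy with T.≤⇒<⊎≡ y≤x
            ... | inj₂ refl = x , T.≤-refl , c
            ... | inj₁ y<x  = x , y≤x , product (move m) id ⊏-irrefl ⊏-irrefl (mid-mid y<x) c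
                                (mono (σ.≤-maxʳ i i₁) qy)

        U : I → Λ → Set ℓ
        U i x = S i (move (push x))

        evaluations : ∃[ i ] (∀ k → S i (move (eval k)))
        evaluations = collect n (λ i k → S i (move (eval k))) (λ i≤j s → S-mono i≤j s) (λ k → S-cover (eval k))

        all-pushes : ∃[ i ] (i₁ σ.≤ i × (∀ x → S i (move (push x))))
        all-pushes =
          let i , h = indecomposable U (λ i≤j s → S-mono i≤j s) (λ x → S-cover (push x)) (σ.max i₁ (proj₁ evaluations)) closed
          in σ.max i₁ i , σ.≤-maxˡ i₁ i , λ x → S-mono (σ.≤-maxʳ i₁ i) (h x)
          where
          closed : ∀ i → σ.max i₁ (proj₁ evaluations) σ.≤ i → ∀ k {x y z} → U i x → U i y → U i z → U i (op k x y z)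
          -- Pushing z, y and x and then evaluating is, on every stack, the same as pushing the
          -- value of the operation.
          closed i l k Ux Uy Uz = S-resp (λ _ → refl)
            (S-∘ i₁≤i (S-mono (σ.≤-trans (σ.≤-maxʳ i₁ (proj₁ evaluations)) l) (proj₂ evaluations k))
              (S-∘ i₁≤i Ux (S-∘ i₁≤i Uy Uz)))
            where i₁≤i = σ.≤-trans (σ.≤-maxˡ i₁ (proj₁ evaluations)) l

        -- The target row of a push depends on the element pushed. Commutators with T(1; bot, bot)
        -- and T(1; top, top) bring both rows to the fixed ends, uniformly in x.
        corners : ∃[ i ] (∀ x → C i (toggle (x ∷_) bot top))
        corners = k , λ x →
          let p , q , _ = Q-unbounded t₀
              r , p≤r , c = proj₂ (proj₂ all-pushes) x p q
          in product id (x ∷_) ⊏-irrefl (λ ()) mid-top (mono (at 2F) (proj₂ ends-top))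
               (product (x ∷_) id (mid-⊑ p≤r) ⊏-irrefl bot-mid (mono (at 0F) c) (mono (at 1F) (proj₂ ends-bot)))
          where
          ends-bot = cover bot stay
          ends-top = cover top stay
          stages : Fin 3 → I
          stages 0F = proj₁ all-pushes
          stages 1F = proj₁ ends-bot
          stages 2F = proj₁ ends-top
          bound = collect 3 (λ i f → stages f σ.≤ i) (λ i≤j l → σ.≤-trans l i≤j) (λ f → stages f , σ.≤-refl)
          k = proj₁ bound
          at = proj₂ bound

      toggle-corners : ∃[ i ] (∀ x → C i (toggle (x ∷_) bot top))
      toggle-corners = Rows.corners (proj₁ identities) (proj₂ identities)

-- The tower of length θ and its action by involutions.

module Towers where

  open import Axiom.ExcludedMiddle using (ExcludedMiddle)
  open import Data.Bool.Base using (Bool; true; false; _xor_; _∧_)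
  open import Data.Empty using (⊥-elim)
  open import Data.Fin.Base using (Fin)
  open import Data.List.Base using ([]; _∷_)
  open import Data.Maybe.Base as Maybe using (Maybe; just; nothing)
  open import Data.Maybe.Properties using (just-injective)
  open import Data.Nat.Base as ℕ using (ℕ)
  open import Data.Product using (∃-syntax; _×_; _,_)
  open import Data.Sum.Base using (_⊎_; inj₁; inj₂)
  open import Data.Unit.Polymorphic.Base using (⊤; tt)
  open import Function.Base using (_∘_; id)
  open import Induction.WellFounded using (Acc; acc)
  open import Level using (Level)
  open import Relation.Binary.Bundles using (Setoid)
  open import Relation.Binary.PropositionalEquality using (_≡_; _≢_; refl; sym; trans; cong; cong₂; subst; isEquivalence; module ≡-Reasoning)
  open import Relation.Nullary using (¬_; Dec; yes; no; does)
  open import Defs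
  open WellOrders
  open Sizes
  open Cardinals
  open InvolutionGroups
  open Toggles

  module Swapping (em : ∀ {a} → ExcludedMiddle a) {a : Level} {A : Set a} where
    open LEM em

    opaque
      swap : A → A → A → A
      swap x y z with em {P = z ≡ x} | em {P = z ≡ y}
      ... | yes _ | _     = y
      ... | no _  | yes _ = x
      ... | no _  | no _  = z

      swap-left : ∀ x y → swap x y x ≡ y
      swap-left x y with em {P = x ≡ x} | em {P = x ≡ y}
      ... | yes _ | _ = refl
      ... | no ¬e | _ = ⊥-elim (¬e refl)

      swap-right : ∀ x y → swap x y y ≡ x
      swap-right x y with em {P = y ≡ x} | em {P = y ≡ y}
      ... | yes e | _     = e
      ... | no _  | yes _ = refl
      ... | no _  | no ¬e = ⊥-elim (¬e refl)

      swap-other : ∀ {x y z} → z ≢ x → z ≢ y → swap x y z ≡ z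
      swap-other {x} {y} {z} z≢x z≢y with em {P = z ≡ x} | em {P = z ≡ y}
      ... | yes e | _     = ⊥-elim (z≢x e)
      ... | no _  | yes e = ⊥-elim (z≢y e)
      ... | no _  | no _  = refl

    data SwapView (x y : A) : A → Set a where
      is-left  : SwapView x y x
      is-right : SwapView x y y
      is-other : ∀ {z} → z ≢ x → z ≢ y → SwapView x y z

    swap-view : ∀ x y z → SwapView x y z
    swap-view x y z with em {P = z ≡ x} | em {P = z ≡ y}
    ... | yes refl | _        = is-left
    ... | no _     | yes refl = is-right
    ... | no z≢x   | no z≢y   = is-other z≢x z≢y

    swap-involutive : ∀ x y z → swap x y (swap x y z) ≡ z
    swap-involutive x y z with swap-view x y z
    ... | is-left        = trans (cong (swap x y) (swap-left x y)) (swap-right x y)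
    ... | is-right       = trans (cong (swap x y) (swap-right x y)) (swap-left x y)
    ... | is-other p q   = trans (cong (swap x y) (swap-other p q)) (swap-other p q)

    swap-cases : ∀ x y z → (swap x y z ≡ x) ⊎ (swap x y z ≡ y) ⊎ (swap x y z ≡ z)
    swap-cases x y z with swap-view x y z
    ... | is-left      = inj₂ (inj₁ (swap-left x y))
    ... | is-right     = inj₁ (swap-right x y)
    ... | is-other p q = inj₂ (inj₂ (swap-other p q))

  module Tower (em : ∀ {a} → ExcludedMiddle a) (ac : AxiomOfChoice) {ℓ : Level}
               (T : WellOrder ℓ) (Λ : Set ℓ) {n : ℕ} (op : Fin n → Λ → Λ → Λ → Λ)
               (B : Involutions ℓ) where
    open LEM em
    open Canonical em ac
    open Swapping em
    open Toggle em ac T Λ op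
    private
      module T = WellOrder T
      module B = Involutions B
      module E = Involutions toggles

    -- `flip` moves a coordinate by a toggle, `carry` and `star` are transpositions involving the
    -- base point, and `copy↓` acts at the place of a lower generator as that generator.
    data Generator : Set ℓ where
      flip  : E.Gen → Generator
      carry : E.Gen → Generator
      star  : Generator
      copy↓ : Generator

    data Gen : Set ℓ where
      base : B.Gen → Gen
      lev  : T.Carrier → Generator → Gen

    Below : T.Carrier → Gen → Set ℓ
    Below q (base _)   = ⊤
    Below q (lev p _)  = p T.< q

    below-mono : ∀ {q r} g → Below q g → q T.< r → Below r g
    below-mono (base _)  _ _ = tt
    below-mono (lev _ _) b l = T.<-trans b l

    Coord : Set ℓ
    Coord = Maybe D

    coordinates : Setoid ℓ ℓ
    coordinates = record
      { Carrier       = T.Carrier → Coord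
      ; _≈_           = λ f g → ∀ q → f q ≡ g q
      ; isEquivalence = record
        { refl  = λ _ → refl
        ; sym   = λ h q → sym (h q)
        ; trans = λ h k q → trans (h q) (k q)
        }
      }

    record Ω : Set ℓ where
      constructor _,_
      field
        ground : B.Ω
        coords : Canon coordinates

    open Ω public

    opaque
      coord : T.Carrier → Ω → Coord
      coord q ω = out (coords ω) q

      set : T.Carrier → Coord → Ω → Ω
      set q x (b , f) = b , class λ r → if-dec (em {P = r ≡ q}) x (out f r)

      setBase : B.Ω → Ω → Ω
      setBase b (_ , f) = b , f

      ground-set : ∀ q x ω → ground (set q x ω) ≡ ground ω
      ground-set q x ω = refl

      ground-setBase : ∀ b ω → ground (setBase b ω) ≡ b
      ground-setBase b ω = refl

      coord-setBase : ∀ q b ω → coord q (setBase b ω) ≡ coord q ω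
      coord-setBase q b ω = refl

      coord-set : ∀ q x ω → coord q (set q x ω) ≡ x
      coord-set q x (b , f) = trans (out-class {S = coordinates} _ q) (same (em {P = q ≡ q}))
        where
        same : (d : Dec (q ≡ q)) → if-dec d x (out f q) ≡ x
        same (yes _) = refl
        same (no ¬e) = ⊥-elim (¬e refl)

      coord-set-≢ : ∀ {q r} x ω → r ≢ q → coord r (set q x ω) ≡ coord r ω
      coord-set-≢ {q} {r} x (b , f) r≢q = trans (out-class {S = coordinates} _ r) (diff (em {P = r ≡ q}))
        where
        diff : (d : Dec (r ≡ q)) → if-dec d x (out f r) ≡ out f r
        diff (yes e) = ⊥-elim (r≢q e)
        diff (no _)  = refl

      vacant-point : B.Ω → Ω
      vacant-point b = b , class λ _ → nothing

      ground-vacant : ∀ b → ground (vacant-point b) ≡ b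
      ground-vacant b = refl

      coord-vacant : ∀ b q → coord q (vacant-point b) ≡ nothing
      coord-vacant b q = out-class {S = coordinates} _ q

      Ω-ext : ∀ {ω ω′} → ground ω ≡ ground ω′ → (∀ q → coord q ω ≡ coord q ω′) → ω ≡ ω′
      Ω-ext {b , f} {.b , f′} refl h = cong (b ,_) (out-injective {S = coordinates} h)

    ≢-sym′ : ∀ {q r : T.Carrier} → q T.< r → r ≢ q
    ≢-sym′ l refl = T.<-irrefl l

    set-set : ∀ q x y ω → set q x (set q y ω) ≡ set q x ω
    set-set q x y ω = Ω-ext (trans (ground-set q x _) (trans (ground-set q y ω) (sym (ground-set q x ω)))) at
      where
      at : ∀ r → coord r (set q x (set q y ω)) ≡ coord r (set q x ω)
      at r with em {P = r ≡ q}
      ... | yes refl = trans (coord-set q x _) (sym (coord-set q x ω))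
      ... | no r≢q   = trans (coord-set-≢ x _ r≢q) (trans (coord-set-≢ y ω r≢q) (sym (coord-set-≢ x ω r≢q)))

    set-coord : ∀ {q x} ω → coord q ω ≡ x → set q x ω ≡ ω
    set-coord {q} {x} ω e = Ω-ext (ground-set q x ω) at
      where
      at : ∀ r → coord r (set q x ω) ≡ coord r ω
      at r with em {P = r ≡ q}
      ... | yes refl = trans (coord-set q x ω) (sym e)
      ... | no r≢q   = coord-set-≢ x ω r≢q

    set-comm : ∀ {q r} x y ω → r ≢ q → set q x (set r y ω) ≡ set r y (set q x ω)
    set-comm {q} {r} x y ω r≢q = Ω-ext
        (trans (ground-set q x _) (trans (ground-set r y ω) (sym (trans (ground-set r y _) (ground-set q x ω))))) at
      where
      at : ∀ s → coord s (set q x (set r y ω)) ≡ coord s (set r y (set q x ω))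
      at s with em {P = s ≡ q} | em {P = s ≡ r}
      ... | yes refl | yes refl = ⊥-elim (r≢q refl)
      ... | yes refl | no s≢r   = trans (coord-set s x _) (sym (trans (coord-set-≢ y _ s≢r) (coord-set s x ω)))
      ... | no s≢q   | yes refl = trans (coord-set-≢ x _ s≢q) (trans (coord-set s y ω) (sym (coord-set s y _)))
      ... | no s≢q   | no s≢r   = trans (coord-set-≢ x _ s≢q) (trans (coord-set-≢ y ω s≢r)
                                    (sym (trans (coord-set-≢ y _ s≢r) (coord-set-≢ x ω s≢q))))

    setBase-set : ∀ b q x ω → setBase b (set q x ω) ≡ set q x (setBase b ω)
    setBase-set b q x ω = Ω-ext (trans (ground-setBase b _) (sym (trans (ground-set q x _) (ground-setBase b ω)))) at
      where
      at : ∀ r → coord r (setBase b (set q x ω)) ≡ coord r (set q x (setBase b ω))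
      at r with em {P = r ≡ q}
      ... | yes refl = trans (coord-setBase q b _) (trans (coord-set q x ω) (sym (coord-set q x _)))
      ... | no r≢q   = trans (coord-setBase r b _) (trans (coord-set-≢ x ω r≢q)
                         (sym (trans (coord-set-≢ x _ r≢q) (coord-setBase r b ω))))

    Diagonal : W → Set ℓ
    Diagonal w = ∃[ x ] (w ≡ x ∷ x ∷ [])

    onDiagonal : Row → W → Bool
    onDiagonal bot w = does (em {P = Diagonal w})
    onDiagonal _   w = false

    opaque
      -- The base point holds the diagonal of λ in row `bot`. Reading it at `x ∷ w` and writing the
      -- result into row `end` records there, at the stack `y ∷ []`, whether y is x; so distinct x
      -- lead to distinct marks.
      origin : D
      origin = table onDiagonal

      val-origin : ∀ s w → val origin s w ≡ onDiagonal s w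
      val-origin = val-table onDiagonal

    mark : Λ → D
    mark x = toggle (x ∷_) bot top origin

    val-mark : ∀ x y → val (mark x) end (y ∷ []) ≡ does (em {P = Diagonal (x ∷ y ∷ [])})
    val-mark x y = trans (val-toggle (x ∷_) bot top origin end (y ∷ []))
      (cong₂ _xor_ (val-origin end (y ∷ [])) (cong₂ _∧_ (gate-yes top-end) (val-origin bot (x ∷ y ∷ []))))

    val-mark-same : ∀ x → val (mark x) end (x ∷ []) ≡ true
    val-mark-same x = trans (val-mark x x) (known em)
      where
      known : (d : Dec (Diagonal (x ∷ x ∷ []))) → does d ≡ true
      known (yes _) = refl
      known (no ¬d) = ⊥-elim (¬d (x , refl))

    val-mark-true : ∀ {x y} → val (mark x) end (y ∷ []) ≡ true → x ≡ y
    val-mark-true {x} {y} h = known em (trans (sym (val-mark x y)) h)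
      where
      known : (d : Dec (Diagonal (x ∷ y ∷ []))) → does d ≡ true → x ≡ y
      known (yes (_ , refl)) _ = refl

    mark-injective : ∀ {x y} → mark x ≡ mark y → x ≡ y
    mark-injective {x} {y} e = sym (val-mark-true (subst (λ d → val d end (x ∷ []) ≡ true) e (val-mark-same x)))

    mark≢origin : ∀ {x} → mark x ≢ origin
    mark≢origin {x} e with trans (sym (val-mark-same x)) (trans (cong (λ d → val d end (x ∷ [])) e) (val-origin end (x ∷ [])))
    ... | ()

    -- Generators act only where all higher coordinates are neutral.  There are two neutral values
    -- because conjugating copy↓ recovers a generator at two places at once, never at a single one.
    data Neutral : Coord → Set ℓ where
      at-origin : Neutral (just origin)
      at-star   : Neutral nothing

    NeutralAbove : T.Carrier → Ω → Set ℓ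
    NeutralAbove q ω = ∀ r → q T.< r → Neutral (coord r ω)

    module Action (code : Gen → Λ) (code-injective : ∀ {g h} → code g ≡ code h → g ≡ h) where

      place : Gen → Coord
      place g = just (mark (code g))

      place-injective : ∀ {g h} → place g ≡ place h → g ≡ h
      place-injective e = code-injective (mark-injective (just-injective e))

      place-not-neutral : ∀ {g} → ¬ Neutral (place g)
      place-not-neutral {g} = go refl
        where
        go : ∀ {x} → x ≡ place g → ¬ Neutral x
        go e at-origin = mark≢origin (sym (just-injective e))

      permute : Generator → Coord → Coord
      permute (flip g)  = Maybe.map (E.act g)
      permute (carry g) = swap (just origin) (just (E.act g origin))
      permute star      = swap (just origin) nothing
      -- A placeholder: `copy↓` leaves its own coordinate alone, and its effect below is defined
      -- separately.
      permute copy↓     = id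

      permute-involutive : ∀ l x → permute l (permute l x) ≡ x
      permute-involutive (flip g) (just d) = cong just (E.involutive g d)
      permute-involutive (flip g) nothing  = refl
      permute-involutive (carry g)         = swap-involutive _ _
      permute-involutive star              = swap-involutive _ _
      permute-involutive copy↓ x           = refl

      Occupied : T.Carrier → Coord → Set ℓ
      Occupied q x = ∃[ g ] (Below q g × x ≡ place g)

      private
        actBase : B.Gen → Ω → Ω
        actBase c ω = if-dec (em {P = ∀ r → Neutral (coord r ω)}) (setBase (B.act c (ground ω)) ω) ω

        mutual
          actLevel : ∀ {q} → Acc T._<_ q → Generator → Ω → Ω
          actLevel {q} a l ω = if-dec (em {P = NeutralAbove q ω}) (local a l ω) ω

          local : ∀ {q} → Acc T._<_ q → Generator → Ω → Ω
          local {q} a copy↓ ω = applyCopy a (em {P = Occupied q (coord q ω)}) ω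
          local {q} a l     ω = set q (permute l (coord q ω)) ω

          applyCopy : ∀ {q x} → Acc T._<_ q → Dec (Occupied q x) → Ω → Ω
          applyCopy a (no _) ω = ω
          -- The place is not neutral and would block g, so the coordinate is reset to the base
          -- point while g acts and is restored afterwards.
          applyCopy {q} {x} a (yes (g , b , _)) ω = set q x (actBelow a g b (set q (just origin) ω))

          actBelow : ∀ {q} → Acc T._<_ q → ∀ g → Below q g → Ω → Ω
          actBelow a        (base c)  _ = actBase c
          actBelow (acc rs) (lev p l) b = actLevel (rs b) l

        irrelevant : ∀ {q} (a a′ : Acc T._<_ q) l ω → actLevel a l ω ≡ actLevel a′ l ω
        irrelevant-copy : ∀ {q x} (a a′ : Acc T._<_ q) (d : Dec (Occupied q x)) ω → applyCopy a d ω ≡ applyCopy a′ d ω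
        irrelevant {q} a a′ (flip _)  ω = refl
        irrelevant {q} a a′ (carry _) ω = refl
        irrelevant {q} a a′ star      ω = refl
        irrelevant {q} a a′ copy↓     ω = cong (λ z → if-dec (em {P = NeutralAbove q ω}) z ω) (irrelevant-copy a a′ em ω)
        irrelevant-copy a a′ (no _) ω = refl
        irrelevant-copy a a′ (yes (base c , b , _)) ω = refl
        irrelevant-copy {q} {x} (acc rs) (acc rs′) (yes (lev p l , b , _)) ω =
          cong (set q x) (irrelevant (rs b) (rs′ b) l (set q (just origin) ω))

      opaque
        act : Gen → Ω → Ω
        act (base c)  = actBase c
        act (lev q l) = actLevel (T.wf q) l

        act-base : ∀ c ω → (∀ r → Neutral (coord r ω)) → act (base c) ω ≡ setBase (B.act c (ground ω)) ω
        act-base c ω h with em {P = ∀ r → Neutral (coord r ω)}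
        ... | yes _ = refl
        ... | no ¬h = ⊥-elim (¬h h)

        act-base-idle : ∀ c ω → ¬ (∀ r → Neutral (coord r ω)) → act (base c) ω ≡ ω
        act-base-idle c ω ¬h with em {P = ∀ r → Neutral (coord r ω)}
        ... | yes h = ⊥-elim (¬h h)
        ... | no _  = refl

        act-idle : ∀ {q} l ω → ¬ NeutralAbove q ω → act (lev q l) ω ≡ ω
        act-idle {q} l ω ¬h with em {P = NeutralAbove q ω}
        ... | yes h = ⊥-elim (¬h h)
        ... | no _  = refl

        act-permute : ∀ {q} l ω → l ≢ copy↓ → NeutralAbove q ω → act (lev q l) ω ≡ set q (permute l (coord q ω)) ω
        act-permute {q} l ω l≢ h with em {P = NeutralAbove q ω}
        act-permute (flip _)  ω l≢ h | yes _ = refl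
        act-permute (carry _) ω l≢ h | yes _ = refl
        act-permute star      ω l≢ h | yes _ = refl
        act-permute copy↓     ω l≢ h | yes _ = ⊥-elim (l≢ refl)
        ... | no ¬h = ⊥-elim (¬h h)

        act-copy : ∀ {q g} ω → NeutralAbove q ω → Below q g → coord q ω ≡ place g →
                   act (lev q copy↓) ω ≡ set q (place g) (act g (set q (just origin) ω))
        act-copy {q} {g} ω h b e with em {P = NeutralAbove q ω}
        ... | no ¬h = ⊥-elim (¬h h)
        ... | yes _ = chosen em
          where
          below-act : ∀ g′ (b′ : Below q g′) → g′ ≡ g → ∀ ω′ → actBelow (T.wf q) g′ b′ ω′ ≡ act g ω′
          below-act (base c) b′ refl ω′ = refl
          below-act (lev p l) b′ refl ω′ = unwrap (T.wf q)
            where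
            unwrap : (a : Acc T._<_ q) → actBelow a (lev p l) b′ ω′ ≡ actLevel (T.wf p) l ω′
            unwrap (acc rs) = irrelevant (rs b′) (T.wf p) l ω′
          chosen : (d : Dec (Occupied q (coord q ω))) →
                   applyCopy (T.wf q) d ω ≡ set q (place g) (act g (set q (just origin) ω))
          chosen (no none) = ⊥-elim (none (g , b , e))
          chosen (yes (g′ , b′ , e′)) = cong₂ (λ x ω′ → set q x ω′) e
            (below-act g′ b′ (place-injective (trans (sym e′) e)) (set q (just origin) ω))

        act-copy-idle : ∀ {q} ω → ¬ Occupied q (coord q ω) → act (lev q copy↓) ω ≡ ω
        act-copy-idle {q} ω ¬occ with em {P = NeutralAbove q ω}
        ... | no _  = refl
        ... | yes _ = chosen em
          where
          chosen : (d : Dec (Occupied q (coord q ω))) → applyCopy (T.wf q) d ω ≡ ω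
          chosen (no _)    = refl
          chosen (yes occ) = ⊥-elim (¬occ occ)

      data ActView (q : T.Carrier) (ω : Ω) : Generator → Ω → Set ℓ where
        idle     : ∀ {l} → ¬ NeutralAbove q ω → ActView q ω l ω
        permutes : ∀ {l} → l ≢ copy↓ → NeutralAbove q ω → ActView q ω l (set q (permute l (coord q ω)) ω)
        copies   : ∀ g → NeutralAbove q ω → Below q g → coord q ω ≡ place g →
                   ActView q ω copy↓ (set q (place g) (act g (set q (just origin) ω)))
        vacant   : NeutralAbove q ω → ¬ Occupied q (coord q ω) → ActView q ω copy↓ ω

      actView : ∀ q l ω → ActView q ω l (act (lev q l) ω)
      actView q l ω with em {P = NeutralAbove q ω}
      ... | no ¬h = subst (ActView q ω l) (sym (act-idle l ω ¬h)) (idle ¬h)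
      ... | yes h = go l
        where
        go : ∀ l → ActView q ω l (act (lev q l) ω)
        go (flip g)  = subst (ActView q ω _) (sym (act-permute (flip g) ω (λ ()) h)) (permutes (λ ()) h)
        go (carry g) = subst (ActView q ω _) (sym (act-permute (carry g) ω (λ ()) h)) (permutes (λ ()) h)
        go star      = subst (ActView q ω _) (sym (act-permute star ω (λ ()) h)) (permutes (λ ()) h)
        go copy↓ with em {P = Occupied q (coord q ω)}
        ... | yes (g , b , e) = subst (ActView q ω _) (sym (act-copy ω h b e)) (copies g h b e)
        ... | no ¬occ         = subst (ActView q ω _) (sym (act-copy-idle ω ¬occ)) (vacant h ¬occ)

      neutral-set : ∀ {q r} {x} {ω} → Neutral x → NeutralAbove q ω → NeutralAbove q (set r x ω)
      neutral-set {q} {r} {x} {ω} nx h s q<s with em {P = s ≡ r}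
      ... | yes refl = subst Neutral (sym (coord-set s x ω)) nx
      ... | no s≢r   = subst Neutral (sym (coord-set-≢ x ω s≢r)) (h s q<s)

      neutral-set-at : ∀ {q} x {ω} → NeutralAbove q ω → NeutralAbove q (set q x ω)
      neutral-set-at {q} x {ω} h s q<s = subst Neutral (sym (coord-set-≢ x ω (≢-sym′ q<s))) (h s q<s)

      unset : ∀ {r x} ω → set r (coord r ω) (set r x ω) ≡ ω
      unset {r} {x} ω = trans (set-set r (coord r ω) x ω) (set-coord ω refl)

      neutral-unset : ∀ {q r x} {ω} → Neutral (coord r ω) → NeutralAbove q (set r x ω) → NeutralAbove q ω
      neutral-unset {q} {r} {x} {ω} nr h = subst (NeutralAbove q) (unset {r} {x} ω) (neutral-set nr h)

      coord-act-base : ∀ c r ω → coord r (act (base c) ω) ≡ coord r ω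
      coord-act-base c r ω with em {P = ∀ r → Neutral (coord r ω)}
      ... | yes h = trans (cong (coord r) (act-base c ω h)) (coord-setBase r _ ω)
      ... | no ¬h = cong (coord r) (act-base-idle c ω ¬h)

      coord-act-lev : ∀ {q} → Acc T._<_ q → ∀ l ω {r} → q T.< r → coord r (act (lev q l) ω) ≡ coord r ω
      coord-act-lev {q} (acc rs) l ω {r} q<r = go (actView q l ω)
        where
        lower : ∀ g → Below q g → ∀ ω → coord r (act g ω) ≡ coord r ω
        lower (base c)  _ ω = coord-act-base c r ω
        lower (lev p l) b ω = coord-act-lev (rs b) l ω (T.<-trans b q<r)
        go : ∀ {l ω′} → ActView q ω l ω′ → coord r ω′ ≡ coord r ω
        go (idle _)         = refl
        go (permutes _ _)   = coord-set-≢ _ ω (≢-sym′ q<r)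
        go (copies g _ b _) = trans (coord-set-≢ _ _ (≢-sym′ q<r)) (trans (lower g b _) (coord-set-≢ _ ω (≢-sym′ q<r)))
        go (vacant _ _)     = refl

      coord-act : ∀ {r} g → Below r g → ∀ ω → coord r (act g ω) ≡ coord r ω
      coord-act (base c)  _ ω = coord-act-base c _ ω
      coord-act (lev p l) b ω = coord-act-lev (T.wf p) l ω b

      act-above-idle : ∀ {r} g → Below r g → ∀ ω → ¬ Neutral (coord r ω) → act g ω ≡ ω
      act-above-idle (base c)  _ ω ¬n = act-base-idle c ω λ h → ¬n (h _)
      act-above-idle (lev p l) b ω ¬n = act-idle l ω λ h → ¬n (h _ b)

      act-base-set : ∀ c {r x} ω → Neutral x → Neutral (coord r ω) → act (base c) (set r x ω) ≡ set r x (act (base c) ω)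
      act-base-set c {r} {x} ω nx nr with em {P = ∀ s → Neutral (coord s ω)}
      ... | yes h = begin
          act (base c) (set r x ω)                              ≡⟨ act-base c _ h′ ⟩
          setBase (B.act c (ground (set r x ω))) (set r x ω)    ≡⟨ cong (λ b → setBase (B.act c b) (set r x ω)) (ground-set r x ω) ⟩
          setBase (B.act c (ground ω)) (set r x ω)              ≡⟨ setBase-set _ r x ω ⟩
          set r x (setBase (B.act c (ground ω)) ω)              ≡⟨ cong (set r x) (act-base c ω h) ⟨
          set r x (act (base c) ω)                              ∎
        where
        open ≡-Reasoning
        h′ : ∀ s → Neutral (coord s (set r x ω))
        h′ s with em {P = s ≡ r}
        ... | yes refl = subst Neutral (sym (coord-set s x ω)) nx
        ... | no s≢r   = subst Neutral (sym (coord-set-≢ x ω s≢r)) (h s)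
      ... | no ¬h = trans (act-base-idle c _ (¬h ∘ back)) (cong (set r x) (sym (act-base-idle c ω ¬h)))
        where
        back : (∀ s → Neutral (coord s (set r x ω))) → ∀ s → Neutral (coord s ω)
        back h s with em {P = s ≡ r}
        ... | yes refl = nr
        ... | no s≢r   = subst Neutral (coord-set-≢ x ω s≢r) (h s)

      -- A lower generator asks of a higher coordinate only whether it is neutral, so it commutes
      -- with exchanging one neutral value for the other.
      act-lev-set : ∀ {q} → Acc T._<_ q → ∀ l {r x} ω → q T.< r → Neutral x → Neutral (coord r ω) →
                    act (lev q l) (set r x ω) ≡ set r x (act (lev q l) ω)
      act-lev-set {q} (acc rs) l {r} {x} ω q<r nx nr = go (actView q l ω)
        where
        q≢r : q ≢ r
        q≢r refl = T.<-irrefl q<r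
        lower : ∀ g → Below q g → ∀ ω → Neutral (coord r ω) → act g (set r x ω) ≡ set r x (act g ω)
        lower (base c)  _ ω nr = act-base-set c ω nx nr
        lower (lev p l) b ω nr = act-lev-set (rs b) l ω (T.<-trans b q<r) nx nr
        same : coord q (set r x ω) ≡ coord q ω
        same = coord-set-≢ x ω q≢r
        go : ∀ {l ω′} → ActView q ω l ω′ → act (lev q l) (set r x ω) ≡ set r x ω′
        go (idle ¬h) = act-idle _ _ (¬h ∘ neutral-unset nr)
        go (permutes {l} l≢ h) = trans (act-permute l _ l≢ (neutral-set nx h))
          (trans (cong (λ y → set q (permute l y) (set r x ω)) same) (set-comm _ x ω (q≢r ∘ sym)))
        go (copies g h b e) = begin
          act (lev q copy↓) (set r x ω)                              ≡⟨ act-copy _ (neutral-set nx h) b (trans same e) ⟩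
          set q (place g) (act g (set q (just origin) (set r x ω)))  ≡⟨ cong (set q (place g) ∘ act g) (set-comm _ x ω (q≢r ∘ sym)) ⟩
          set q (place g) (act g (set r x (set q (just origin) ω)))  ≡⟨ cong (set q (place g)) (lower g b _ nr′) ⟩
          set q (place g) (set r x (act g (set q (just origin) ω)))  ≡⟨ set-comm _ x _ (q≢r ∘ sym) ⟩
          set r x (set q (place g) (act g (set q (just origin) ω)))  ∎
          where
          open ≡-Reasoning
          nr′ : Neutral (coord r (set q (just origin) ω))
          nr′ = subst Neutral (sym (coord-set-≢ _ ω (q≢r ∘ sym))) nr
        go (vacant h ¬occ) = act-copy-idle _ (¬occ ∘ subst (Occupied q) same)

      act-set : ∀ {r x} g → Below r g → ∀ ω → Neutral x → Neutral (coord r ω) → act g (set r x ω) ≡ set r x (act g ω)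
      act-set (base c)  _ ω nx nr = act-base-set c ω nx nr
      act-set (lev p l) b ω nx nr = act-lev-set (T.wf p) l ω b nx nr

      act-base-involutive : ∀ c ω → act (base c) (act (base c) ω) ≡ ω
      act-base-involutive c ω with em {P = ∀ s → Neutral (coord s ω)}
      ... | no ¬h = trans (cong (act (base c)) (act-base-idle c ω ¬h)) (act-base-idle c ω ¬h)
      ... | yes h = trans (cong (act (base c)) (act-base c ω h)) (trans (act-base c _ h′)
            (Ω-ext (trans (ground-setBase _ _) (trans (cong (B.act c) (ground-setBase _ ω)) (B.involutive c (ground ω))))
                   λ r → trans (coord-setBase r _ _) (coord-setBase r _ ω)))
        where
        h′ : ∀ s → Neutral (coord s (setBase (B.act c (ground ω)) ω))
        h′ s = subst Neutral (sym (coord-setBase s _ ω)) (h s)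

      act-lev-involutive : ∀ {q} → Acc T._<_ q → ∀ l ω → act (lev q l) (act (lev q l) ω) ≡ ω
      act-lev-involutive {q} (acc rs) l ω = go (actView q l ω)
        where
        open ≡-Reasoning
        lower : ∀ g → Below q g → ∀ ω → act g (act g ω) ≡ ω
        lower (base c)  _ = act-base-involutive c
        lower (lev p l) b = act-lev-involutive (rs b) l
        go : ∀ {l ω′} → ActView q ω l ω′ → act (lev q l) ω′ ≡ ω
        go (idle ¬h) = act-idle _ ω ¬h
        go (permutes {l} l≢ h) = begin
          act (lev q l) (set q y ω)                  ≡⟨ act-permute l _ l≢ (neutral-set-at y h) ⟩
          set q (permute l (coord q (set q y ω))) (set q y ω)
            ≡⟨ cong (λ z → set q (permute l z) (set q y ω)) (coord-set q y ω) ⟩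
          set q (permute l y) (set q y ω)            ≡⟨ set-set q _ y ω ⟩
          set q (permute l y) ω                      ≡⟨ set-coord ω (sym (permute-involutive l (coord q ω))) ⟩
          ω                                          ∎
          where y = permute l (coord q ω)
        go (copies g h b e) = begin
          act (lev q copy↓) (set q (place g) ω₂)     ≡⟨ act-copy _ (neutral-set-at _ h₂) b (coord-set q _ ω₂) ⟩
          set q (place g) (act g (set q (just origin) (set q (place g) ω₂)))
            ≡⟨ cong (set q (place g) ∘ act g) (trans (set-set q _ _ ω₂) (set-coord ω₂ (trans (coord-act g b ω₁) (coord-set q _ ω)))) ⟩
          set q (place g) (act g (act g ω₁))         ≡⟨ cong (set q (place g)) (lower g b ω₁) ⟩
          set q (place g) (set q (just origin) ω)    ≡⟨ set-set q _ _ ω ⟩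
          set q (place g) ω                          ≡⟨ set-coord ω e ⟩
          ω                                          ∎
          where
          ω₁ = set q (just origin) ω
          ω₂ = act g ω₁
          h₂ : NeutralAbove q ω₂
          h₂ s q<s = subst Neutral (sym (trans (coord-act g (below-mono g b q<s) ω₁) (coord-set-≢ _ ω (≢-sym′ q<s)))) (h s q<s)
        go (vacant _ ¬occ) = act-copy-idle ω ¬occ

      act-involutive : ∀ g ω → act g (act g ω) ≡ ω
      act-involutive (base c)  = act-base-involutive c
      act-involutive (lev q l) = act-lev-involutive (T.wf q) l

      tower : Involutions ℓ
      tower = record { Gen = Gen ; Ω = Ω ; act = act ; involutive = act-involutive }

-- Uniformly bounded orbits in the tower.

module TowerFiniteness where

  open import Axiom.ExcludedMiddle using (ExcludedMiddle)
  open import Data.Bool.Base using (Bool; true; false; _xor_; _∧_)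
  open import Data.Empty using (⊥-elim)
  open import Data.Fin.Base using (Fin)
  open import Data.List.Base using (List; []; _∷_; _++_; map; length; reverse; cartesianProductWith)
  open import Data.List.Properties using (length-map)
  open import Data.List.Membership.Propositional using (_∈_)
  open import Data.List.Membership.Propositional.Properties using (∈-map⁺; ∈-map⁻; ∈-++⁺ˡ; ∈-++⁺ʳ; ∈-++⁻; ∈-cartesianProductWith⁺; ∈-cartesianProductWith⁻)
  open import Data.List.Relation.Unary.All as All using (All; []; _∷_)
  import Data.List.Relation.Unary.All.Properties as Allₚ
  open import Data.List.Relation.Unary.Any using (here; there)
  open import Data.Maybe.Base using (just; nothing)
  open import Data.Maybe.Properties using (just-injective)
  open import Data.Nat.Base as ℕ using (ℕ)
  import Data.Nat.Properties as ℕₚ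
  open import Data.Product using (Σ-syntax; ∃-syntax; _×_; _,_; proj₁; proj₂)
  open import Data.Sum.Base using (_⊎_; inj₁; inj₂)
  open import Data.Unit.Polymorphic.Base using (tt)
  open import Function.Base using (_∘_)
  open import Induction.WellFounded using (module All)
  open import Level using (Level)
  open import Relation.Binary.Definitions using (tri<; tri≈; tri>)
  open import Relation.Binary.PropositionalEquality using (_≡_; _≢_; refl; sym; trans; cong; cong₂; subst; module ≡-Reasoning)
  open import Relation.Nullary using (¬_; Dec; yes; no)
  open import Defs
  open WellOrders
  open Sizes
  open InvolutionGroups
  open Toggles
  open Towers

  module Selection (em : ∀ {a} → ExcludedMiddle a) where

    select : ∀ {a p} {A : Set a} (P : A → Set p) (xs : List A) →
             Σ[ ys ∈ List A ] ((∀ {x} → x ∈ ys → P x) × (∀ {x} → x ∈ xs → P x → x ∈ ys))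
    select P []       = [] , (λ ()) , λ ()
    select P (x ∷ xs) with select P xs | em {P = P x}
    ... | ys , sat , keep | yes Px = x ∷ ys , (λ { (here refl) → Px ; (there y∈) → sat y∈ }) ,
                                     λ { (here refl) _ → here refl ; (there y∈) Py → there (keep y∈ Py) }
    ... | ys , sat , keep | no ¬Px = ys , sat , λ { (here refl) Px → ⊥-elim (¬Px Px) ; (there y∈) Py → keep y∈ Py }

    witnesses : ∀ {a b p q} {A : Set a} {B : Set b} (R : A → B → Set p) (P : B → Set q) →
                (∀ x → Σ[ ys ∈ List B ] ((∀ {y} → y ∈ ys → P y) × (∀ {y} → P y → R x y → y ∈ ys))) →
                ∀ xs → Σ[ ys ∈ List B ] ((∀ {y} → y ∈ ys → P y) ×
                  (∀ {x y} → x ∈ xs → P y → R x y → y ∈ ys))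
    witnesses R P each []       = [] , (λ ()) , λ ()
    witnesses R P each (x ∷ xs) with each x | witnesses R P each xs
    ... | ys , ok , all | zs , ok′ , all′ = ys ++ zs , ok″ , λ where
        (here refl) Py r → ∈-++⁺ˡ (all Py r)
        (there x∈)  Py r → ∈-++⁺ʳ ys (all′ x∈ Py r)
      where
      ok″ : ∀ {y} → y ∈ ys ++ zs → P y
      ok″ y∈ with ∈-++⁻ ys y∈
      ... | inj₁ y∈ys = ok y∈ys
      ... | inj₂ y∈zs = ok′ y∈zs

  module TowerFinite (em : ∀ {a} → ExcludedMiddle a) (ac : AxiomOfChoice) {ℓ : Level}
    (T : WellOrder ℓ) (T-unbounded : ∀ p → ∃[ q ] WellOrder._<_ T p q) (t₀ : WellOrder.Carrier T)
    (Λ : Set ℓ) {n : ℕ} (op : Fin n → Λ → Λ → Λ → Λ)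
    (B : Involutions ℓ) (B-bounded : ∀ gs → Involutions.BoundedOrbits B gs)
    (code : Tower.Gen em ac T Λ op B → Λ) (code-injective : ∀ {g h} → code g ≡ code h → g ≡ h) where

    open LEM em
    open Selection em
    open Swapping em
    open Toggle em ac T Λ op
    open Tower em ac T Λ op B
    open Action code code-injective
    private
      module T = WellOrder T
      module B = Involutions B
      module E = Involutions toggles
    open Involutions tower using (run; Over; BoundedOrbits; FinitelyManyWords; bounded⇒finite; bounded-⊆)

    run-coord : ∀ {r gs} → (∀ {g} → g ∈ gs → Below r g) → ∀ {w} → Over gs w → ∀ ω → coord r (run w ω) ≡ coord r ω
    run-coord b []                ω = refl
    run-coord b (_∷_ {x = g} g∈ o) ω = trans (coord-act g (b g∈) _) (run-coord b o ω)

    AtMost : T.Carrier → Gen → Set ℓ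
    AtMost q g = Below q g ⊎ (∃[ l ] g ≡ lev q l)

    opaque
      -- A closed set at level q is a product of a set `X` of coordinates and a set `L` of points
      -- whose coordinate is reset. Level generators move `X`. `L` is moved by lower generators
      -- where the coordinate is neutral, and by `copy↓` through the generators whose places occur
      -- in `X`.
      closure : ∀ q gs → (∀ {g} → g ∈ gs → AtMost q g) → ∀ X L →
        (∀ {ω} → ω ∈ L → coord q ω ≡ just origin × NeutralAbove q ω) →
        (∀ {l x} → lev q l ∈ gs → x ∈ X → permute l x ∈ X) →
        (∀ {g x ω} → g ∈ gs → Below q g → x ∈ X → Neutral x → ω ∈ L → act g ω ∈ L) →
        (∀ {g ω} → Below q g → place g ∈ X → ω ∈ L → act g ω ∈ L) →
        ∀ {g y} → g ∈ gs → y ∈ cartesianProductWith (set q) X L → act g y ∈ cartesianProductWith (set q) X L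
      closure q gs most X L h₁ h₂ h₃ h₄ {g} g∈ y∈ with ∈-cartesianProductWith⁻ (set q) X L y∈
      ... | x , ω , x∈ , ω∈ , refl = go g g∈ (most g∈)
        where
        ys : List Ω
        ys = cartesianProductWith (set q) X L
        add : ∀ {x ω} → x ∈ X → ω ∈ L → set q x ω ∈ ys
        add = ∈-cartesianProductWith⁺ (set q)
        n-ω : Neutral (coord q ω)
        n-ω = subst Neutral (sym (proj₁ (h₁ ω∈))) at-origin
        above : NeutralAbove q (set q x ω)
        above = neutral-set-at x (proj₂ (h₁ ω∈))
        go : ∀ g → g ∈ gs → AtMost q g → act g (set q x ω) ∈ ys
        go g g∈ (inj₁ b) with em {P = Neutral x}
        ... | yes nx = subst (_∈ ys) (sym (act-set g b ω nx n-ω)) (add x∈ (h₃ g∈ b x∈ nx ω∈))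
        ... | no ¬nx = subst (_∈ ys) (sym (act-above-idle g b _ (¬nx ∘ subst Neutral (coord-set q x ω)))) (add x∈ ω∈)
        go .(lev q l) g∈ (inj₂ (l , refl)) = view (actView q l (set q x ω)) g∈
          where
          view : ∀ {l ω′} → ActView q (set q x ω) l ω′ → lev q l ∈ gs → ω′ ∈ ys
          view (idle ¬h) _ = ⊥-elim (¬h above)
          view (permutes {l} l≢ _) l∈ = subst (_∈ ys)
            (sym (trans (cong (λ z → set q (permute l z) (set q x ω)) (coord-set q x ω)) (set-set q _ x ω)))
            (add (h₂ l∈ x∈) ω∈)
          view (copies g _ b e) _ = subst (_∈ ys)
            (cong₂ (λ z ω′ → set q z (act g ω′)) x≡ (sym (trans (set-set q _ x ω) (set-coord ω (proj₁ (h₁ ω∈))))))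
            (add x∈ (h₄ b (subst (_∈ X) x≡ x∈) ω∈))
            where
            x≡ : x ≡ place g
            x≡ = trans (sym (coord-set q x ω)) e
          view (vacant _ _) _ = add x∈ ω∈

    copy-end : ∀ m d → copy m end end d ≡ 𝟎
    copy-end m d = D-ext λ s w → trans (val-copy m end end d s w)
      (trans (cong (_∧ val d end (m w)) (gate-no λ ())) (sym (val-𝟎 s w)))

    -- The summand u lives in row `end` only: toggles reading lower rows do not see it, and toggles
    -- at `end` have no row to write to.
    act-⊕ : ∀ g d {u} → Vanishes top u → E.act g (d ⊕ u) ≡ E.act g d ⊕ u
    act-⊕ (end , m) d {u} _ = trans (cong ((d ⊕ u) ⊕_) (copy-end (move m) _))
      (trans (⊕-𝟎 (d ⊕ u)) (cong (_⊕ u) (sym (trans (cong (d ⊕_) (copy-end (move m) d)) (⊕-𝟎 d)))))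
    act-⊕ (bot , m) d {u} h = toggle-⊕ (move m) d u (vanishes-⊑ {d = u} (λ ()) h)
    act-⊕ (mid p , m) d {u} h = toggle-⊕ (move m) d u (vanishes-⊑ {d = u} (λ ()) h)
    act-⊕ (top , m) d {u} h = toggle-⊕ (move m) d u h

    run-⊕ : ∀ w d {u} → Vanishes top u → E.run w (d ⊕ u) ≡ E.run w d ⊕ u
    run-⊕ []      d h = refl
    run-⊕ (g ∷ w) d {u} h = trans (cong (E.act g) (run-⊕ w d h)) (act-⊕ g (E.run w d) h)

    spot : Gen → D
    spot g = copy (code g ∷_) bot top origin

    spot-vanishes : ∀ g → Vanishes top (spot g)
    spot-vanishes g = copy-vanishes (code g ∷_) bot top origin

    bit : Gen → Gen → Bool
    bit g h = val (spot g) end (code h ∷ [])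

    bit≡ : ∀ g h → bit g h ≡ val (mark (code g)) end (code h ∷ [])
    bit≡ g h = sym (trans (val-⊕ origin (spot g) end _) (cong (_xor bit g h) (val-origin end _)))

    bit-same : ∀ g → bit g g ≡ true
    bit-same g = trans (bit≡ g g) (val-mark-same (code g))

    bit-true : ∀ {g h} → bit g h ≡ true → g ≡ h
    bit-true {g} {h} e = code-injective (val-mark-true (trans (sym (bit≡ g h)) e))

    Collision : List E.Gen → Gen → Gen → Set ℓ
    Collision w g h = g ≢ h × E.run w (mark (code g)) ≡ mark (code h)

    -- The right-hand side involves neither g nor h, so the word alone determines the sum of the two
    -- spots.
    collision-sum : ∀ {w g h} → Collision w g h → spot g ⊕ spot h ≡ E.run w origin ⊕ origin
    collision-sum {w} {g} {h} (_ , e) = begin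
      spot g ⊕ spot h                               ≡⟨ ⊕-cancel (r ⊕ origin) _ ⟨
      (r ⊕ origin) ⊕ ((r ⊕ origin) ⊕ (spot g ⊕ spot h))  ≡⟨ cong ((r ⊕ origin) ⊕_) zero-sum ⟩
      (r ⊕ origin) ⊕ 𝟎                              ≡⟨ ⊕-𝟎 _ ⟩
      r ⊕ origin                                    ∎
      where
      open ≡-Reasoning
      r = E.run w origin
      e′ : r ⊕ spot g ≡ origin ⊕ spot h
      e′ = trans (sym (run-⊕ w origin (spot-vanishes g))) e
      zero-sum : (r ⊕ origin) ⊕ (spot g ⊕ spot h) ≡ 𝟎
      zero-sum = begin
        (r ⊕ origin) ⊕ (spot g ⊕ spot h)   ≡⟨ ⊕-assoc r origin _ ⟩
        r ⊕ (origin ⊕ (spot g ⊕ spot h))   ≡⟨ cong (r ⊕_) (⊕-swap origin (spot g) (spot h)) ⟩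
        r ⊕ (spot g ⊕ (origin ⊕ spot h))   ≡⟨ ⊕-assoc r (spot g) _ ⟨
        (r ⊕ spot g) ⊕ (origin ⊕ spot h)   ≡⟨ cong (_⊕ (origin ⊕ spot h)) e′ ⟩
        (origin ⊕ spot h) ⊕ (origin ⊕ spot h)  ≡⟨ ⊕-same _ ⟩
        𝟎                                  ∎

    -- A word moves at most one pair of marks to each other, because it moves all of them by the same amount.
    collision-unique : ∀ {w g h g′ h′} → Collision w g h → Collision w g′ h′ →
                       (g′ ≡ g ⊎ g′ ≡ h) × (h′ ≡ g ⊎ h′ ≡ h)
    collision-unique {w} {g} {h} {g′} {h′} c c′@(g′≢h′ , _) = pick g′ odd-g′ , pick h′ odd-h′
      where
      sums≡ : spot g ⊕ spot h ≡ spot g′ ⊕ spot h′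
      sums≡ = trans (collision-sum {w} c) (sym (collision-sum {w} c′))
      not-true : ∀ {g h} → g ≢ h → bit g h ≡ false
      not-true {g} {h} g≢h with bit g h in eq
      ... | false = refl
      ... | true  = ⊥-elim (g≢h (bit-true eq))
      bits : ∀ k → bit g k xor bit h k ≡ bit g′ k xor bit h′ k
      bits k = trans (sym (val-⊕ (spot g) (spot h) end _))
        (trans (cong (λ d → val d end (code k ∷ [])) sums≡) (val-⊕ (spot g′) (spot h′) end _))
      odd-g′ : bit g g′ xor bit h g′ ≡ true
      odd-g′ = trans (bits g′) (cong₂ _xor_ (bit-same g′) (not-true (g′≢h′ ∘ sym)))
      odd-h′ : bit g h′ xor bit h h′ ≡ true
      odd-h′ = trans (bits h′) (cong₂ _xor_ (not-true g′≢h′) (bit-same h′))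
      pick : ∀ k → bit g k xor bit h k ≡ true → k ≡ g ⊎ k ≡ h
      pick k odd with bit g k in eq
      ... | true  = inj₁ (sym (bit-true eq))
      ... | false = inj₂ (sym (bit-true odd))

    togglesIn : List Gen → List E.Gen
    togglesIn []                     = []
    togglesIn (lev _ (flip g) ∷ gs)  = g ∷ togglesIn gs
    togglesIn (lev _ (carry g) ∷ gs) = g ∷ togglesIn gs
    togglesIn (lev _ star ∷ gs)      = togglesIn gs
    togglesIn (lev _ copy↓ ∷ gs)     = togglesIn gs
    togglesIn (base _ ∷ gs)          = togglesIn gs

    flip∈ : ∀ {q g gs} → lev q (flip g) ∈ gs → g ∈ togglesIn gs
    flip∈ (here refl) = here refl
    flip∈ {gs = lev _ (flip _) ∷ _}  (there h) = there (flip∈ h)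
    flip∈ {gs = lev _ (carry _) ∷ _} (there h) = there (flip∈ h)
    flip∈ {gs = lev _ star ∷ _}      (there h) = flip∈ h
    flip∈ {gs = lev _ copy↓ ∷ _}     (there h) = flip∈ h
    flip∈ {gs = base _ ∷ _}          (there h) = flip∈ h

    carry∈ : ∀ {q g gs} → lev q (carry g) ∈ gs → g ∈ togglesIn gs
    carry∈ (here refl) = here refl
    carry∈ {gs = lev _ (flip _) ∷ _}  (there h) = there (carry∈ h)
    carry∈ {gs = lev _ (carry _) ∷ _} (there h) = there (carry∈ h)
    carry∈ {gs = lev _ star ∷ _}      (there h) = carry∈ h
    carry∈ {gs = lev _ copy↓ ∷ _}     (there h) = carry∈ h
    carry∈ {gs = base _ ∷ _}          (there h) = carry∈ h

    module Step (q : T.Carrier) (finite-below : ∀ gs → (∀ {g} → g ∈ gs → Below q g) → FinitelyManyWords gs)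
                (gs : List Gen) (most : ∀ {g} → g ∈ gs → AtMost q g) where

      es : List E.Gen
      es = togglesIn gs

      opaque
        words : List (List E.Gen)
        words = proj₁ (toggles-finite es)

        words-over : ∀ {w} → w ∈ words → E.Over es w
        words-over = proj₁ (proj₂ (toggles-finite es))

        represent : ∀ {v} → E.Over es v → ∃[ w ] (w ∈ words × (∀ d → E.run v d ≡ E.run w d))
        represent = proj₂ (proj₂ (toggles-finite es))

      orbit : D → List Coord
      orbit d = map (λ w → just (E.run w d)) words

      orbit-run : ∀ {v} d → E.Over es v → just (E.run v d) ∈ orbit d
      orbit-run d o = let w , w∈ , e = represent o in
        subst (_∈ orbit d) (cong just (sym (e d))) (∈-map⁺ (λ w → just (E.run w d)) w∈)

      points : List D
      points = origin ∷ map (λ g → E.act g origin) es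

      -- Contains the toggle orbit of every coordinate that a transposition in `gs` can touch, and
      -- both neutral values. Outside this list only `flip` moves a coordinate.
      special : List Coord
      special = nothing ∷ cartesianProductWith (λ w d → just (E.run w d)) words points

      special-run : ∀ {v d} → E.Over es v → d ∈ points → just (E.run v d) ∈ special
      special-run {d = d} o d∈ = let w , w∈ , e = represent o in
        there (subst (_∈ cartesianProductWith (λ w d → just (E.run w d)) words points) (cong just (sym (e d))) (∈-cartesianProductWith⁺ (λ w d → just (E.run w d)) w∈ d∈))

      point-special : ∀ {d} → d ∈ points → just d ∈ special
      point-special d∈ = special-run [] d∈

      carried∈ : ∀ {g} → lev q (carry g) ∈ gs → E.act g origin ∈ points
      carried∈ c∈ = there (∈-map⁺ (λ g → E.act g origin) (carry∈ c∈))

      swap-closed : ∀ {X : List Coord} {x y z} → x ∈ X → y ∈ X → z ∈ X → swap x y z ∈ X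
      swap-closed {X} {x} {y} {z} x∈ y∈ z∈ with swap-cases x y z
      ... | inj₁ e        = subst (_∈ X) (sym e) x∈
      ... | inj₂ (inj₁ e) = subst (_∈ X) (sym e) y∈
      ... | inj₂ (inj₂ e) = subst (_∈ X) (sym e) z∈

      special-closed : ∀ {l x} → lev q l ∈ gs → x ∈ special → permute l x ∈ special
      special-closed {flip g} l∈ (here refl) = here refl
      special-closed {flip g} l∈ (there x∈) with ∈-cartesianProductWith⁻ (λ w d → just (E.run w d)) words points x∈
      ... | w , d , w∈ , d∈ , refl = special-run (flip∈ l∈ ∷ words-over w∈) d∈
      special-closed {carry g} l∈ x∈ = swap-closed (point-special (here refl)) (point-special (carried∈ l∈)) x∈
      special-closed {star} l∈ x∈    = swap-closed (point-special (here refl)) (here refl) x∈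
      special-closed {copy↓} l∈ x∈   = x∈

      meets-special : ∀ {d p x} → x ∈ orbit d → x ≡ just p → p ∈ points → just d ∈ special
      meets-special {d} {p} x∈ e p∈ with ∈-map⁻ (λ w → just (E.run w d)) x∈
      ... | w , w∈ , refl = subst (λ d → just d ∈ special)
            (trans (cong (E.run (reverse w)) (sym (just-injective e))) (E.run-reverse w d))
            (special-run (E.over-reverse w (words-over w∈)) p∈)

      orbit-not-nothing : ∀ {d} → ¬ (nothing ∈ orbit d)
      orbit-not-nothing {d} n∈ with ∈-map⁻ (λ w → just (E.run w d)) n∈
      ... | _ , _ , ()

      orbit-closed : ∀ {d} → ¬ (just d ∈ special) → ∀ {l x} → lev q l ∈ gs → x ∈ orbit d → permute l x ∈ orbit d
      orbit-closed {d} ¬s {flip g} l∈ x∈ with ∈-map⁻ (λ w → just (E.run w d)) x∈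
      ... | w , w∈ , refl = orbit-run d (flip∈ l∈ ∷ words-over w∈)
      orbit-closed {d} ¬s {carry g} l∈ x∈ = subst (_∈ orbit d) (sym (swap-other
        (λ e → ¬s (meets-special x∈ e (here refl))) (λ e → ¬s (meets-special x∈ e (carried∈ l∈))))) x∈
      orbit-closed {d} ¬s {star} l∈ x∈ = subst (_∈ orbit d) (sym (swap-other
        (λ e → ¬s (meets-special x∈ e (here refl))) (λ { refl → orbit-not-nothing x∈ }))) x∈
      orbit-closed ¬s {copy↓} l∈ x∈ = x∈

      orbit-not-neutral : ∀ {d} → ¬ (just d ∈ special) → ∀ {x} → x ∈ orbit d → ¬ Neutral x
      orbit-not-neutral ¬s x∈ at-origin = ¬s (meets-special x∈ refl (here refl))
      orbit-not-neutral ¬s x∈ at-star   = orbit-not-nothing x∈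

      opaque
        occupants : Σ[ hs ∈ List Gen ] ((∀ {g} → g ∈ hs → Below q g) ×
                      (∀ {x g} → x ∈ special → Below q g → x ≡ place g → g ∈ hs))
        occupants = witnesses (λ x g → x ≡ place g) (Below q) each special
          where
          each : ∀ x → Σ[ hs ∈ List Gen ] ((∀ {g} → g ∈ hs → Below q g) × (∀ {g} → Below q g → x ≡ place g → g ∈ hs))
          each x with em {P = Occupied q x}
          ... | no none       = [] , (λ ()) , λ {g} b e → ⊥-elim (none (g , b , e))
          ... | yes (h , b , e) = h ∷ [] , (λ { (here refl) → b }) ,
                                  λ b′ e′ → here (place-injective (trans (sym e′) e))

        -- Each of the finitely many words contributes at most the two members of its only possible
        -- pair.
        colliders : Σ[ hs ∈ List Gen ] ((∀ {g} → g ∈ hs → Below q g) ×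
                      (∀ {w g} → w ∈ words → Below q g → ∃[ h ] (Below q h × Collision w g h) → g ∈ hs))
        colliders = witnesses (λ w g → ∃[ h ] (Below q h × Collision w g h)) (Below q) each words
          where
          each : ∀ w → Σ[ hs ∈ List Gen ] ((∀ {g} → g ∈ hs → Below q g) ×
                   (∀ {g} → Below q g → ∃[ h ] (Below q h × Collision w g h) → g ∈ hs))
          each w with em {P = ∃[ g ] ∃[ h ] (Below q g × Below q h × Collision w g h)}
          ... | no none = [] , (λ ()) , λ {g} b (h , b′ , c) → ⊥-elim (none (g , h , b , b′ , c))
          ... | yes (g , h , b , b′ , c) = g ∷ h ∷ [] , (λ { (here refl) → b ; (there (here refl)) → b′ }) , find
            where
            find : ∀ {g′} → Below q g′ → ∃[ h′ ] (Below q h′ × Collision w g′ h′) → g′ ∈ g ∷ h ∷ []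
            find _ (h′ , _ , c′) with proj₁ (collision-unique {w} c c′)
            ... | inj₁ e = here e
            ... | inj₂ e = there (here e)

      exceptional : List Gen
      exceptional = proj₁ occupants ++ proj₁ colliders

      opaque
        lowers : Σ[ hs ∈ List Gen ] ((∀ {g} → g ∈ hs → Below q g) × (∀ {g} → g ∈ gs → Below q g → g ∈ hs))
        lowers = select (Below q) gs

      low : List Gen
      low = proj₁ lowers ++ exceptional

      low-below : ∀ {g} → g ∈ low → Below q g
      low-below g∈ with ∈-++⁻ (proj₁ lowers) g∈
      ... | inj₁ h = proj₁ (proj₂ lowers) h
      ... | inj₂ h with ∈-++⁻ (proj₁ occupants) h
      ...   | inj₁ k = proj₁ (proj₂ occupants) k
      ...   | inj₂ k = proj₁ (proj₂ colliders) k

      lower∈low : ∀ {g} → g ∈ gs → Below q g → g ∈ low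
      lower∈low g∈ b = ∈-++⁺ˡ (proj₂ (proj₂ lowers) g∈ b)

      exceptional∈low : ∀ {g} → g ∈ exceptional → g ∈ low
      exceptional∈low = ∈-++⁺ʳ (proj₁ lowers)

      opaque
        low-words : FinitelyManyWords low
        low-words = finite-below low low-below

      module _ (ω : Ω) (above : NeutralAbove q ω) where

        ω° : Ω
        ω° = set q (just origin) ω

        above° : NeutralAbove q ω°
        above° = neutral-set-at (just origin) above

        neutral-run : ∀ {w} → Over low w → coord q (run w ω°) ≡ just origin × NeutralAbove q (run w ω°)
        neutral-run o = trans (run-coord low-below o ω°) (coord-set q _ ω) ,
          λ r q<r → subst Neutral (sym (run-coord (λ {g} g∈ → below-mono g (low-below g∈) q<r) o ω°)) (above° r q<r)

        fibre : List Ω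
        fibre = map (λ w → run w ω°) (proj₁ low-words)

        fibre-run : ∀ {v} → Over low v → run v ω° ∈ fibre
        fibre-run o = let w , w∈ , e = proj₂ (proj₂ low-words) o in
          subst (_∈ fibre) (sym (e ω°)) (∈-map⁺ (λ w → run w ω°) w∈)

        fibre-neutral : ∀ {ω′} → ω′ ∈ fibre → coord q ω′ ≡ just origin × NeutralAbove q ω′
        fibre-neutral ω∈ with ∈-map⁻ (λ w → run w ω°) ω∈
        ... | w , w∈ , refl = neutral-run (proj₁ (proj₂ low-words) w∈)

        fibre-closed : ∀ {g ω′} → g ∈ low → ω′ ∈ fibre → act g ω′ ∈ fibre
        fibre-closed g∈ ω∈ with ∈-map⁻ (λ w → run w ω°) ω∈
        ... | w , w∈ , refl = fibre-run (g∈ ∷ proj₁ (proj₂ low-words) w∈)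

        restore : set q (coord q ω) ω° ≡ ω
        restore = trans (set-set q _ _ ω) (set-coord ω refl)

        Frame : ℕ → Set ℓ
        Frame N = Σ[ ys ∈ List Ω ] (length ys ℕ.≤ N × ω ∈ ys × (∀ {g y} → g ∈ gs → y ∈ ys → act g y ∈ ys))

        frame : ∀ X L → coord q ω ∈ X → ω° ∈ L →
          (∀ {ω} → ω ∈ L → coord q ω ≡ just origin × NeutralAbove q ω) →
          (∀ {l x} → lev q l ∈ gs → x ∈ X → permute l x ∈ X) →
          (∀ {g x ω} → g ∈ gs → Below q g → x ∈ X → Neutral x → ω ∈ L → act g ω ∈ L) →
          (∀ {g ω} → Below q g → place g ∈ X → ω ∈ L → act g ω ∈ L) →
          Frame (length X ℕ.* length L)
        frame X L x∈ ω∈ h₁ h₂ h₃ h₄ = cartesianProductWith (set q) X L ,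
          ℕₚ.≤-reflexive (length-cartesianProductWith (set q) X L) ,
          subst (_∈ cartesianProductWith (set q) X L) restore (∈-cartesianProductWith⁺ (set q) x∈ ω∈) ,
          closure q gs most X L h₁ h₂ h₃ h₄

        weaken : ∀ {M N} → M ℕ.≤ N → Frame M → Frame N
        weaken M≤N (ys , len , rest) = ys , ℕₚ.≤-trans len M≤N , rest

        -- The generators placed at special coordinates are finitely many and belong to `low`, so
        -- the lower part stays in one orbit of `low`.
        special-frame : coord q ω ∈ special → Frame (length special ℕ.* length fibre)
        special-frame x∈ = frame special fibre x∈ (fibre-run []) fibre-neutral special-closed
          (λ g∈ b _ _ → fibre-closed (lower∈low g∈ b))
          (λ b p∈ → fibre-closed (exceptional∈low (∈-++⁺ˡ (proj₂ (proj₂ occupants) p∈ b refl))))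

        module _ {d : D} (coord≡ : coord q ω ≡ just d) (¬s : ¬ (just d ∈ special)) where

          d∈ : coord q ω ∈ orbit d
          d∈ = subst (_∈ orbit d) (sym coord≡) (orbit-run d [])

          crowded-frame : (∀ {g} → Below q g → place g ∈ orbit d → g ∈ exceptional) →
                          Frame (length (orbit d) ℕ.* length fibre)
          crowded-frame h = frame (orbit d) fibre d∈ (fibre-run []) fibre-neutral (orbit-closed ¬s)
            (λ _ _ x∈ nx → ⊥-elim (orbit-not-neutral ¬s x∈ nx))
            (λ b p∈ → fibre-closed (exceptional∈low (h b p∈)))

          -- Going from the place of g back to d and on to the place of h is a word that carries one
          -- mark to another; unless h is g, this makes g a collider.
          same-occupant : ∀ {g h} → Below q g → Below q h → place g ∈ orbit d → place h ∈ orbit d →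
                          ¬ (g ∈ exceptional) → h ≡ g
          same-occupant {g} {h} bg bh g∈ h∈ g∉ = byContra λ h≢g → g∉ (∈-++⁺ʳ (proj₁ occupants) (collide h≢g))
            where
            collide : h ≢ g → g ∈ proj₁ colliders
            collide h≢g with ∈-map⁻ (λ w → just (E.run w d)) g∈ | ∈-map⁻ (λ w → just (E.run w d)) h∈
            ... | v , v∈ , e | w , w∈ , f with represent (Allₚ.++⁺ (words-over w∈) (E.over-reverse v (words-over v∈)))
            ...   | u , u∈ , k = proj₂ (proj₂ colliders) u∈ bg (h , bh , h≢g ∘ sym , (begin
                E.run u (mark (code g))                  ≡⟨ k _ ⟨
                E.run (w ++ reverse v) (mark (code g))   ≡⟨ E.run-++ w (reverse v) _ ⟩
                E.run w (E.run (reverse v) (mark (code g)))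
                  ≡⟨ cong (λ z → E.run w (E.run (reverse v) z)) (just-injective e) ⟩
                E.run w (E.run (reverse v) (E.run v d))  ≡⟨ cong (E.run w) (E.run-reverse v d) ⟩
                E.run w d                                ≡⟨ just-injective f ⟨
                mark (code h)                            ∎))
              where open ≡-Reasoning

          -- No neutral coordinate occurs in the orbit and g is the only generator placed there, so
          -- the lower part has just two positions. As g varies with d, adding it to `low` would not
          -- give a uniform bound.
          lonely-frame : ∀ {g} → Below q g → place g ∈ orbit d → ¬ (g ∈ exceptional) →
                         Frame (length (orbit d) ℕ.* 2)
          lonely-frame {g} b g∈ g∉ = frame (orbit d) (ω° ∷ act g ω° ∷ []) d∈ (here refl)
            (λ { (here refl) → coord-set q _ ω , above°
               ; (there (here refl)) → trans (coord-act g b ω°) (coord-set q _ ω) ,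
                   λ r q<r → subst Neutral (sym (coord-act g (below-mono g b q<r) ω°)) (above° r q<r) })
            (orbit-closed ¬s)
            (λ _ _ x∈ nx → ⊥-elim (orbit-not-neutral ¬s x∈ nx))
            closed
            where
            closed : ∀ {h ω′} → Below q h → place h ∈ orbit d → ω′ ∈ ω° ∷ act g ω° ∷ [] → act h ω′ ∈ ω° ∷ act g ω° ∷ []
            closed bh h∈ ω∈ with same-occupant b bh g∈ h∈ g∉
            closed bh h∈ (here refl)         | refl = there (here refl)
            closed bh h∈ (there (here refl)) | refl = here (act-involutive g ω°)

      opaque
        bound : ℕ
        -- Coordinates come from `special` or from an orbit listed by `words`; lower parts come from
        -- the words over `low` or are the 2 positions of a lonely orbit.
        bound = (length special ℕ.+ length words) ℕ.* (length (proj₁ low-words) ℕ.+ 2)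

        bound-≤ : ∀ {x y} → x ℕ.≤ length special ℕ.+ length words → y ℕ.≤ length (proj₁ low-words) ℕ.+ 2 →
                  x ℕ.* y ℕ.≤ bound
        bound-≤ = ℕₚ.*-mono-≤

      length-special : length special ℕ.≤ length special ℕ.+ length words
      length-special = ℕₚ.m≤m+n (length special) (length words)

      length-orbit : ∀ d → length (orbit d) ℕ.≤ length special ℕ.+ length words
      length-orbit d = subst (ℕ._≤ length special ℕ.+ length words)
        (sym (length-map (λ w → just (E.run w d)) words)) (ℕₚ.m≤n+m (length words) (length special))

      length-fibre : ∀ ω above → length (fibre ω above) ℕ.≤ length (proj₁ low-words) ℕ.+ 2
      length-fibre ω above = subst (ℕ._≤ length (proj₁ low-words) ℕ.+ 2)
        (sym (length-map (λ w → run w (ω° ω above)) (proj₁ low-words))) (ℕₚ.m≤m+n (length (proj₁ low-words)) 2)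

      opaque
        ordinary : ∀ ω (above : NeutralAbove q ω) {d} → coord q ω ≡ just d → ¬ (just d ∈ special) → Frame ω above bound
        ordinary ω above {d} e ¬s with em {P = ∃[ g ] (Below q g × place g ∈ orbit d × ¬ (g ∈ exceptional))}
        ... | yes (g , b , g∈ , g∉) = weaken ω above (bound-≤ (length-orbit d) (ℕₚ.m≤n+m 2 (length (proj₁ low-words))))
                (lonely-frame ω above e ¬s b g∈ g∉)
        ... | no none = weaken ω above (bound-≤ (length-orbit d) (length-fibre ω above))
                (crowded-frame ω above e ¬s λ {g} b g∈ → byContra λ g∉ → none (g , b , g∈ , g∉))

        orbits-above : ∀ ω (above : NeutralAbove q ω) → Frame ω above bound
        orbits-above ω above = by-cases (coord q ω) refl em
          where
          by-cases : ∀ x → coord q ω ≡ x → Dec (x ∈ special) → Frame ω above bound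
          by-cases x e (yes x∈) = weaken ω above (bound-≤ length-special (length-fibre ω above))
            (special-frame ω above (subst (_∈ special) (sym e) x∈))
          by-cases nothing  e (no ¬s) = ⊥-elim (¬s (here refl))
          by-cases (just d) e (no ¬s) = ordinary ω above e ¬s

      idle-above : ∀ {ω} → ¬ NeutralAbove q ω → ∀ {g} → AtMost q g → act g ω ≡ ω
      idle-above ¬h {g} (inj₂ (l , refl)) = act-idle l _ ¬h
      idle-above {ω} ¬h {g} (inj₁ b) with ¬∀⇒∃¬′ {P = q T.<_} {Q = λ r → Neutral (coord r ω)} (λ h → ¬h h)
      ... | r , q<r , ¬n = act-above-idle g (below-mono g b q<r) ω ¬n

      bounded : BoundedOrbits gs
      -- The extra 1 is for points with a non-neutral higher coordinate, which are fixed by all of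
      -- `gs`.
      bounded = bound ℕ.+ 1 , λ ω → by-guard ω em
        where
        by-guard : ∀ ω → Dec (NeutralAbove q ω) → Σ[ xs ∈ List Ω ] (length xs ℕ.≤ bound ℕ.+ 1 × ω ∈ xs ×
                     (∀ {g x} → g ∈ gs → x ∈ xs → act g x ∈ xs))
        by-guard ω (yes above) = weaken ω above (ℕₚ.m≤m+n bound 1) (orbits-above ω above)
        by-guard ω (no ¬h) = ω ∷ [] , ℕₚ.m≤n+m 1 bound , here refl ,
                             λ { g∈ (here refl) → here (idle-above ¬h (most g∈)) }

    base-bounded : ∀ gs → (∀ {g} → g ∈ gs → ∃[ c ] g ≡ base c) → BoundedOrbits gs
    base-bounded gs all-base = N ℕ.+ 1 , λ ω → by-guard ω em
      where
      bases : ∀ gs → (∀ {g} → g ∈ gs → ∃[ c ] g ≡ base c) → Σ[ cs ∈ List B.Gen ] (∀ {c} → base c ∈ gs → c ∈ cs)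
      bases []       _ = [] , λ ()
      bases (g ∷ gs) h with h (here refl) | bases gs (h ∘ there)
      ... | c , refl | cs , sub = c ∷ cs , λ { (here refl) → here refl ; (there c∈) → there (sub c∈) }
      cs = proj₁ (bases gs all-base)
      N = proj₁ (B-bounded cs)
      by-guard : ∀ ω → Dec (∀ r → Neutral (coord r ω)) → Σ[ xs ∈ List Ω ] (length xs ℕ.≤ N ℕ.+ 1 × ω ∈ xs ×
                   (∀ {g x} → g ∈ gs → x ∈ xs → act g x ∈ xs))
      by-guard ω (no ¬h) = ω ∷ [] , ℕₚ.m≤n+m 1 N , here refl , λ { {g} g∈ (here refl) → here (base-idle g (all-base g∈)) }
        where
        base-idle : ∀ g → ∃[ c ] g ≡ base c → act g ω ≡ ω
        base-idle _ (c , refl) = act-base-idle c ω ¬h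
      by-guard ω (yes h) with proj₂ (B-bounded cs) (ground ω)
      ... | bs , len , b∈ , closed = map at bs ,
              ℕₚ.≤-trans (ℕₚ.≤-reflexive (length-map at bs)) (ℕₚ.≤-trans len (ℕₚ.m≤m+n N 1)) ,
              subst (_∈ map at bs) at-ground (∈-map⁺ at b∈) ,
              λ g∈ x∈ → step g∈ (all-base g∈) x∈
        where
        at : B.Ω → Ω
        at b = setBase b ω
        at-ground : at (ground ω) ≡ ω
        at-ground = Ω-ext (ground-setBase _ ω) λ r → coord-setBase r _ ω
        at-neutral : ∀ b r → Neutral (coord r (at b))
        at-neutral b r = subst Neutral (sym (coord-setBase r b ω)) (h r)
        at-act : ∀ c b → act (base c) (at b) ≡ at (B.act c b)
        at-act c b = trans (act-base c (at b) (at-neutral b)) (Ω-ext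
          (trans (ground-setBase _ _) (trans (cong (B.act c) (ground-setBase b ω)) (sym (ground-setBase _ ω))))
          λ r → trans (coord-setBase r _ _) (trans (coord-setBase r b ω) (sym (coord-setBase r _ ω))))
        step : ∀ {g x} → g ∈ gs → ∃[ c ] g ≡ base c → x ∈ map at bs → act g x ∈ map at bs
        step g∈ (c , refl) x∈ with ∈-map⁻ at x∈
        ... | b , b∈ , refl = subst (_∈ map at bs) (sym (at-act c b))
              (∈-map⁺ at (closed (proj₂ (bases gs all-base) g∈) b∈))

    data TopLevel (gs : List Gen) : Set ℓ where
      no-levels : (∀ {g} → g ∈ gs → ∃[ c ] g ≡ base c) → TopLevel gs
      top-level : ∀ q → (∃[ l ] lev q l ∈ gs) → (∀ {g} → g ∈ gs → AtMost q g) → TopLevel gs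

    atMost-mono : ∀ {p q g} → AtMost p g → p T.< q → Below q g
    atMost-mono {g = g} (inj₁ b) l   = below-mono g b l
    atMost-mono (inj₂ (_ , refl)) l = l

    topLevel : ∀ gs → TopLevel gs
    topLevel [] = no-levels λ ()
    topLevel (base c ∷ gs) with topLevel gs
    ... | no-levels h        = no-levels λ { (here refl) → c , refl ; (there g∈) → h g∈ }
    ... | top-level q (l , l∈) h = top-level q (l , there l∈) λ { (here refl) → inj₁ tt ; (there g∈) → h g∈ }
    topLevel (lev p l ∷ gs) with topLevel gs
    ... | no-levels h = top-level p (l , here refl) λ { (here refl) → inj₂ (l , refl) ; (there g∈) → inj₁ (low (h g∈)) }
      where
      low : ∀ {g} → ∃[ c ] g ≡ base c → Below p g
      low (_ , refl) = tt
    ... | top-level q (k , k∈) h with T.cmp p q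
    ...   | tri< p<q _ _  = top-level q (k , there k∈) λ { (here refl) → inj₁ p<q ; (there g∈) → h g∈ }
    ...   | tri≈ _ refl _ = top-level q (k , there k∈) λ { (here refl) → inj₂ (l , refl) ; (there g∈) → h g∈ }
    ...   | tri> _ _ q<p  = top-level p (l , here refl) λ { (here refl) → inj₂ (l , refl)
                                                         ; (there g∈) → inj₁ (atMost-mono (h g∈) q<p) }

    opaque
      -- The induction on levels must range over all lists below q, because `Step` enlarges the
      -- given list by exceptional generators.
      finite-below : ∀ q gs → (∀ {g} → g ∈ gs → Below q g) → FinitelyManyWords gs
      finite-below = All.wfRec T.wf _ (λ q → ∀ gs → (∀ {g} → g ∈ gs → Below q g) → FinitelyManyWords gs) step
        where
        step : ∀ q → (∀ {p} → p T.< q → ∀ gs → (∀ {g} → g ∈ gs → Below p g) → FinitelyManyWords gs) →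
               ∀ gs → (∀ {g} → g ∈ gs → Below q g) → FinitelyManyWords gs
        step q ih gs below with topLevel gs
        ... | no-levels h            = bounded⇒finite em gs (base-bounded gs h)
        ... | top-level p (l , l∈) h = bounded⇒finite em gs (Step.bounded p (ih (below l∈)) gs h)

      tower-finite : ∀ gs → FinitelyManyWords gs
      tower-finite gs with topLevel gs
      ... | no-levels h     = bounded⇒finite em gs (base-bounded gs h)
      ... | top-level q _ h = let r , q<r = T-unbounded q in finite-below r gs λ g∈ → atMost-mono (h g∈) q<r

-- A σ-chain of subgroups contains the whole tower in one member.

module TowerChains where

  open import Axiom.ExcludedMiddle using (ExcludedMiddle)
  open import Data.Empty using (⊥-elim)
  open import Data.Fin.Base using (Fin)
  open import Data.List.Base using (List; []; _∷_; _++_; reverse; [_])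
  open import Data.Maybe.Base as Maybe using (Maybe; just; nothing)
  open import Data.Nat.Base as ℕ using (ℕ)
  open import Data.Product using (∃-syntax; _×_; _,_; proj₁; proj₂)
  open import Data.Unit.Polymorphic.Base using (⊤; tt)
  open import Function.Base using (_∘_; id)
  open import Level using (Level)
  open import Relation.Binary.PropositionalEquality using (_≡_; _≢_; refl; sym; trans; cong; subst; module ≡-Reasoning)
  open import Relation.Nullary using (¬_; Dec; yes; no)
  open import Defs
  open WellOrders
  open Sizes
  open Stages
  open InvolutionGroups
  open Toggles
  open ToggleChains
  open Towers

  module SwapLaws (em : ∀ {a} → ExcludedMiddle a) {a : Level} {A : Set a} where
    open Swapping em {A = A}

    swap-same : ∀ x z → swap x x z ≡ z
    swap-same x z with swap-view x x z
    ... | is-left      = swap-left x x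
    ... | is-right     = swap-left x x
    ... | is-other p q = swap-other p q

    swap-conjugate : ∀ (π π′ : A → A) → (∀ x → π (π′ x) ≡ x) → (∀ x → π′ (π x) ≡ x) →
                     ∀ x y z → π (swap x y (π′ z)) ≡ swap (π x) (π y) z
    swap-conjugate π π′ ππ′ π′π x y z with swap-view (π x) (π y) z
    ... | is-left  = trans (cong (π ∘ swap x y) (π′π x)) (trans (cong π (swap-left x y)) (sym (swap-left (π x) (π y))))
    ... | is-right = trans (cong (π ∘ swap x y) (π′π y)) (trans (cong π (swap-right x y)) (sym (swap-right (π x) (π y))))
    ... | is-other p q = trans (cong π (swap-other (λ e → p (trans (sym (ππ′ z)) (cong π e)))
                                                   (λ e → q (trans (sym (ππ′ z)) (cong π e)))))
                               (trans (ππ′ z) (sym (swap-other p q)))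

    swap-triangle : ∀ {x y z} → x ≢ y → y ≢ z → x ≢ z → ∀ u → swap x y (swap y z (swap x y u)) ≡ swap x z u
    swap-triangle {x} {y} {z} x≢y y≢z x≢z u with swap-view x z u
    ... | is-left = trans (cong (swap x y ∘ swap y z) (swap-left x y)) (trans (cong (swap x y) (swap-left y z))
          (trans (swap-other (x≢z ∘ sym) (y≢z ∘ sym)) (sym (swap-left x z))))
    ... | is-right = trans (cong (swap x y ∘ swap y z) (swap-other (x≢z ∘ sym) (y≢z ∘ sym)))
          (trans (cong (swap x y) (swap-right y z)) (trans (swap-right x y) (sym (swap-right x z))))
    ... | is-other u≢x u≢z with em {P = u ≡ y}
    ...   | yes refl = trans (cong (swap x u ∘ swap u z) (swap-right x u)) (trans (cong (swap x u) (swap-other x≢y x≢z))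
            (trans (swap-left x u) (sym (swap-other u≢x u≢z))))
    ...   | no u≢y = trans (cong (swap x y ∘ swap y z) (swap-other u≢x u≢y))
            (trans (cong (swap x y) (swap-other u≢y u≢z)) (trans (swap-other u≢x u≢y) (sym (swap-other u≢x u≢z))))

  module TowerChain (em : ∀ {a} → ExcludedMiddle a) (ac : AxiomOfChoice) {ℓ : Level}
    (T : WellOrder ℓ) (T-unbounded : ∀ p → ∃[ q ] WellOrder._<_ T p q) (t₀ : WellOrder.Carrier T)
    (Λ : Set ℓ) {n : ℕ} (op : Fin n → Λ → Λ → Λ → Λ)
    (B : Involutions ℓ)
    (code : Tower.Gen em ac T Λ op B → Λ) (code-injective : ∀ {g h} → code g ≡ code h → g ≡ h)
    (σ : WellOrder ℓ) (i₀ : WellOrder.Carrier σ)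
    (no-map : ∀ {P : WellOrder.Carrier T → Set ℓ} → (∀ p → ∃[ q ] (P q × WellOrder._<_ T p q)) →
              ¬ CofinalMap σ T P)
    (indecomposable : ∀ (U : WellOrder.Carrier σ → Λ → Set ℓ) →
       (∀ {i j} → WellOrder._≤_ σ i j → ∀ {x} → U i x → U j x) →
       (∀ x → ∃[ i ] U i x) → ∀ i₁ →
       (∀ i → WellOrder._≤_ σ i₁ i → ∀ k {x y z} → U i x → U i y → U i z → U i (op k x y z)) →
       ∃[ i ] (∀ x → U i x)) where

    open LEM em
    open Exhaustion em
    open Swapping em
    open SwapLaws em
    open Toggle em ac T Λ op
    open ToggleChain em ac T T-unbounded Λ op σ i₀ t₀ no-map indecomposable using (toggle-corners)
    open Tower em ac T Λ op B
    open Action code code-injective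
    open Involutions tower using (run; run-++; _≗ᵣ_)
    private
      module T = WellOrder T
      module σ = WellOrder σ
      module E = Involutions toggles
      I = σ.Carrier

    opaque
      -- A map of one coordinate under the same guard as the generators, so that computations with
      -- permutations of coordinates transfer to the group.
      lift : T.Carrier → (Coord → Coord) → Ω → Ω
      lift q π ω = if-dec (em {P = NeutralAbove q ω}) (set q (π (coord q ω)) ω) ω

      lift-above : ∀ {q} π ω → NeutralAbove q ω → lift q π ω ≡ set q (π (coord q ω)) ω
      lift-above {q} π ω h with em {P = NeutralAbove q ω}
      ... | yes _ = refl
      ... | no ¬h = ⊥-elim (¬h h)

      lift-idle : ∀ {q} π ω → ¬ NeutralAbove q ω → lift q π ω ≡ ω
      lift-idle {q} π ω ¬h with em {P = NeutralAbove q ω}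
      ... | yes h = ⊥-elim (¬h h)
      ... | no _  = refl

      lift-cong : ∀ {q π ρ} → (∀ x → π x ≡ ρ x) → ∀ ω → lift q π ω ≡ lift q ρ ω
      lift-cong {q} h ω = cong (λ x → if-dec (em {P = NeutralAbove q ω}) (set q x ω) ω) (h (coord q ω))

    lift-∘ : ∀ {q} π ρ ω → lift q π (lift q ρ ω) ≡ lift q (π ∘ ρ) ω
    lift-∘ {q} π ρ ω with em {P = NeutralAbove q ω}
    ... | no ¬h = trans (cong (lift q π) (lift-idle ρ ω ¬h)) (trans (lift-idle π ω ¬h) (sym (lift-idle (π ∘ ρ) ω ¬h)))
    ... | yes h = begin
      lift q π (lift q ρ ω)             ≡⟨ cong (lift q π) (lift-above ρ ω h) ⟩
      lift q π (set q x ω)              ≡⟨ lift-above π _ (neutral-set-at x h) ⟩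
      set q (π (coord q (set q x ω))) (set q x ω)  ≡⟨ cong (λ y → set q (π y) (set q x ω)) (coord-set q x ω) ⟩
      set q (π x) (set q x ω)           ≡⟨ set-set q (π x) x ω ⟩
      set q (π x) ω                     ≡⟨ lift-above (π ∘ ρ) ω h ⟨
      lift q (π ∘ ρ) ω                  ∎
      where
      open ≡-Reasoning
      x = ρ (coord q ω)

    lift-fixed : ∀ {q} π ω → π (coord q ω) ≡ coord q ω → lift q π ω ≡ ω
    lift-fixed {q} π ω e with em {P = NeutralAbove q ω}
    ... | no ¬h = lift-idle π ω ¬h
    ... | yes h = trans (lift-above π ω h) (set-coord ω (sym e))

    act-lift : ∀ {q} l → l ≢ copy↓ → ∀ ω → act (lev q l) ω ≡ lift q (permute l) ω
    act-lift {q} l l≢ ω with em {P = NeutralAbove q ω}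
    ... | no ¬h = trans (act-idle l ω ¬h) (sym (lift-idle (permute l) ω ¬h))
    ... | yes h = trans (act-permute l ω l≢ h) (sym (lift-above (permute l) ω h))

    -- A τ A τ acts as g where the coordinate is origin or the place of g; conjugation by s replaces
    -- the latter by the second neutral value.
    module Recover (q : T.Carrier) (g : Gen) (below : Below q g) where

      τ s : Ω → Ω
      τ = lift q (swap (just origin) (place g))
      s = lift q (swap nothing (place g))

      A : Ω → Ω
      A = act (lev q copy↓)

      neutral-free : ∀ {x} → Neutral x → ¬ Occupied q x
      neutral-free n (h , _ , refl) = place-not-neutral n

      origin≢place : just origin ≢ place g
      origin≢place e = place-not-neutral (subst Neutral e at-origin)

      nothing≢place : nothing ≢ place g
      nothing≢place ()

      recovered : ∀ ω → s (A (τ (A (τ (s ω))))) ≡ act g ω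
      recovered ω with em {P = NeutralAbove q ω}
      ... | no ¬h = trans (cong (s ∘ A ∘ τ ∘ A ∘ τ) (lift-idle _ ω ¬h))
                      (trans (cong (s ∘ A ∘ τ ∘ A) (lift-idle _ ω ¬h))
                      (trans (cong (s ∘ A ∘ τ) (act-idle _ ω ¬h))
                      (trans (cong (s ∘ A) (lift-idle _ ω ¬h))
                      (trans (cong s (act-idle _ ω ¬h))
                      (trans (lift-idle _ ω ¬h) (sym idle-g))))))
        where
        above : ∃[ r ] (q T.< r × ¬ Neutral (coord r ω))
        above = ¬∀⇒∃¬′ λ h → ¬h h
        idle-g : act g ω ≡ ω
        idle-g = act-above-idle g (below-mono g below (proj₁ (proj₂ above))) ω (proj₂ (proj₂ above))
      ... | yes h = by-coord em em em
        where
        ω° : Ω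
        ω° = set q (just origin) ω
        ω₁ : Ω
        ω₁ = act g ω°
        coord-ω₁ : coord q ω₁ ≡ just origin
        coord-ω₁ = trans (coord-act g below ω°) (coord-set q _ ω)
        h₁ : NeutralAbove q ω₁
        h₁ r q<r = subst Neutral (sym (trans (coord-act g (below-mono g below q<r) ω°)
          (coord-set-≢ _ ω (≢-sym′ q<r)))) (h r q<r)

        τ-set : ∀ x {ω} → NeutralAbove q ω → τ (set q x ω) ≡ set q (swap (just origin) (place g) x) ω
        τ-set x {ω} h = trans (lift-above _ _ (neutral-set-at x h)) (trans
          (cong (λ y → set q (swap (just origin) (place g) y) (set q x ω)) (coord-set q x ω)) (set-set q _ x ω))
        s-set : ∀ x {ω} → NeutralAbove q ω → s (set q x ω) ≡ set q (swap nothing (place g) x) ω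
        s-set x {ω} h = trans (lift-above _ _ (neutral-set-at x h)) (trans
          (cong (λ y → set q (swap nothing (place g) y) (set q x ω)) (coord-set q x ω)) (set-set q _ x ω))
        A-place : A (set q (place g) ω) ≡ set q (place g) ω₁
        A-place = trans (act-copy _ (neutral-set-at _ h) below (coord-set q _ ω))
                        (cong (set q (place g) ∘ act g) (set-set q _ _ ω))
        A-free : ∀ x {ω} → ¬ Occupied q x → A (set q x ω) ≡ set q x ω
        A-free x {ω} ¬occ = act-copy-idle _ (¬occ ∘ subst (Occupied q) (coord-set q x ω))

        B-origin : A (τ (A (τ ω°))) ≡ set q (just origin) ω₁
        B-origin = begin
          A (τ (A (τ ω°)))                       ≡⟨ cong (A ∘ τ ∘ A) (trans (τ-set _ h) (cong (λ x → set q x ω) (swap-left _ _))) ⟩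
          A (τ (A (set q (place g) ω)))          ≡⟨ cong (A ∘ τ) A-place ⟩
          A (τ (set q (place g) ω₁))             ≡⟨ cong A (trans (τ-set _ h₁) (cong (λ x → set q x ω₁) (swap-right _ _))) ⟩
          A (set q (just origin) ω₁)             ≡⟨ A-free _ (neutral-free at-origin) ⟩
          set q (just origin) ω₁                 ∎
          where open ≡-Reasoning

        B-place : A (τ (A (τ (set q (place g) ω)))) ≡ set q (place g) ω₁
        B-place = begin
          A (τ (A (τ (set q (place g) ω))))      ≡⟨ cong (A ∘ τ ∘ A) (trans (τ-set _ h) (cong (λ x → set q x ω) (swap-right _ _))) ⟩
          A (τ (A ω°))                           ≡⟨ cong (A ∘ τ) (A-free _ (neutral-free at-origin)) ⟩
          A (τ ω°)                               ≡⟨ cong A (trans (τ-set _ h) (cong (λ x → set q x ω) (swap-left _ _))) ⟩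
          A (set q (place g) ω)                  ≡⟨ A-place ⟩
          set q (place g) ω₁                     ∎
          where open ≡-Reasoning

        B-other : coord q ω ≢ just origin → coord q ω ≢ place g → A (τ (A (τ ω))) ≡ ω
        B-other ≢o ≢p = begin
          A (τ (A (τ ω)))    ≡⟨ cong (A ∘ τ ∘ A) (lift-fixed _ ω (swap-other ≢o ≢p)) ⟩
          A (τ (A ω))        ≡⟨ cong A (lift-fixed _ (A ω) (subst (λ x → swap (just origin) (place g) x ≡ x)
                                  (sym coord-A) (swap-other ≢o ≢p))) ⟩
          A (A ω)            ≡⟨ act-involutive (lev q copy↓) ω ⟩
          ω                  ∎
          where
          open ≡-Reasoning
          coord-A : coord q (A ω) ≡ coord q ω
          coord-A = view (actView q copy↓ ω) refl
            where
            view : ∀ {l ω′} → ActView q ω l ω′ → l ≡ copy↓ → coord q ω′ ≡ coord q ω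
            view (idle _)          _ = refl
            view (permutes l≢ _)   e = ⊥-elim (l≢ e)
            view (copies h _ _ e′) _ = trans (coord-set q _ _) (sym e′)
            view (vacant _ _)      _ = refl

        by-coord : Dec (coord q ω ≡ just origin) → Dec (coord q ω ≡ nothing) → Dec (coord q ω ≡ place g) →
                   s (A (τ (A (τ (s ω))))) ≡ act g ω
        by-coord (yes e) _ _ = begin
          s (A (τ (A (τ (s ω)))))      ≡⟨ cong (s ∘ A ∘ τ ∘ A ∘ τ) (trans (lift-fixed _ ω
                                            (subst (λ x → swap nothing (place g) x ≡ x) (sym e) (swap-other (λ ()) origin≢place)))
                                            (sym (set-coord ω e))) ⟩
          s (A (τ (A (τ ω°))))         ≡⟨ cong s B-origin ⟩
          s (set q (just origin) ω₁)   ≡⟨ trans (s-set _ h₁) (cong (λ x → set q x ω₁) (swap-other (λ ()) origin≢place)) ⟩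
          set q (just origin) ω₁       ≡⟨ set-coord ω₁ coord-ω₁ ⟩
          act g ω°                     ≡⟨ cong (act g) (set-coord ω e) ⟩
          act g ω                      ∎
          where open ≡-Reasoning
        by-coord (no _) (yes e) _ = begin
          s (A (τ (A (τ (s ω)))))                ≡⟨ cong (s ∘ A ∘ τ ∘ A ∘ τ) (trans (lift-above _ ω h)
                                                      (cong (λ x → set q x ω) (trans (cong (swap nothing (place g)) e) (swap-left _ _)))) ⟩
          s (A (τ (A (τ (set q (place g) ω)))))  ≡⟨ cong s B-place ⟩
          s (set q (place g) ω₁)                 ≡⟨ trans (s-set _ h₁) (cong (λ x → set q x ω₁) (swap-right _ _)) ⟩
          set q nothing ω₁                       ≡⟨ act-set g below ω° at-star (subst Neutral (sym (coord-set q _ ω)) at-origin) ⟨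
          act g (set q nothing ω°)               ≡⟨ cong (act g) (trans (set-set q _ _ ω) (set-coord ω e)) ⟩
          act g ω                                ∎
          where open ≡-Reasoning
        -- Here `s` trades the place for the second neutral value, which neither `A` nor `τ`
        -- changes, and g itself is blocked at its own place.
        by-coord (no ≢o) (no ≢n) (yes e) = begin
          s (A (τ (A (τ (s ω)))))                ≡⟨ cong (s ∘ A ∘ τ ∘ A ∘ τ) (trans (lift-above _ ω h)
                                                      (cong (λ x → set q x ω) (trans (cong (swap nothing (place g)) e) (swap-right _ _)))) ⟩
          s (A (τ (A (τ (set q nothing ω)))))    ≡⟨ cong (s ∘ A ∘ τ ∘ A) (trans (τ-set _ h)
                                                      (cong (λ x → set q x ω) (swap-other (λ ()) nothing≢place))) ⟩
          s (A (τ (A (set q nothing ω))))        ≡⟨ cong (s ∘ A ∘ τ) (A-free _ (neutral-free at-star)) ⟩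
          s (A (τ (set q nothing ω)))            ≡⟨ cong (s ∘ A) (trans (τ-set _ h)
                                                      (cong (λ x → set q x ω) (swap-other (λ ()) nothing≢place))) ⟩
          s (A (set q nothing ω))                ≡⟨ cong s (A-free _ (neutral-free at-star)) ⟩
          s (set q nothing ω)                    ≡⟨ trans (s-set _ h) (cong (λ x → set q x ω) (swap-left _ _)) ⟩
          set q (place g) ω                      ≡⟨ set-coord ω e ⟩
          ω                                      ≡⟨ act-above-idle g below ω (place-not-neutral ∘ subst Neutral e) ⟨
          act g ω                                ∎
          where open ≡-Reasoning
        by-coord (no ≢o) (no ≢n) (no ≢p) = begin
          s (A (τ (A (τ (s ω)))))   ≡⟨ cong (s ∘ A ∘ τ ∘ A ∘ τ) (lift-fixed _ ω (swap-other ≢n ≢p)) ⟩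
          s (A (τ (A (τ ω))))       ≡⟨ cong s (B-other ≢o ≢p) ⟩
          s ω                       ≡⟨ lift-fixed _ ω (swap-other ≢n ≢p) ⟩
          ω                         ≡⟨ act-above-idle g below ω not-neutral ⟨
          act g ω                   ∎
          where
          open ≡-Reasoning
          not-neutral : ¬ Neutral (coord q ω)
          not-neutral n = go n refl
            where
            go : ∀ {x} → Neutral x → ¬ (coord q ω ≡ x)
            go at-origin = ≢o
            go at-star   = ≢n

    module _ (M : I → List Gen → Set ℓ) (M-mono : ∀ {i j} → i σ.≤ j → ∀ {w} → M i w → M j w)
             (M-ε : ∀ {i} → M i []) (M-∙ : ∀ {i v w} → M i v → M i w → M i (v ++ w))
             (M-⁻¹ : ∀ {i w} → M i w → M i (reverse w)) (M-resp : ∀ {i v w} → v ≗ᵣ w → M i v → M i w)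
             (M-cover : ∀ w → ∃[ i ] M i w) where

      Performs : I → (Ω → Ω) → Set ℓ
      Performs i π = ∃[ w ] (M i w × (∀ ω → run w ω ≡ π ω))

      performs-mono : ∀ {i j} → i σ.≤ j → ∀ {π} → Performs i π → Performs j π
      performs-mono l (w , m , h) = w , M-mono l m , h

      performs-∘ : ∀ {i π ρ} → Performs i π → Performs i ρ → Performs i (π ∘ ρ)
      performs-∘ {π = π} (v , m , h) (w , m′ , h′) = v ++ w , M-∙ m m′ ,
        λ ω → trans (run-++ v w ω) (trans (h (run w ω)) (cong π (h′ ω)))

      performs-resp : ∀ {i π ρ} → (∀ ω → π ω ≡ ρ ω) → Performs i π → Performs i ρ
      performs-resp e (w , m , h) = w , m , λ ω → trans (h ω) (e ω)

      performs-gen : ∀ g → ∃[ i ] Performs i (act g)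
      performs-gen g = let i , m = M-cover [ g ] in i , [ g ] , m , λ _ → refl

      module Level-q (q : T.Carrier) where

        Lifts : I → (Coord → Coord) → Set ℓ
        Lifts i π = Performs i (lift q π)

        lifts-∘ : ∀ {i π ρ} → Lifts i π → Lifts i ρ → Lifts i (π ∘ ρ)
        lifts-∘ {π = π} {ρ} p r = performs-resp (lift-∘ π ρ) (performs-∘ p r)

        lifts-resp : ∀ {i π ρ} → (∀ x → π x ≡ ρ x) → Lifts i π → Lifts i ρ
        lifts-resp e = performs-resp (lift-cong e)

        lifts-id : ∀ {i} → Lifts i id
        lifts-id = [] , M-ε , λ ω → sym (lift-fixed id ω refl)

        swap-trans : ∀ {i x y z} → Lifts i (swap x y) → Lifts i (swap y z) → Lifts i (swap x z)
        swap-trans {i} {x} {y} {z} p r with em {P = x ≡ y} | em {P = y ≡ z} | em {P = x ≡ z}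
        ... | yes refl | _ | _        = r
        ... | no _ | yes refl | _     = p
        ... | no _ | no _ | yes refl  = lifts-resp (λ u → sym (swap-same x u)) lifts-id
        ... | no x≢y | no y≢z | no x≢z = lifts-resp (swap-triangle x≢y y≢z x≢z) (lifts-∘ p (lifts-∘ r p))

        -- Besides f, the stage must perform the transposition of the base point with its image
        -- under f. Carried through the commutator formula, this becomes a transposition of the base
        -- point with a mark, which is what `Recover` asks for. The inverse serves to conjugate.
        record C (i : I) (f : D → D) : Set ℓ where
          field
            f⁻¹     : D → D
            inverse : ∀ d → f (f⁻¹ d) ≡ d
            inverse′ : ∀ d → f⁻¹ (f d) ≡ d
            lifts   : Lifts i (Maybe.map f)
            lifts⁻¹ : Lifts i (Maybe.map f⁻¹)
            reaches : Lifts i (swap (just origin) (just (f origin)))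

        C-mono : ∀ {i j} → i σ.≤ j → ∀ {f} → C i f → C j f
        C-mono l c = record
          { f⁻¹ = f⁻¹ ; inverse = inverse ; inverse′ = inverse′
          ; lifts   = performs-mono l lifts
          ; lifts⁻¹ = performs-mono l lifts⁻¹
          ; reaches = performs-mono l reaches
          }
          where open C c

        map-inverse : ∀ {f g : D → D} → (∀ d → f (g d) ≡ d) → ∀ x → Maybe.map f (Maybe.map g x) ≡ x
        map-inverse h (just d) = cong just (h d)
        map-inverse h nothing  = refl

        map-∘ : ∀ (f g : D → D) x → Maybe.map f (Maybe.map g x) ≡ Maybe.map (f ∘ g) x
        map-∘ f g (just d) = refl
        map-∘ f g nothing  = refl

        C-∘ : ∀ {i f g} → C i f → C i g → C i (f ∘ g)
        C-∘ {i} {f} {g} c c′ = record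
          { f⁻¹      = c′.f⁻¹ ∘ c.f⁻¹
          ; inverse  = λ d → trans (cong f (c′.inverse (c.f⁻¹ d))) (c.inverse d)
          ; inverse′ = λ d → trans (cong c′.f⁻¹ (c.inverse′ (g d))) (c′.inverse′ d)
          ; lifts    = lifts-resp (map-∘ f g) (lifts-∘ c.lifts c′.lifts)
          ; lifts⁻¹  = lifts-resp (map-∘ c′.f⁻¹ c.f⁻¹) (lifts-∘ c′.lifts⁻¹ c.lifts⁻¹)
          -- Conjugating by f turns the transposition of `origin` and `g origin` into that of
          -- `f origin` and `f (g origin)`; combined with the transposition for f it gives the one
          -- for `f ∘ g`.
          ; reaches  = swap-trans c.reaches (lifts-resp
              (swap-conjugate (Maybe.map f) (Maybe.map c.f⁻¹) (map-inverse c.inverse) (map-inverse c.inverse′) _ _)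
              (lifts-∘ c.lifts (lifts-∘ c′.reaches c.lifts⁻¹)))
          }
          where
          module c = C c
          module c′ = C c′

        C-resp : ∀ {i f g} → (∀ d → f d ≡ g d) → C i f → C i g
        C-resp {i} {f} {g} e c = record
          { f⁻¹      = f⁻¹
          ; inverse  = λ d → trans (sym (e (f⁻¹ d))) (inverse d)
          ; inverse′ = λ d → trans (cong f⁻¹ (sym (e d))) (inverse′ d)
          ; lifts    = lifts-resp (λ { (just d) → cong just (e d) ; nothing → refl }) lifts
          ; lifts⁻¹  = lifts⁻¹
          ; reaches  = subst (λ d → Lifts i (swap (just origin) (just d))) (e origin) reaches
          }
          where open C c

        C-cover : ∀ r m → ∃[ i ] C i (toggle (move m) r r)
        C-cover r m = σ.max i j , record
          { f⁻¹      = toggle (move m) r r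
          ; inverse  = E.involutive (r , m)
          ; inverse′ = E.involutive (r , m)
          ; lifts    = flips
          ; lifts⁻¹  = flips
          ; reaches  = performs-mono (σ.≤-maxʳ i j) (performs-resp (act-lift (carry (r , m)) λ ()) (proj₂ carried))
          }
          where
          flipped = performs-gen (lev q (flip (r , m)))
          carried = performs-gen (lev q (carry (r , m)))
          i = proj₁ flipped
          j = proj₁ carried
          flips : Lifts (σ.max i j) (Maybe.map (toggle (move m) r r))
          flips = performs-mono (σ.≤-maxˡ i j) (performs-resp (act-lift (flip (r , m)) λ ()) (proj₂ flipped))

        opaque
          corners : ∃[ i ] (∀ x → C i (toggle (x ∷_) bot top))
          corners = toggle-corners C C-mono C-∘ C-resp C-cover

        -- The stage k is independent of g: `corners` gives the transpositions with all places
        -- simultaneously, and only the two generators `star` and `copy↓` are added to recover every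
        -- g below q.
        below-stage : ∃[ i ] (∀ g → Below q g → M i [ g ])
        below-stage = k , λ g b → contained g b
          where
          starred = performs-gen (lev q star)
          copied  = performs-gen (lev q copy↓)
          k = σ.max (proj₁ corners) (σ.max (proj₁ starred) (proj₁ copied))
          k₁ : proj₁ corners σ.≤ k
          k₁ = σ.≤-maxˡ _ _
          k₂ : proj₁ starred σ.≤ k
          k₂ = σ.≤-trans (σ.≤-maxˡ (proj₁ starred) (proj₁ copied)) (σ.≤-maxʳ (proj₁ corners) _)
          k₃ : proj₁ copied σ.≤ k
          k₃ = σ.≤-trans (σ.≤-maxʳ (proj₁ starred) (proj₁ copied)) (σ.≤-maxʳ (proj₁ corners) _)
          contained : ∀ g → Below q g → M k [ g ]
          contained g b = let w , m , h = performs in M-resp h m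
            where
            open Recover q g b
            τ-performed : Lifts k (swap (just origin) (place g))
            τ-performed = performs-mono k₁ (C.reaches (proj₂ corners (code g)))
            star-performed : Lifts k (swap (just origin) nothing)
            star-performed = performs-mono k₂ (performs-resp (act-lift star λ ()) (proj₂ starred))
            s-performed : Lifts k (swap nothing (place g))
            s-performed = swap-trans (lifts-resp swap-comm star-performed) τ-performed
              where
              swap-comm : ∀ x → swap (just origin) nothing x ≡ swap nothing (just origin) x
              swap-comm x with swap-view (just origin) nothing x
              ... | is-left      = trans (swap-left _ _) (sym (swap-right _ _))
              ... | is-right     = trans (swap-right _ _) (sym (swap-left _ _))
              ... | is-other p r = trans (swap-other p r) (sym (swap-other r p))
            A-performed : Performs k A
            A-performed = performs-mono k₃ (proj₂ copied)
            performs : Performs k (act g)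
            performs = performs-resp recovered (performs-∘ s-performed (performs-∘ A-performed
              (performs-∘ τ-performed (performs-∘ A-performed (performs-∘ τ-performed s-performed)))))

      below-≤ : ∀ {p q} g → Below p g → p T.≤ q → Below q g
      below-≤ (base _)  _ _ = tt
      below-≤ (lev _ _) b l = T.<-≤-trans b l

      gens-stage : ∃[ i ] (∀ q g → Below q g → M i [ g ])
      gens-stage = let i , h = exhaust σ T {P = λ _ → ⊤} (λ i q → ∀ g → Below q g → M i [ g ]) t₀
                                 (λ l h g b → M-mono l (h g b)) stage (no-map λ p → let q , l = T-unbounded p in q , tt , l)
                   in i , λ q → h tt
        where
        stage : ∀ {q} → ⊤ → ∃[ i ] (∀ {p} → p T.≤ q → ⊤ → ∀ g → Below p g → M i [ g ])
        stage {q} _ = let i , h = Level-q.below-stage q in i , λ l _ g b → h g (below-≤ g b l)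

      total : ∃[ i ] (∀ w → M i w)
      total = proj₁ gens-stage , all
        where
        gen : ∀ g → M (proj₁ gens-stage) [ g ]
        gen (base c)  = proj₂ gens-stage t₀ (base c) tt
        gen (lev p l) = let q , p<q = T-unbounded p in proj₂ gens-stage q (lev p l) p<q
        all : ∀ w → M (proj₁ gens-stage) w
        all []      = M-ε
        all (g ∷ w) = M-∙ (gen g) (all w)

-- Cardinality of the tower, the embedding of G, and indecomposability.

module Assembly where

  open import Algebra.Bundles using (Group)
  import Algebra.Properties.Group as GroupProperties
  open import Axiom.ExcludedMiddle using (ExcludedMiddle)
  open import Data.Bool.Base using (Bool; true; false)
  open import Data.Fin.Base using (Fin; toℕ)
  open import Data.Fin.Properties using (toℕ-injective)
  open import Data.List.Base using (List; []; _∷_; _++_; reverse)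
  open import Data.Nat.Base as ℕ using (ℕ)
  open import Data.Product using (∃-syntax; _×_; _,_; proj₁; proj₂)
  open import Data.Sum.Base using (_⊎_; inj₁; inj₂)
  open import Data.Unit.Base using (⊤; tt)
  open import Function.Base using (_∘_; id)
  open import Function.Bundles using (Bijection)
  open import Level using (Level; _⊔_)
  open import Relation.Binary.Bundles using (Setoid)
  open import Relation.Binary.PropositionalEquality using (_≡_; refl; sym; trans; cong; cong₂; subst; subst₂)
  open import Relation.Nullary using (¬_; yes; no)
  open import Relation.Unary using (_∩_; ∁)
  open import Defs
  open WellOrders
  open Sizes
  open Stages
  open JonssonAlgebras
  open Cardinals
  open Cofinalities
  open InvolutionGroups
  open Reflections
  open Toggles
  open Towers
  open TowerFiniteness
  open TowerChains

  module Coding {ℓ : Level} {X : Set ℓ} (point : ℕ → X) (point-inj : ∀ {m n} → point m ≡ point n → m ≡ n)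
                (pair : X → X → X) (pair-inj : ∀ {x y x′ y′} → pair x y ≡ pair x′ y′ → x ≡ x′ × y ≡ y′) where

    record Coded {a : Level} (A : Set a) : Set (a ⊔ ℓ) where
      field
        code     : A → X
        code-inj : ∀ {x y} → code x ≡ code y → x ≡ y

    open Coded public

    coded-ℕ : Coded ℕ
    coded-ℕ = record { code = point ; code-inj = point-inj }

    coded-⊤ : Coded ⊤
    coded-⊤ = record { code = λ _ → point 0 ; code-inj = λ _ → refl }

    coded-retract : ∀ {a b} {A : Set a} {B : Set b} (f : A → B) (g : B → A) → (∀ x → g (f x) ≡ x) → Coded B → Coded A
    coded-retract f g gf c = record
      { code     = code c ∘ f
      ; code-inj = λ {x} {y} e → trans (sym (gf x)) (trans (cong g (code-inj c e)) (gf y))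
      }

    coded-× : ∀ {a b} {A : Set a} {B : Set b} → Coded A → Coded B → Coded (A × B)
    coded-× c d = record
      { code     = λ (x , y) → pair (code c x) (code d y)
      ; code-inj = λ e → let e₁ , e₂ = pair-inj e in cong₂ _,_ (code-inj c e₁) (code-inj d e₂)
      }

    coded-⊎ : ∀ {a b} {A : Set a} {B : Set b} → Coded A → Coded B → Coded (A ⊎ B)
    coded-⊎ {A = A} {B} c d = record { code = f ; code-inj = f-inj }
      where
      f : A ⊎ B → X
      f (inj₁ x) = pair (point 0) (code c x)
      f (inj₂ y) = pair (point 1) (code d y)
      f-inj : ∀ {x y} → f x ≡ f y → x ≡ y
      f-inj {inj₁ _} {inj₁ _} e = cong inj₁ (code-inj c (proj₂ (pair-inj e)))
      f-inj {inj₂ _} {inj₂ _} e = cong inj₂ (code-inj d (proj₂ (pair-inj e)))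
      f-inj {inj₁ _} {inj₂ _} e with () ← point-inj (proj₁ (pair-inj e))
      f-inj {inj₂ _} {inj₁ _} e with () ← point-inj (proj₁ (pair-inj e))

    coded-List : ∀ {a} {A : Set a} → Coded A → Coded (List A)
    coded-List {A = A} c = record { code = f ; code-inj = f-inj }
      where
      f : List A → X
      f []       = pair (point 0) (point 0)
      f (x ∷ xs) = pair (point 1) (pair (code c x) (f xs))
      f-inj : ∀ {xs ys} → f xs ≡ f ys → xs ≡ ys
      f-inj {[]}     {[]}     _ = refl
      f-inj {x ∷ xs} {y ∷ ys} e = let e₁ , e₂ = pair-inj (proj₂ (pair-inj e)) in cong₂ _∷_ (code-inj c e₁) (f-inj e₂)
      f-inj {[]}     {_ ∷ _}  e with () ← point-inj (proj₁ (pair-inj e))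
      f-inj {_ ∷ _}  {[]}     e with () ← point-inj (proj₁ (pair-inj e))

  module Construction (em : ∀ {a} → ExcludedMiddle a) (ac : AxiomOfChoice) {ℓ : Level} (lam θ : Cardinal ℓ)
    (lam-uncountable : Uncountable ∣ lam ∣) (θ-regular : Regular θ) (θ≲lam : ∣ θ ∣ ≲ ∣ lam ∣)
    (G : Group ℓ ℓ) (G-locallyFinite : LocallyFinite G) (G≃lam : Group.setoid G ≃ ∣ lam ∣) where

    open LEM em
    open Cardinality em
    open Comparison em
    open Canonical em ac
    open Cofinality em ac
    private
      module G = Group G

    Λ T : WellOrder ℓ
    Λ = ordinal lam
    T = ordinal θ

    lam-infinite : Infinite {A = Canon ∣ lam ∣} Full
    lam-infinite = infinite lam λ (n , b) → lam-uncountable (≲-trans (Bijection.injection b) (record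
      { to = toℕ ; cong = cong toℕ ; injective = toℕ-injective }))

    open Algebra em Λ lam-infinite (ordinal-initial lam) using (op; Admissible; module Chain)
    open Reflection em ac G G-locallyFinite using (strict; reflections; reflections-bounded; reflect; reflect-product; class-∙; class-ε)

    T-unbounded : ∀ p → ∃[ q ] WellOrder._<_ T p q
    T-unbounded = no-maximum θ θ-regular

    t₀ : Canon ∣ θ ∣
    t₀ = _≼_.to (infinite θ (proj₁ θ-regular)) 0

    open Tower em ac T (Canon ∣ lam ∣) op reflections
    open Toggle em ac T (Canon ∣ lam ∣) op using (Row; bot; mid; top; end; Move; stay; push; eval)

    squared : Full {A = Canon ∣ lam ∣ × Canon ∣ lam ∣} ≼ Full {A = Canon ∣ lam ∣}
    squared = square-full Λ lam-infinite (λ x _ → ordinal-initial lam x)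

    pair : Canon ∣ lam ∣ → Canon ∣ lam ∣ → Canon ∣ lam ∣
    pair x y = _≼_.to squared (x , y)

    pair-injective : ∀ {x y x′ y′} → pair x y ≡ pair x′ y′ → x ≡ x′ × y ≡ y′
    pair-injective e = let e′ = _≼_.to-inj squared tt tt e in cong proj₁ e′ , cong proj₂ e′

    open Coding (_≼_.to lam-infinite) (_≼_.to-inj lam-infinite tt tt) pair pair-injective

    coded-≼ : ∀ {A : Set ℓ} → Full {A = A} ≼ Full {A = Canon ∣ lam ∣} → Coded A
    coded-≼ (inj f _ f-inj) = record { code = f ; code-inj = f-inj tt tt }

    coded-Row : Coded Row
    coded-Row = coded-retract to from (λ { bot → refl ; (mid _) → refl ; top → refl ; end → refl })
                  (coded-⊎ coded-ℕ (coded-≼ (≲⇒≼ θ≲lam)))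
      where
      to : Row → ℕ ⊎ Canon ∣ θ ∣
      to bot     = inj₁ 0
      to top     = inj₁ 1
      to end     = inj₁ 2
      to (mid p) = inj₂ p
      from : ℕ ⊎ Canon ∣ θ ∣ → Row
      from (inj₁ 0) = bot
      from (inj₁ 1) = top
      from (inj₁ _) = end
      from (inj₂ p) = mid p

    coded-Move : Coded Move
    coded-Move = coded-retract to from (λ { stay → refl ; (push _) → refl ; (eval _) → refl })
                   (coded-⊎ coded-⊤ (coded-⊎ (coded-≼ (inj id (λ _ → tt) λ _ _ e → e)) (record
                     { code = λ k → code coded-ℕ (toℕ k) ; code-inj = λ e → toℕ-injective (code-inj coded-ℕ e) })))
      where
      to : Move → ⊤ ⊎ (Canon ∣ lam ∣ ⊎ Fin 5)
      to stay     = inj₁ tt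
      to (push x) = inj₂ (inj₁ x)
      to (eval k) = inj₂ (inj₂ k)
      from : ⊤ ⊎ (Canon ∣ lam ∣ ⊎ Fin 5) → Move
      from (inj₁ _)        = stay
      from (inj₂ (inj₁ x)) = push x
      from (inj₂ (inj₂ k)) = eval k

    coded-Generator : Coded Generator
    coded-Generator = coded-retract to from (λ { (flip _) → refl ; (carry _) → refl ; star → refl ; copy↓ → refl })
                        (coded-⊎ coded-ℕ (coded-⊎ toggle-code toggle-code))
      where
      toggle-code : Coded (Row × Move)
      toggle-code = coded-× coded-Row coded-Move
      to : Generator → ℕ ⊎ ((Row × Move) ⊎ (Row × Move))
      to star      = inj₁ 0
      to copy↓     = inj₁ 1
      to (flip g)  = inj₂ (inj₁ g)
      to (carry g) = inj₂ (inj₂ g)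
      from : ℕ ⊎ ((Row × Move) ⊎ (Row × Move)) → Generator
      from (inj₁ 0)        = star
      from (inj₁ _)        = copy↓
      from (inj₂ (inj₁ g)) = flip g
      from (inj₂ (inj₂ g)) = carry g

    coded-Gen : Coded Gen
    coded-Gen = coded-retract to from (λ { (base _) → refl ; (lev _ _) → refl })
                  (coded-⊎ (coded-× coded-Bool (coded-≼ (≲⇒≼ (Bijection.injection G≃lam))))
                           (coded-× (coded-≼ (≲⇒≼ θ≲lam)) coded-Generator))
      where
      coded-Bool : Coded Bool
      coded-Bool = coded-retract (λ { true → 1 ; false → 0 }) (λ { 0 → false ; _ → true })
                     (λ { true → refl ; false → refl }) coded-ℕ
      to : Gen → (Bool × Canon G.setoid) ⊎ (Canon ∣ θ ∣ × Generator)
      to (base c)  = inj₁ c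
      to (lev p l) = inj₂ (p , l)
      from : (Bool × Canon G.setoid) ⊎ (Canon ∣ θ ∣ × Generator) → Gen
      from (inj₁ c)       = base c
      from (inj₂ (p , l)) = lev p l

    opaque
      gen-code : Gen → Canon ∣ lam ∣
      gen-code = code coded-Gen

      gen-code-injective : ∀ {g h} → gen-code g ≡ gen-code h → g ≡ h
      gen-code-injective = code-inj coded-Gen

    open Action gen-code gen-code-injective using (tower; act; act-base; act-base-idle)
    open Involutions tower using (run; run-++; group; locallyFinite)
    private module H = Group group

    H-locallyFinite : LocallyFinite group
    H-locallyFinite = locallyFinite em (TowerFinite.tower-finite em ac T T-unbounded t₀ (Canon ∣ lam ∣) op
      reflections reflections-bounded gen-code gen-code-injective)

    opaque
      coded-word : Coded (List Gen)
      coded-word = coded-List coded-Gen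

    private
      module Least = WellOrder.Minimum Λ em (_≼_.to lam-infinite 0)

    Names : List Gen → Canon ∣ lam ∣ → Set ℓ
    Names w c = ∃[ u ] ((∀ ω → run u ω ≡ run w ω) × code coded-word u ≡ c)

    -- The least code among the words that act alike, so that equal elements of H receive equal
    -- indices.
    index : List Gen → Canon ∣ lam ∣
    index w = Least.μ (Names w)

    index-names : ∀ w → Names w (index w)
    index-names w = Least.μ-sat (Names w) (code coded-word w , w , (λ _ → refl) , refl)

    index-cong : ∀ {v w} → (∀ ω → run v ω ≡ run w ω) → index v ≡ index w
    index-cong h = Least.μ-cong (λ c (u , k , e) → u , (λ ω → trans (k ω) (h ω)) , e)
                                (λ c (u , k , e) → u , (λ ω → trans (k ω) (sym (h ω))) , e)

    index-injective : ∀ {v w} → index v ≡ index w → ∀ ω → run v ω ≡ run w ω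
    index-injective {v} {w} e = compare-names (index-names v) (index-names w)
      where
      compare-names : Names v (index v) → Names w (index w) → ∀ ω → run v ω ≡ run w ω
      compare-names (u , k , p) (u′ , k′ , p′) ω with code-inj coded-word (trans p (trans e (sym p′)))
      ... | refl = trans (sym (k ω)) (k′ ω)

    H≲lam : H.setoid ≲ ∣ lam ∣
    H≲lam = record
      { to        = λ w → out (index w)
      ; cong      = λ {v} {w} h → Setoid.reflexive ∣ lam ∣ (cong out (index-cong {v} {w} h))
      ; injective = λ {v} {w} e → index-injective {v} {w} (out-injective {S = ∣ lam ∣} e)
      }

    private
      module S = Group strict

    -- The product of the two reflections for g: left multiplication by g on the ground wherever all
    -- coordinates are neutral, and the identity elsewhere.
    embed : G.Carrier → List Gen
    embed g = base (true , class g) ∷ base (false , class g) ∷ []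

    embed-neutral : ∀ g ω → (∀ r → Neutral (coord r ω)) → run (embed g) ω ≡ setBase (class g S.∙ ground ω) ω
    embed-neutral g ω h = trans (cong (act (base (true , class g))) (act-base (false , class g) ω h))
      (trans (act-base (true , class g) _ λ r → subst Neutral (sym (coord-setBase r _ ω)) (h r))
        (Ω-ext (trans (ground-setBase _ _) (trans (cong (reflect (class g) true) (ground-setBase _ ω))
                 (trans (reflect-product (class g) (ground ω)) (sym (ground-setBase _ ω)))))
               λ r → trans (coord-setBase r _ _) (trans (coord-setBase r _ ω) (sym (coord-setBase r _ ω)))))

    embed-idle : ∀ g ω → ¬ (∀ r → Neutral (coord r ω)) → run (embed g) ω ≡ ω
    embed-idle g ω ¬h = trans (cong (act (base (true , class g))) (act-base-idle _ ω ¬h)) (act-base-idle _ ω ¬h)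

    embed-∙ : ∀ g h → embed (g G.∙ h) H.≈ embed g ++ embed h
    embed-∙ g h ω with em {P = ∀ r → Neutral (coord r ω)}
    ... | no ¬n = trans (embed-idle _ ω ¬n) (sym (trans (run-++ (embed g) (embed h) ω)
                    (trans (cong (run (embed g)) (embed-idle h ω ¬n)) (embed-idle g ω ¬n))))
    ... | yes n = trans (embed-neutral _ ω n) (sym (trans (run-++ (embed g) (embed h) ω)
        (trans (cong (run (embed g)) (embed-neutral h ω n))
          (trans (embed-neutral g _ λ r → subst Neutral (sym (coord-setBase r _ ω)) (n r))
            (Ω-ext (trans (ground-setBase _ _) (trans (cong (class g S.∙_) (ground-setBase _ ω))
                     (trans (sym (S.assoc (class g) (class h) (ground ω)))
                       (trans (cong (S._∙ ground ω) (sym (class-∙ g h))) (sym (ground-setBase _ ω))))))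
                   λ r → trans (coord-setBase r _ _) (trans (coord-setBase r _ ω) (sym (coord-setBase r _ ω))))))))

    embed-ε : embed G.ε H.≈ []
    embed-ε ω with em {P = ∀ r → Neutral (coord r ω)}
    ... | no ¬n = embed-idle _ ω ¬n
    ... | yes n = trans (embed-neutral _ ω n) (Ω-ext
          (trans (ground-setBase _ ω) (trans (cong (S._∙ ground ω) class-ε) (S.identityˡ (ground ω))))
          λ r → coord-setBase r _ ω)

    embed-cong : ∀ {g h} → g G.≈ h → embed g H.≈ embed h
    embed-cong e ω = cong (λ c → run (base (true , c) ∷ base (false , c) ∷ []) ω) (class-cong e)

    embed-injective : ∀ {g h} → embed g H.≈ embed h → g G.≈ h
    embed-injective {g} {h} e = class-injective {S = G.setoid} (trans (sym (S.identityʳ (class g)))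
      (trans (at-ε g) (trans (cong ground (e ω)) (trans (sym (at-ε h)) (S.identityʳ (class h))))))
      where
      -- Every coordinate has the second neutral value and the ground is the unit, so the image of
      -- this point reveals g.
      ω : Ω
      ω = vacant-point S.ε
      neutral : ∀ r → Neutral (coord r ω)
      neutral r = subst Neutral (sym (coord-vacant S.ε r)) at-star
      at-ε : ∀ g → class g S.∙ S.ε ≡ ground (run (embed g) ω)
      at-ε g = sym (trans (cong ground (embed-neutral g ω neutral))
        (trans (ground-setBase _ ω) (cong (class g S.∙_) (ground-vacant S.ε))))

    embed-⁻¹ : ∀ g → embed (g G.⁻¹) H.≈ reverse (embed g)
    embed-⁻¹ g = inverseˡ-unique (embed (g G.⁻¹)) (embed g)
      (H.trans {embed (g G.⁻¹) ++ embed g} {embed (g G.⁻¹ G.∙ g)} {[]}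
        (H.sym {embed (g G.⁻¹ G.∙ g)} {embed (g G.⁻¹) ++ embed g} (embed-∙ (g G.⁻¹) g))
        (H.trans {embed (g G.⁻¹ G.∙ g)} {embed G.ε} {[]} (embed-cong (G.inverseˡ g)) embed-ε))
      where open GroupProperties group using (inverseˡ-unique)

    H-extends : group Extends G
    H-extends = embed , record
      { isGroupHomomorphism = record
        { isMonoidHomomorphism = record
          { isMagmaHomomorphism = record
            { isRelHomomorphism = record { cong = embed-cong }
            ; homo = embed-∙
            }
          ; ε-homo = embed-ε
          }
        ; ⁻¹-homo = embed-⁻¹
        }
      ; injective = embed-injective
      }

    H≃lam : H.setoid ≃ ∣ lam ∣
    H≃lam = cantor-bernstein H≲lam (≲-trans (≃⇒≳ G≃lam) (record
      { to = embed ; cong = embed-cong ; injective = embed-injective }))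

    H-indecomposable : IndecomposableFor group (Θ′ lam ∩ ∁ (Θ lam θ))
    H-indecomposable σ ((σ≺lam , σ-regular , _) , σ∉Θ) M M-subgroup M-mono M-cover =
      out (proj₁ stage) , proj₂ stage
      where
      module σ = Cardinal σ
      module I = WellOrder (ordinal σ)
      i₀ : Canon ∣ σ ∣
      i₀ = _≼_.to (infinite σ (proj₁ σ-regular)) 0
      no-map : ∀ {P : Canon ∣ θ ∣ → Set ℓ} → (∀ p → ∃[ q ] (P q × WellOrder._<_ T p q)) → ¬ CofinalMap (ordinal σ) T P
      no-map unb h = no-map-θ lam θ σ lam-infinite σ≺lam σ-regular σ∉Θ θ-regular record
        { map      = map
        ; map-in   = λ _ → tt
        ; monotone = monotone
        ; cofinal  = λ {x} _ → let q , Pq , x<q = unb x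
                                   i , q<i = cofinal Pq in i , WellOrder.<-trans T {x} {q} {map i} x<q q<i
        }
        where open CofinalMap h
      mono : ∀ {i j} → i I.≤ j → ∀ {w} → member (M (out i)) w → member (M (out j)) w
      mono {i} {j} l = M-mono (≤⇒NonStrict σ (subst₂ I._≤_ (sym (class-out i)) (sym (class-out j)) l))
      stage = TowerChain.total em ac T T-unbounded t₀ (Canon ∣ lam ∣) op reflections
        gen-code gen-code-injective (ordinal σ) i₀ no-map
        (λ U U-mono U-cover i₁ closed →
          Chain.total (ordinal σ) (admissible lam θ σ lam-infinite σ≺lam σ-regular σ∉Θ) U U-mono U-cover i₁ closed)
        (λ i → member (M (out i))) (λ {i} {j} → mono {i} {j})
        (λ {i} → IsSubgroup.ε-closed (M-subgroup (out i)))
        (λ {i} → IsSubgroup.∙-closed (M-subgroup (out i)))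
        (λ {i} → IsSubgroup.⁻¹-closed (M-subgroup (out i)))
        (λ {i} {v} {w} e → respect (M (out i)) {v} {w} e)
        (λ w → let i , m = M-cover w in class i , M-mono (inj₂ (Setoid.sym ∣ σ ∣ (out-class {S = ∣ σ ∣} i))) m)

open import Algebra.Bundles using (Group)
open import Axiom.ExcludedMiddle using (ExcludedMiddle)
open import Data.Product using (Σ-syntax; _×_; _,_)
open import Level using (Level)
open import Relation.Unary using (_∩_; ∁)
open import Defs
open Assembly using (module Construction)

mainTheorem7 : (∀ {a} → ExcludedMiddle a) →
    AxiomOfChoice →
    ∀ {ℓ : Level} (lam θ : Cardinal ℓ) →
    Uncountable ∣ lam ∣ →
    Regular θ →
    ∣ θ ∣ ≲ ∣ lam ∣ →
    (G : Group ℓ ℓ) →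
    LocallyFinite G →
    Group.setoid G ≃ ∣ lam ∣ →
    Σ[ H ∈ Group ℓ ℓ ]
    (LocallyFinite H × Group.setoid H ≃ ∣ lam ∣ × H Extends G ×
    IndecomposableFor H (Θ′ lam ∩ ∁ (Θ lam θ)))
mainTheorem7 em ac lam θ uncountable regular θ≲lam G finite G≃lam =
  _ , H-locallyFinite , H≃lam , H-extends , H-indecomposable
  where open Construction em ac lam θ uncountable regular θ≲lam G finite G≃lam
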